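{- For every integer $\delta \geq 0$ there exists an integer $k$ such that every $C_4$-free odd-signable graph with maximum degree at most $\delta$ has treewidth at most $k$.
   Context: All graphs are finite and simple. A hole is an induced cycle of length at least four. A graph is $C_4$-free if it has no induced subgraph isomorphic to the cycle on four vertices. A graph $G$ is odd-signable if there is an assignment of weights in $\{0,1\}$ to the edges of $G$ such that every triangle and every hole of $G$ has odd total weight. A tree decomposition of $G$ is a pair $(T,\chi)$ where $T$ is a tree and $\chi: V(T)\to 2^{V(G)}$ such that every vertex of $G$ lies in some $\chi(t)$, every edge of $G$ has both ends in some $\chi(t)$, and for every $v\in V(G)$ the set $\{t : v\in \chi(t)\}$ induces a connected subtree of $T$; its width is $\max_t |\chi(t)|-1$, and the treewidth of $G$ is the minimum width of a tree decomposition of $G$. -}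

module Defs where

open import Data.Nat using (ℕ; zero; suc; _≤_; _<_; _%_; s≤s)
open import Data.Nat.Properties using (_≟_; ≤∧≢⇒<)
open import Data.Fin using (Fin; toℕ; fromℕ<)
open import Data.Fin.Properties using (toℕ<n)
open import Data.Fin.Subset using (Subset; _∈_; ∣_∣)
open import Data.Bool using (Bool; true; false; if_then_else_)
open import Data.List using (map; allFin)
open import Data.Nat.ListAction using (sum)
open import Data.Product using (_×_; Σ; ∃; ∃-syntax; _,_)
open import Data.Sum using (_⊎_)
open import Data.Unit using (⊤)
open import Relation.Nullary using (¬_; yes; no)
open import Relation.Binary.PropositionalEquality using (_≡_)
open import Function.Definitions using (Injective)

record Graph (n : ℕ) : Set where
  field
    adj    : Fin n → Fin n → Bool
    sym    : ∀ u v → adj u v ≡ adj v u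
    irrefl : ∀ v → adj v v ≡ false
open Graph public

next : ∀ {k} → Fin (suc k) → Fin (suc k)
next {k} i with toℕ i ≟ k
... | yes _ = Fin.zero
... | no ne = fromℕ< (s≤s (≤∧≢⇒< (Data.Nat.Properties.≤-pred (toℕ<n i)) ne))
  where import Data.Nat.Properties

IsInducedCycle : ∀ {n} (G : Graph n) (k : ℕ) → (Fin (suc k) → Fin n) → Set
IsInducedCycle G k c =
  Injective _≡_ _≡_ c ×
  (∀ i j → adj G (c i) (c j) ≡ true → (j ≡ next i ⊎ i ≡ next j)) ×
  (∀ i j → (j ≡ next i ⊎ i ≡ next j) → adj G (c i) (c j) ≡ true)

IsHole : ∀ {n} (G : Graph n) (k : ℕ) → (Fin (suc k) → Fin n) → Set
IsHole G k c = 3 ≤ k × IsInducedCycle G k c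

IsTriangle : ∀ {n} (G : Graph n) → (Fin 3 → Fin n) → Set
IsTriangle G c = IsInducedCycle G 2 c

C4Free : ∀ {n} → Graph n → Set
C4Free {n} G = ∀ (c : Fin 4 → Fin n) → ¬ IsInducedCycle G 3 c

cycleWeight : ∀ {n k} → (Fin n → Fin n → ℕ) → (Fin (suc k) → Fin n) → ℕ
cycleWeight w c = sum (map (λ i → w (c i) (c (next i))) (allFin _))

OddSignable : ∀ {n} → Graph n → Set
OddSignable {n} G =
  Σ (Fin n → Fin n → ℕ) λ w →
    (∀ u v → w u v ≤ 1) ×
    (∀ u v → w u v ≡ w v u) ×
    (∀ (c : Fin 3 → Fin n) → IsTriangle G c → cycleWeight w c % 2 ≡ 1) ×
    (∀ k (c : Fin (suc k) → Fin n) → IsHole G k c → cycleWeight w c % 2 ≡ 1)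

degree : ∀ {n} → Graph n → Fin n → ℕ
degree G v = sum (map (λ u → if adj G v u then 1 else 0) (allFin _))

MaxDegree≤ : ∀ {n} → Graph n → ℕ → Set
MaxDegree≤ G δ = ∀ v → degree G v ≤ δ

data Walk {m} (T : Graph m) (P : Fin m → Set) : Fin m → Fin m → Set where
  here : ∀ {v} → P v → Walk T P v v
  step : ∀ {u w v} → P u → adj T u w ≡ true → Walk T P w v → Walk T P u v

Connected : ∀ {m} → Graph m → Set
Connected T = ∀ s t → Walk T (λ _ → ⊤) s t

HasCycle : ∀ {m} → Graph m → Set
HasCycle {m} T = ∃[ k ] Σ (Fin (suc k) → Fin m) λ c →
  2 ≤ k × Injective _≡_ _≡_ c × (∀ i → adj T (c i) (c (next i)) ≡ true)

IsTree : ∀ {m} → Graph m → Set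
IsTree {m} T = 1 ≤ m × Connected T × ¬ HasCycle T

record TreeDecomposition {n} (G : Graph n) : Set where
  field
    m      : ℕ
    T      : Graph m
    χ      : Fin m → Subset n
    isTree : IsTree T
    cover  : ∀ v → ∃[ t ] v ∈ χ t
    edges  : ∀ u v → adj G u v ≡ true → ∃[ t ] (u ∈ χ t × v ∈ χ t)
    subtree : ∀ v s t → v ∈ χ s → v ∈ χ t → Walk T (λ r → v ∈ χ r) s t

widthAtMost : ∀ {n} {G : Graph n} → TreeDecomposition G → ℕ → Set
widthAtMost D k = ∀ t → ∣ TreeDecomposition.χ D t ∣ ≤ suc k

TreewidthAtMost : ∀ {n} → Graph n → ℕ → Set
TreewidthAtMost G k = Σ (TreeDecomposition G) λ D → widthAtMost D k

{-# OPTIONS --safe #-}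
-- Parity excludes thetas and prisms: the holes of a theta, or the holes and triangles of a prism, would have an odd total
-- weight although every edge is counted twice.  Consequently a pyramid with apex a and base b₀b₁b₂ is a separator: if X
-- contains the neighbourhoods of a, of its three neighbours on the paths and of the base, a path outside X between two of the
-- three paths would create a theta or a prism.
--
-- A graph without long pyramids has bounded treewidth.  In the tree of the components of the distance layers around a vertex,
-- a layer of a component is covered by two balls of bounded radius; otherwise three of its vertices are far apart, and the
-- three shortest paths from them towards the root, joined above and below by a claw or a triangle, form a theta, a prism or a
-- long pyramid.
--
-- Long pyramids are eliminated one pair of colours (of a and b₀) at a time, for a colouring in which vertices of equal colour
-- are far apart.  For a fixed pair, the balls of radius 2 around the vertices with these colours form disjoint connected cells
-- of bounded size, and bags are measured in cells.  A pyramid splits the graph at the two cells of a and b₀ into three parts,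
-- one for each of two paths and the rest.  Each part, extended by a segment of another path linking the two cells, is a smaller
-- induced subgraph; contracting the segment puts both cells into one bag, so the three decompositions can be glued.
module Submission where

open import Defs hiding (sym)
open import Data.Bool using (Bool; true; false; not; if_then_else_; _∧_; _xor_)
open import Data.Bool.Properties using (xor-same) renaming (_≟_ to _≟ᵇ_)
open import Data.Empty using (⊥; ⊥-elim)
open import Data.Fin using (Fin; toℕ; fromℕ; fromℕ<; inject₁; splitAt; _↑ˡ_; _↑ʳ_) renaming (suc to fsuc)
open import Data.Fin.Patterns using (0F; 1F; 2F)
open import Data.Fin.Properties using (any?; injective⇒≤; splitAt-↑ˡ; splitAt-↑ʳ; splitAt⁻¹-↑ˡ; splitAt⁻¹-↑ʳ;
  toℕ-injective; toℕ-inject₁; toℕ-fromℕ; toℕ-fromℕ<; toℕ<n) renaming (_≟_ to _≟ᶠ_)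
open import Data.Fin.Subset using (Subset; ∣_∣; ⁅_⁆; _∪_) renaming (_∈_ to _∈ˢ_; ⊥ to ∅)
open import Data.Fin.Subset.Properties using (x∈⁅x⁆; x∈⁅y⁆⇒x≡y; x∈p∪q⁺; x∈p∪q⁻; ∉⊥; ∣⊥∣≡0; ∣⁅x⁆∣≡1)
open import Data.List using (List; []; _∷_; _++_; _∷ʳ_; length; reverse; map; lookup; filter; concatMap; tabulate; allFin; cartesianProduct)
open import Data.List.Membership.Propositional using (_∈_; find; lose)
open import Data.List.Membership.Propositional.Properties using (∈-++⁺ˡ; ∈-++⁺ʳ; ∈-++⁻; ∈-map⁺; ∈-concatMap⁺; ∈-concatMap⁻;
  ∈-filter⁺; ∈-filter⁻; ∈-allFin; ∈-lookup; ∈-cartesianProduct⁺)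
open import Data.List.Properties using (++-assoc; length-++; length-map; length-filter; length-tabulate; map-tabulate; tabulate-cong;
  unfold-reverse; reverse-++; ∷-injectiveˡ)
open import Data.List.Relation.Unary.All as All using (All; []; _∷_)
open import Data.List.Relation.Unary.All.Properties using (¬Any⇒All¬; ++⁺; ++⁻ˡ; ++⁻ʳ; ∷ʳ⁺)
open import Data.List.Relation.Unary.Any as Any using (Any; here; there)
open import Data.List.Relation.Unary.Any.Properties using (reverse⁻; lookup-index)
open import Data.Nat using (ℕ; zero; suc; _+_; _*_; _∸_; _≤_; _<_; _%_; z≤n; s≤s)
open import Data.Nat.DivMod using ([m+n]%n≡m%n)
open import Data.Nat.Induction using (<-wellFounded)
open import Data.Nat.ListAction using (sum)
import Data.Nat.Properties as ℕP
open import Data.Nat.Tactic.RingSolver using (solve-∀)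
open import Data.Product using (_×_; Σ; ∃-syntax; _,_; proj₁; proj₂; map₂)
open import Data.Sum using (_⊎_; inj₁; inj₂; [_,_]′; reduce; swap)
open import Data.Unit using (⊤; tt)
open import Data.Vec using ([]; _∷_)
open import Function using (_∘_; id)
open import Induction.WellFounded using (Acc; acc)
open import Relation.Binary using (IsEquivalence)
open import Relation.Binary.PropositionalEquality using (_≡_; _≢_; refl; sym; trans; cong; cong₂; subst; subst₂; module ≡-Reasoning)
open import Relation.Nullary using (¬_; Dec; yes; no)
open import Relation.Nullary.Decidable using (¬?; _×-dec_; _⊎-dec_; ⌊_⌋; map′; decidable-stable)
open import Relation.Unary using (Decidable)

-- The splitting along pyramids of one colour pair has unbounded depth, so a step must not enlarge
-- the bags at all. Counted in cells it does not: the segment linking the two cells is connected,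
-- and each representative lying in it is replaced by `b₀`, one for one. Returning to vertices costs
-- the factor `ballBound δ 8` once per colour pair, and the number of pairs depends on `δ` alone. A
-- part with its segment is smaller than the whole because another one of the three paths contains a
-- vertex outside it: that path is too long to fit into two cells. Induced subgraphs are decidable
-- predicates on one fixed graph, so the signing, the degree bound and the colouring serve all of
-- them; only balls and cells are taken inside the subgraph. Thetas and prisms are given by regions
-- that contain walks, and shortcuts produce the induced paths, so the constructions only have to
-- exhibit walks and to check adjacency between regions.

module _ {m : ℕ} {T : Graph m} where

  adj-sym : ∀ {u v} → adj T u v ≡ true → adj T v u ≡ true
  adj-sym {u} {v} e = trans (Graph.sym T v u) e

  walk-map : ∀ {P Q : Fin m → Set} → (∀ {x} → P x → Q x) → ∀ {u v} → Walk T P u v → Walk T Q u v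
  walk-map f (here p) = here (f p)
  walk-map f (step p e w) = step (f p) e (walk-map f w)

  walk-++ : ∀ {P : Fin m → Set} {u v w} → Walk T P u v → Walk T P v w → Walk T P u w
  walk-++ (here _) w = w
  walk-++ (step p e w′) w = step p e (walk-++ w′ w)

  walk-source : ∀ {P : Fin m → Set} {u v} → Walk T P u v → P u
  walk-source (here p) = p
  walk-source (step p _ _) = p

  walk-target : ∀ {P : Fin m → Set} {u v} → Walk T P u v → P v
  walk-target (here p) = p
  walk-target (step _ _ w) = walk-target w

  walk-snoc : ∀ {P : Fin m → Set} {u v w} → Walk T P u v → adj T v w ≡ true → P w → Walk T P u w
  walk-snoc w e p = walk-++ w (step (walk-target w) e (here p))

  walk-reverse : ∀ {P : Fin m → Set} {u v} → Walk T P u v → Walk T P v u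
  walk-reverse (here p) = here p
  walk-reverse (step p e w) = walk-snoc (walk-reverse w) (adj-sym e) p

  -- The walk is cut at its last visit to `u`. This keeps the start of a walk out of a region that
  -- has to serve as a leg of a theta or claw.
  walk-leave : ∀ {P : Fin m → Set} {u v} → Walk T P u v →
    u ≡ v ⊎ ∃[ w ] (adj T u w ≡ true × Walk T (λ x → P x × x ≢ u) w v)
  walk-leave {P} {u} (here p) = inj₁ refl
  walk-leave {P} {u} {v} (step {w = w} p e rest) = go e rest
    where
    go : ∀ {w} → adj T u w ≡ true → Walk T P w v →
      u ≡ v ⊎ ∃[ w ] (adj T u w ≡ true × Walk T (λ x → P x × x ≢ u) w v)
    go′ : ∀ {w} → Walk T P w v →
      (u ≡ v ⊎ ∃[ w ] (adj T u w ≡ true × Walk T (λ x → P x × x ≢ u) w v)) ⊎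
      Walk T (λ x → P x × x ≢ u) w v
    go′ {w} (here p) with w ≟ᶠ u
    ... | yes refl = inj₁ (inj₁ refl)
    ... | no ne = inj₂ (here (p , ne))
    go′ {w} (step p e r) with go′ r
    ... | inj₁ x = inj₁ x
    ... | inj₂ r′ with w ≟ᶠ u
    ...   | yes refl = inj₁ (inj₂ (_ , e , r′))
    ...   | no ne = inj₂ (step (p , ne) e r′)
    go e r with go′ r
    ... | inj₁ x = x
    ... | inj₂ r′ = inj₂ (_ , e , r′)

-- Splitting lists and their last elements

module _ {A : Set} where

  firstSat : ∀ {P : A → Set} → Decidable P → ∀ l → Any P l →
    ∃[ pre ] ∃[ z ] ∃[ suf ] (l ≡ pre ++ z ∷ suf × P z × All (¬_ ∘ P) pre)
  firstSat P? (x ∷ l) a with P? x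
  ... | yes p = [] , x , l , refl , p , []
  firstSat P? (x ∷ l) (here p) | no ¬p = ⊥-elim (¬p p)
  firstSat P? (x ∷ l) (there a) | no ¬p with firstSat P? l a
  ... | pre , z , suf , refl , p , np = x ∷ pre , z , suf , refl , p , ¬p ∷ np

  lastSat : ∀ {P : A → Set} → Decidable P → ∀ l → Any P l →
    ∃[ pre ] ∃[ z ] ∃[ suf ] (l ≡ pre ++ z ∷ suf × P z × All (¬_ ∘ P) suf)
  lastSat P? (x ∷ l) a with Any.any? P? l
  ... | yes a′ with lastSat P? l a′
  ...   | pre , z , suf , refl , p , np = x ∷ pre , z , suf , refl , p , np
  lastSat P? (x ∷ l) (here p) | no ¬a = [] , x , l , refl , p , ¬Any⇒All¬ l ¬a
  lastSat P? (x ∷ l) (there a) | no ¬a = ⊥-elim (¬a a)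

  snoc-only : ∀ {P : A → Set} {l x v} → All (¬_ ∘ P) l → v ∈ l ∷ʳ x → P v → v ≡ x
  snoc-only {l = l} none v∈ p with ∈-++⁻ l v∈
  ... | inj₁ v∈l = ⊥-elim (All.lookup none v∈l p)
  ... | inj₂ (here refl) = refl

  cons-only : ∀ {P : A → Set} {l x v} → All (¬_ ∘ P) l → v ∈ x ∷ l → P v → v ≡ x
  cons-only none (here refl) p = refl
  cons-only none (there v∈) p = ⊥-elim (All.lookup none v∈ p)

  data EndsAt (y : A) : List A → Set where
    here : EndsAt y (y ∷ [])
    there : ∀ {x l} → EndsAt y l → EndsAt y (x ∷ l)

  lastOf : ∀ x l → ∃[ f ] EndsAt f (x ∷ l)
  lastOf x [] = x , here
  lastOf x (y ∷ l) = map₂ there (lastOf y l)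

  endsAt-++ : ∀ {y} pre {z l} → EndsAt y (pre ++ z ∷ l) → EndsAt y (z ∷ l)
  endsAt-++ [] e = e
  endsAt-++ (_ ∷ []) (there e) = e
  endsAt-++ (_ ∷ p ∷ pre) (there e) = endsAt-++ (p ∷ pre) e

  endsAt-∈ : ∀ {y l} → EndsAt y l → y ∈ l
  endsAt-∈ here = here refl
  endsAt-∈ (there e) = there (endsAt-∈ e)

  endsAt-snoc : ∀ {y l} → EndsAt y l → ∃[ l′ ] (l ≡ l′ ∷ʳ y)
  endsAt-snoc here = [] , refl
  endsAt-snoc (there {x} e) with endsAt-snoc e
  ... | l′ , refl = x ∷ l′ , refl

  snoc-endsAt : ∀ l {y} → EndsAt y (l ∷ʳ y)
  snoc-endsAt [] = here
  snoc-endsAt (x ∷ l) = there (snoc-endsAt l)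

-- Induced paths

module Paths {n : ℕ} (G : Graph n) where

  V : Set
  V = Fin n

  E : V → V → Set
  E u v = adj G u v ≡ true

  E? : ∀ u v → Dec (E u v)
  E? u v = adj G u v ≟ᵇ true

  E-sym : ∀ {u v} → E u v → E v u
  E-sym = adj-sym {T = G}

  E-irrefl : ∀ {v} → ¬ E v v
  E-irrefl {v} e with trans (sym e) (irrefl G v)
  ... | ()

  E⇒≢ : ∀ {u v} → E u v → u ≢ v
  E⇒≢ e refl = E-irrefl e

  Far : V → V → Set
  Far u v = u ≢ v × ¬ E u v

  Near : V → V → Set
  Near u v = u ≡ v ⊎ E u v

  Near? : ∀ u v → Dec (Near u v)
  Near? u v = (u ≟ᶠ v) ⊎-dec E? u v

  far-sym : ∀ {u v} → Far u v → Far v u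
  far-sym (a , b) = (λ e → a (sym e)) , b ∘ E-sym

  ¬near⇒far : ∀ {u v} → ¬ Near u v → Far u v
  ¬near⇒far f = f ∘ inj₁ , f ∘ inj₂

  near-sym : ∀ {u v} → Near u v → Near v u
  near-sym (inj₁ refl) = inj₁ refl
  near-sym (inj₂ e) = inj₂ (E-sym e)

  -- Nonempty induced paths, as vertex lists.
  data IP : List V → Set where
    [-] : ∀ {x} → IP (x ∷ [])
    cons : ∀ {x y r} → E x y → All (Far x) r → IP (y ∷ r) → IP (x ∷ y ∷ r)

  ip-suffix : ∀ pre {z l} → IP (pre ++ z ∷ l) → IP (z ∷ l)
  ip-suffix [] p = p
  ip-suffix (_ ∷ []) (cons _ _ p) = p
  ip-suffix (_ ∷ x ∷ pre) (cons _ _ p) = ip-suffix (x ∷ pre) p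

  ip-head : ∀ {x l y} → IP (x ∷ l) → y ∈ l → E x y → ∃[ r ] (l ≡ y ∷ r)
  ip-head (cons e f p) (here refl) e′ = _ , refl
  ip-head (cons e f p) (there i) e′ = ⊥-elim (proj₂ (All.lookup f i) e′)

  ip-≢ : ∀ {x l y} → IP (x ∷ l) → y ∈ l → x ≢ y
  ip-≢ (cons e f p) (here refl) = E⇒≢ e
  ip-≢ (cons e f p) (there i) = proj₁ (All.lookup f i)

  ip-sep : ∀ xs {m ys u v} → IP (xs ++ m ∷ ys) → u ∈ xs → v ∈ ys → Far u v
  ip-sep (x ∷ []) (cons _ f _) (here refl) v∈ = All.lookup f v∈
  ip-sep (x ∷ y ∷ xs) (cons _ f _) (here refl) v∈ = All.lookup f (∈-++⁺ʳ xs (there v∈))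
  ip-sep (x ∷ []) p (there ()) v∈
  ip-sep (x ∷ y ∷ xs) (cons _ _ p) (there u∈) v∈ = ip-sep (y ∷ xs) p u∈ v∈

  ip-disjoint : ∀ xs {ys u v} → IP (xs ++ ys) → u ∈ xs → v ∈ ys → u ≢ v
  ip-disjoint (x ∷ xs) {ys} p (here refl) v∈ = ip-≢ p (∈-++⁺ʳ xs v∈)
  ip-disjoint (x ∷ []) p (there ()) v∈
  ip-disjoint (x ∷ y ∷ xs) (cons _ _ p) (there u∈) v∈ = ip-disjoint (y ∷ xs) p u∈ v∈

  ip-cut : ∀ xs {x y ys u v} → IP (xs ++ x ∷ y ∷ ys) → u ∈ xs ∷ʳ x → v ∈ y ∷ ys → E u v → u ≡ x × v ≡ y
  ip-cut [] (cons e f p) (here refl) (here refl) e′ = refl , refl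
  ip-cut [] (cons e f p) (here refl) (there v∈) e′ = ⊥-elim (proj₂ (All.lookup f v∈) e′)
  ip-cut (a ∷ []) (cons e f p) (here refl) v∈ e′ = ⊥-elim (proj₂ (All.lookup f v∈) e′)
  ip-cut (a ∷ b ∷ xs) (cons e f p) (here refl) v∈ e′ = ⊥-elim (proj₂ (All.lookup f (∈-++⁺ʳ xs (there v∈))) e′)
  ip-cut (a ∷ []) (cons e f p) (there u∈) v∈ e′ = ip-cut [] p u∈ v∈ e′
  ip-cut (a ∷ b ∷ xs) (cons e f p) (there u∈) v∈ e′ = ip-cut (b ∷ xs) p u∈ v∈ e′

  ip-mid-edge : ∀ xs {x y ys} → IP (xs ++ x ∷ y ∷ ys) → E x y
  ip-mid-edge xs p with ip-suffix xs p
  ... | cons e _ _ = e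

  ip-walk : ∀ {D : V → Set} {x l y} → IP (x ∷ l) → All D (x ∷ l) → EndsAt y (x ∷ l) → Walk G D x y
  ip-walk [-] (d ∷ []) here = here d
  ip-walk [-] (d ∷ []) (there ())
  ip-walk (cons e f p) (d ∷ ds) (there en) = step d e (ip-walk p ds en)

  ip-walk-from-start : ∀ {D : V → Set} {x l v} → IP (x ∷ l) → All D (x ∷ l) → v ∈ x ∷ l → Walk G D x v
  ip-walk-from-start p (d ∷ ds) (here refl) = here d
  ip-walk-from-start (cons e f p) (d ∷ ds) (there v∈) = step d e (ip-walk-from-start p ds v∈)

  ip-prefix : ∀ {xs ys} → IP (xs ++ ys) → ∀ {x xs′} → xs ≡ x ∷ xs′ → IP xs
  ip-prefix {x ∷ []} p refl = [-]
  ip-prefix {x ∷ y ∷ xs} (cons e f p) refl = cons e (++⁻ˡ xs f) (ip-prefix {y ∷ xs} p refl)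

  record IPath (D : V → Set) (x y : V) : Set where
    constructor ipath
    field
      tail : List V
      isIP : IP (x ∷ tail)
      inside : All D (x ∷ tail)
      ends : EndsAt y (x ∷ tail)

  -- Jump from x to the last vertex of l equal or adjacent to x.
  prepend : ∀ {D : V → Set} {x u y} → D x → Near x u → IPath D u y → IPath D x y
  prepend {D} {x} {u} {y} dx ne (ipath l p ds en) with lastSat (Near? x) (u ∷ l) (here ne)
  ... | pre , z , suf , eq , nz , fs = go nz
    where
    p′ : IP (z ∷ suf)
    p′ = ip-suffix pre (subst IP eq p)
    ds′ : All D (z ∷ suf)
    ds′ = ++⁻ʳ pre (subst (All D) eq ds)
    en′ : EndsAt y (z ∷ suf)
    en′ = endsAt-++ pre (subst (EndsAt y) eq en)
    go : Near x z → IPath D x y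
    go (inj₁ refl) = ipath suf p′ ds′ en′
    go (inj₂ e) = ipath (z ∷ suf) (cons e (All.map ¬near⇒far fs) p′) (dx ∷ ds′) (there en′)

  walk⇒ipath : ∀ {D : V → Set} {x y} → Walk G D x y → IPath D x y
  walk⇒ipath (here d) = ipath [] [-] (d ∷ []) here
  walk⇒ipath (step d e w) = prepend d (inj₂ e) (walk⇒ipath w)

  ip-injective : ∀ {l} → IP l → ∀ i j → lookup l i ≡ lookup l j → i ≡ j
  ip-injective {x ∷ l} p 0F 0F e = refl
  ip-injective {x ∷ l} p 0F (fsuc j) e = ⊥-elim (ip-≢ p (∈-lookup j) e)
  ip-injective {x ∷ l} p (fsuc i) 0F e = ⊥-elim (ip-≢ p (∈-lookup i) (sym e))
  ip-injective (cons _ _ p) (fsuc i) (fsuc j) e = cong fsuc (ip-injective p i j e)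

-- Parity

odd : ℕ → Bool
odd zero = false
odd (suc m) = not (odd m)

odd-+ : ∀ a b → odd (a + b) ≡ odd a xor odd b
odd-+ zero b = refl
odd-+ (suc a) b rewrite odd-+ a b with odd a | odd b
... | false | _ = refl
... | true | false = refl
... | true | true = refl

%2⇒odd : ∀ m → m % 2 ≡ 1 → odd m ≡ true
%2⇒odd (suc zero) e = refl
%2⇒odd (suc (suc m)) e with odd m | %2⇒odd m (trans (sym (trans (cong (_% 2) (ℕP.+-comm 2 m)) ([m+n]%n≡m%n m 2))) e)
... | true | _ = refl

odd-double : ∀ m → odd (m + m) ≡ false
odd-double m = trans (odd-+ m m) (xor-same (odd m))

-- The three sums add up to twice `a + b + c`. In a theta these are the weights of the three paths.
three-odd-pairs : ∀ a b c → odd (a + b) ≡ true → odd (a + c) ≡ true → odd (b + c) ≡ true → ⊥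
three-odd-pairs a b c p q r rewrite odd-+ a b | odd-+ a c | odd-+ b c with odd a | odd b | odd c
three-odd-pairs a b c () q r | false | false | _
three-odd-pairs a b c p () r | false | true | false
three-odd-pairs a b c p q () | false | true | true
three-odd-pairs a b c p q () | true | false | false
three-odd-pairs a b c p () r | true | false | true
three-odd-pairs a b c () q r | true | true | _

five-odd : ∀ a b c d e m → odd a ≡ true → odd b ≡ true → odd c ≡ true → odd d ≡ true → odd e ≡ true →
  a + b + c + d + e ≡ m + m → ⊥
five-odd a b c d e m p q r s t eq with trans (sym (odd-double m)) (trans (cong odd (sym eq)) all-odd)
  where
  all-odd : odd (a + b + c + d + e) ≡ true
  all-odd rewrite odd-+ (a + b + c + d) e | odd-+ (a + b + c) d | odd-+ (a + b) c | odd-+ a b | p | q | r | s | t = refl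
... | ()

next-last : ∀ {k} (i : Fin (suc k)) → toℕ i ≡ k → next i ≡ 0F
next-last {k} i e with toℕ i ℕP.≟ k
... | yes _ = refl
... | no ne = ⊥-elim (ne e)

toℕ-next : ∀ {k} (i : Fin (suc k)) → toℕ i ≢ k → toℕ (next i) ≡ suc (toℕ i)
toℕ-next {k} i ne with toℕ i ℕP.≟ k
... | yes e = ⊥-elim (ne e)
... | no _ = toℕ-fromℕ< (s≤s (ℕP.≤∧≢⇒< (ℕP.≤-pred (toℕ<n i)) ne))

next-unique : ∀ {k} {i j : Fin (suc k)} → toℕ j ≡ suc (toℕ i) → j ≡ next i
next-unique {k} {i} {j} e = toℕ-injective (trans e (sym (toℕ-next i λ e′ →
  ℕP.<-irrefl (trans e (cong suc e′)) (toℕ<n j))))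

next-cases : ∀ {k} (i j : Fin (suc k)) → j ≡ next i → toℕ j ≡ suc (toℕ i) ⊎ (toℕ i ≡ k × j ≡ 0F)
next-cases {k} i .(next i) refl with toℕ i ℕP.≟ k
... | yes e = inj₂ (e , refl)
... | no ne = inj₁ (toℕ-fromℕ< (s≤s (ℕP.≤∧≢⇒< (ℕP.≤-pred (toℕ<n i)) ne)))

sum-tabulate-last : ∀ k (f : Fin (suc k) → ℕ) → sum (tabulate f) ≡ sum (tabulate (f ∘ inject₁)) + f (fromℕ k)
sum-tabulate-last zero f = ℕP.+-identityʳ (f 0F)
sum-tabulate-last (suc k) f = trans (cong (f 0F +_) (sum-tabulate-last k (f ∘ fsuc))) (sym (ℕP.+-assoc (f 0F) _ _))

reverse-endsAt : ∀ {A : Set} {d : A} {l} → EndsAt d l → ∃[ s ] (reverse l ≡ d ∷ s)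
reverse-endsAt {l = l} en with endsAt-snoc en
... | l′ , refl = reverse l′ , reverse-++ l′ _

-- Weights of induced cycles; exclusion of thetas and prisms

module Holes {n : ℕ} (G : Graph n) (signing : OddSignable G) where

  open Paths G

  w : V → V → ℕ
  w = proj₁ signing

  w-sym : ∀ u v → w u v ≡ w v u
  w-sym = proj₁ (proj₂ (proj₂ signing))

  pw : List V → ℕ
  pw [] = 0
  pw (x ∷ []) = 0
  pw (x ∷ y ∷ r) = w x y + pw (y ∷ r)

  pw-join : ∀ l {b} → EndsAt b l → ∀ c r → pw (l ++ c ∷ r) ≡ pw l + (w b c + pw (c ∷ r))
  pw-join (b ∷ []) here c r = refl
  pw-join (x ∷ y ∷ l) (there en) c r = trans (cong (w x y +_) (pw-join (y ∷ l) en c r)) (sym (ℕP.+-assoc (w x y) _ _))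

  pw-reverse : ∀ l → pw (reverse l) ≡ pw l
  pw-reverse [] = refl
  pw-reverse (x ∷ []) = refl
  pw-reverse (x ∷ y ∷ r) = begin
    pw (reverse (x ∷ y ∷ r))                   ≡⟨ cong pw (unfold-reverse x (y ∷ r)) ⟩
    pw (reverse (y ∷ r) ∷ʳ x)                  ≡⟨ pw-join (reverse (y ∷ r)) (subst (EndsAt y) (sym (unfold-reverse y r)) (snoc-endsAt (reverse r))) x [] ⟩
    pw (reverse (y ∷ r)) + (w y x + 0)         ≡⟨ cong₂ _+_ (pw-reverse (y ∷ r)) (trans (ℕP.+-identityʳ _) (w-sym y x)) ⟩
    pw (y ∷ r) + w x y                         ≡⟨ ℕP.+-comm (pw (y ∷ r)) _ ⟩
    w x y + pw (y ∷ r) ∎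
    where open ≡-Reasoning

  pw-tabulate : ∀ z p → sum (tabulate (λ i → w (lookup (z ∷ p) (inject₁ i)) (lookup p i))) ≡ pw (z ∷ p)
  pw-tabulate z [] = refl
  pw-tabulate z (x ∷ p) = cong (w z x +_) (pw-tabulate x p)

  cycleWeight-lookup : ∀ z p → cycleWeight w (lookup (z ∷ p)) ≡ pw (z ∷ p) + w (lookup (z ∷ p) (fromℕ (length p))) z
  cycleWeight-lookup z p = begin
    cycleWeight w c                                         ≡⟨ cong sum (map-tabulate id f) ⟩
    sum (tabulate f)                                        ≡⟨ sum-tabulate-last (length p) f ⟩
    sum (tabulate (f ∘ inject₁)) + f (fromℕ (length p))     ≡⟨ cong₂ _+_ (cong sum (tabulate-cong step-eq)) last-eq ⟩
    sum (tabulate (λ i → w (c (inject₁ i)) (lookup p i))) + w (c (fromℕ (length p))) z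
                                                            ≡⟨ cong (_+ w (c (fromℕ (length p))) z) (pw-tabulate z p) ⟩
    pw (z ∷ p) + w (c (fromℕ (length p))) z ∎
    where
    open ≡-Reasoning
    c = lookup (z ∷ p)
    f = λ i → w (c i) (c (next i))
    step-eq : ∀ i → f (inject₁ i) ≡ w (c (inject₁ i)) (lookup p i)
    step-eq i = cong (λ j → w (c (inject₁ i)) (c j)) (sym (next-unique {j = fsuc i} (cong suc (sym (toℕ-inject₁ i)))))
    last-eq : f (fromℕ (length p)) ≡ w (c (fromℕ (length p))) z
    last-eq = cong (λ j → w (c (fromℕ (length p))) (c j)) (next-last (fromℕ (length p)) (toℕ-fromℕ (length p)))

  ip-index : ∀ {l} → IP l → ∀ i j → E (lookup l i) (lookup l j) → toℕ j ≡ suc (toℕ i) ⊎ toℕ i ≡ suc (toℕ j)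
  ip-index [-] 0F 0F e = ⊥-elim (E-irrefl e)
  ip-index (cons x f p) 0F 0F e = ⊥-elim (E-irrefl e)
  ip-index (cons x f p) 0F 1F e = inj₁ refl
  ip-index (cons x f p) 0F (fsuc (fsuc j)) e = ⊥-elim (proj₂ (All.lookup f (∈-lookup j)) e)
  ip-index (cons x f p) 1F 0F e = inj₂ refl
  ip-index (cons x f p) (fsuc (fsuc i)) 0F e = ⊥-elim (proj₂ (All.lookup f (∈-lookup i)) (E-sym e))
  ip-index (cons x f p) (fsuc i) (fsuc j) e with ip-index p i j e
  ... | inj₁ q = inj₁ (cong suc q)
  ... | inj₂ q = inj₂ (cong suc q)

  ip-index⁻ : ∀ {l} → IP l → ∀ i j → toℕ j ≡ suc (toℕ i) → E (lookup l i) (lookup l j)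
  ip-index⁻ [-] 0F 0F ()
  ip-index⁻ (cons x f p) 0F 1F e = x
  ip-index⁻ (cons x f p) (fsuc i) (fsuc j) e = ip-index⁻ p i j (ℕP.suc-injective e)

  -- How `z` sees the vertices of a path after the first one: only the last is a neighbour. With `z`
  -- adjacent to the first vertex `x` too, `z ∷ x ∷ l` is an induced cycle.
  data Closing (z : V) : List V → Set where
    last : ∀ {y} → E z y → Closing z (y ∷ [])
    far : ∀ {x l} → Far z x → Closing z l → Closing z (x ∷ l)

  closing-++ : ∀ {z} l {r} → All (Far z) l → Closing z r → Closing z (l ++ r)
  closing-++ [] fs c = c
  closing-++ (x ∷ l) (f ∷ fs) c = far f (closing-++ l fs c)

  closing-index : ∀ {z l} → Closing z l → ∀ i → E z (lookup l i) → suc (toℕ i) ≡ length l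
  closing-index (last _) 0F e = refl
  closing-index (far f c) 0F e = ⊥-elim (proj₂ f e)
  closing-index (far f c) (fsuc i) e = cong suc (closing-index c i e)

  closing-index⁻ : ∀ {z l} → Closing z l → ∀ i → suc (toℕ i) ≡ length l → E z (lookup l i)
  closing-index⁻ (last x) 0F e = x
  closing-index⁻ (far _ (last x)) 0F ()
  closing-index⁻ (far _ (far x c)) 0F ()
  closing-index⁻ (far _ c) (fsuc i) e = closing-index⁻ c i (ℕP.suc-injective e)

  ring-induced : ∀ {z x l} → IP (x ∷ l) → E z x → Closing z l → IsInducedCycle G (length (x ∷ l)) (lookup (z ∷ x ∷ l))
  ring-induced {z} {x} {l} p zx cl = inj , adj⇒next , next⇒adj
    where
    c = lookup (z ∷ x ∷ l)
    nonempty : ∀ {l} → Closing z l → 1 ≤ length l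
    nonempty (last _) = s≤s z≤n
    nonempty (far _ _) = s≤s z≤n
    apart : ∀ i → z ≢ lookup (x ∷ l) i
    apart 0F refl = E-irrefl zx
    apart (fsuc i) = go cl i
      where
      go : ∀ {l} → Closing z l → ∀ i → z ≢ lookup l i
      go (last e) 0F refl = E-irrefl e
      go (far f c) 0F = proj₁ f
      go (far f c) (fsuc i) = go c i
    inj : ∀ {i j} → c i ≡ c j → i ≡ j
    inj {0F} {0F} e = refl
    inj {0F} {fsuc j} e = ⊥-elim (apart j e)
    inj {fsuc i} {0F} e = ⊥-elim (apart i (sym e))
    inj {fsuc i} {fsuc j} e = cong fsuc (ip-injective p i j e)
    first⇒ : ∀ j → E z (lookup (x ∷ l) j) → fsuc j ≡ next 0F ⊎ 0F ≡ next (fsuc j)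
    first⇒ 0F e = inj₁ (next-unique refl)
    first⇒ (fsuc j) e = inj₂ (sym (next-last _ (cong suc (closing-index cl j e))))
    adj⇒next : ∀ i j → adj G (c i) (c j) ≡ true → (j ≡ next i ⊎ i ≡ next j)
    adj⇒next 0F 0F e = ⊥-elim (E-irrefl e)
    adj⇒next 0F (fsuc j) e = first⇒ j e
    adj⇒next (fsuc i) 0F e = swap (first⇒ i (E-sym e))
    adj⇒next (fsuc i) (fsuc j) e with ip-index p i j e
    ... | inj₁ q = inj₁ (next-unique (cong suc q))
    ... | inj₂ q = inj₂ (next-unique (cong suc q))
    next⇒ : ∀ i j → j ≡ next i → E (c i) (c j)
    next⇒ i j e with next-cases i j e
    next⇒ 0F 1F e | inj₁ q = zx
    next⇒ (fsuc i) (fsuc j) e | inj₁ q = ip-index⁻ p i j (ℕP.suc-injective q)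
    next⇒ 0F j e | inj₂ (() , _)
    next⇒ 1F .0F e | inj₂ (q , refl) = ⊥-elim (ℕP.<⇒≢ (nonempty cl) (ℕP.suc-injective q))
    next⇒ (fsuc (fsuc i)) .0F e | inj₂ (q , refl) = E-sym (closing-index⁻ cl i (ℕP.suc-injective q))
    next⇒adj : ∀ i j → (j ≡ next i ⊎ i ≡ next j) → adj G (c i) (c j) ≡ true
    next⇒adj i j (inj₁ e) = next⇒ i j e
    next⇒adj i j (inj₂ e) = E-sym (next⇒ j i e)

  ring-odd : ∀ {z x l y} → IP (x ∷ l) → E z x → Closing z l → EndsAt y l → odd (pw (z ∷ x ∷ l) + w y z) ≡ true
  ring-odd {z} {x} {l} {y} p zx cl en =
    subst (λ m → odd m ≡ true) (trans (cycleWeight-lookup z (x ∷ l)) (cong (λ v → pw (z ∷ x ∷ l) + w v z) (last-lookup {z} {x ∷ l} {y} (there (there en)))))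
      (%2⇒odd (cycleWeight w (lookup (z ∷ x ∷ l))) (cyc l p cl))
    where
    last-lookup : ∀ {z l y} → EndsAt y (z ∷ l) → lookup (z ∷ l) (fromℕ (length l)) ≡ y
    last-lookup here = refl
    last-lookup (there (here)) = refl
    last-lookup (there (there en)) = last-lookup (there en)
    cyc : ∀ l → IP (x ∷ l) → Closing z l → cycleWeight w (lookup (z ∷ x ∷ l)) % 2 ≡ 1
    -- One vertex in `l` gives a triangle, two or more give a hole; both are odd, so rings need no
    -- case distinction later.
    cyc (y ∷ []) p cl′ = proj₁ (proj₂ (proj₂ (proj₂ signing))) _ (ring-induced p zx cl′)
    cyc (y ∷ y′ ∷ l) p cl′ = proj₂ (proj₂ (proj₂ (proj₂ signing))) _ _ (s≤s (s≤s (s≤s z≤n)) , ring-induced p zx cl′)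

  ip-snoc : ∀ {l y x} → IP l → EndsAt y l → E y x → (∀ {u} → u ∈ l → u ≢ y → Far u x) → IP (l ∷ʳ x)
  ip-snoc [-] here e f = cons e [] [-]
  ip-snoc (cons e′ fs p) (there en) e f =
    cons e′ (∷ʳ⁺ fs (f (here refl) (ip-≢ (cons e′ fs p) (endsAt-∈ en)))) (ip-snoc p en e (f ∘ there))

  ip-reverse : ∀ {l} → IP l → IP (reverse l)
  ip-reverse [-] = [-]
  ip-reverse {x ∷ y ∷ r} (cons e f p) = subst IP (sym (unfold-reverse x (y ∷ r)))
    (ip-snoc (ip-reverse p) (subst (EndsAt y) (sym (unfold-reverse y r)) (snoc-endsAt (reverse r))) (E-sym e)
      λ {u} u∈ ne → far-sym (apart u (reverse⁻ u∈) ne))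
    where
    apart : ∀ u → u ∈ y ∷ r → u ≢ y → Far x u
    apart u (here refl) ne = ⊥-elim (ne refl)
    apart u (there i) ne = All.lookup f i

  ip-join : ∀ {l b c r} → IP l → EndsAt b l → E b c → IP (c ∷ r) →
    (∀ {u v} → u ∈ l → v ∈ c ∷ r → u ≢ v × (E u v → u ≡ b × v ≡ c)) → IP (l ++ c ∷ r)
  ip-join {b = b} {c} [-] here bc q cross = cons bc (All.tabulate λ {v} i →
    proj₁ (cross (here refl) (there i)) , λ e → ip-≢ q i (sym (proj₂ (proj₂ (cross (here refl) (there i)) e)))) q
  ip-join {b = b} (cons e f p) (there en) bc q cross = cons e
    (++⁺ f (All.tabulate λ i → proj₁ (cross (here refl) i) ,
      λ e′ → ip-≢ (cons e f p) (endsAt-∈ en) (proj₁ (proj₂ (cross (here refl) i) e′))))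
    (ip-join p en bc q (cross ∘ there))

  -- The ring runs along the first path and back along the second, whose weight is the same in both
  -- directions. Triangles are included, with a second path of one vertex.
  two-path-ring : ∀ {z x r b h q d} → IP (z ∷ x ∷ r) → EndsAt b (x ∷ r) → IP (h ∷ q) → EndsAt d (h ∷ q) →
    E b d → E h z →
    (∀ {u v} → u ∈ z ∷ x ∷ r → v ∈ h ∷ q → u ≢ v × (E u v → (u ≡ b × v ≡ d) ⊎ (u ≡ z × v ≡ h))) →
    odd (pw (z ∷ x ∷ r) + pw (h ∷ q) + (w b d + w h z)) ≡ true
  two-path-ring {z} {x} {r} {b} {h} {q} {d} (cons zx fs p) enb ipq end bd hz cross with reverse-endsAt end
  ... | s , req = subst (λ m → odd m ≡ true) weight
      (ring-odd path zx closing (endsAt-rest r))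
    where
    rq = reverse (h ∷ q)
    zip : IP (z ∷ x ∷ r)
    zip = cons zx fs p
    path : IP (x ∷ r ++ rq)
    path = subst (λ l → IP (x ∷ r ++ l)) (sym req)
      (ip-join p enb bd (subst IP req (ip-reverse ipq)) λ {u} {v} i j →
        let c = cross (there i) (reverse⁻ (subst (v ∈_) (sym req) j)) in
        proj₁ c , λ e → [ id , (λ { (refl , _) → ⊥-elim (ip-≢ zip i refl) }) ]′ (proj₂ c e))
    zfar : ∀ {v} → v ∈ reverse q → Far z v
    zfar {v} i = let c = cross (here refl) (there (reverse⁻ i)) in proj₁ c ,
      λ e → [ (λ { (refl , _) → ip-≢ zip (endsAt-∈ enb) refl }) , (λ { (_ , refl) → ip-≢ ipq (reverse⁻ i) refl }) ]′ (proj₂ c e)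
    closing : Closing z (r ++ rq)
    closing = closing-++ r fs (subst (Closing z) (sym (unfold-reverse h q)) (closing-++ (reverse q) (All.tabulate zfar) (last (E-sym hz))))
    endsAt-rest : ∀ r → EndsAt h (r ++ rq)
    endsAt-rest [] = subst (EndsAt h) (sym (unfold-reverse h q)) (snoc-endsAt (reverse q))
    endsAt-rest (_ ∷ r) = there (endsAt-rest r)
    weight : pw (z ∷ x ∷ r ++ rq) + w h z ≡ pw (z ∷ x ∷ r) + pw (h ∷ q) + (w b d + w h z)
    weight = trans (cong (λ m → m + w h z) (trans (cong (λ l → pw (z ∷ x ∷ r ++ l)) req)
        (trans (pw-join (z ∷ x ∷ r) (there enb) d s)
          (cong (λ m → pw (z ∷ x ∷ r) + (w b d + m)) (trans (cong pw (sym req)) (pw-reverse (h ∷ q)))))))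
      (arith (pw (z ∷ x ∷ r)) (w b d) (pw (h ∷ q)) (w h z))
      where
      arith : ∀ a b c d → a + (b + c) + d ≡ a + c + (b + d)
      arith = solve-∀

  record Arc (D : V → Set) (x y : V) : Set where
    constructor arc
    field
      first : V
      rest : List V
      final : V
      isIP : IP (x ∷ (first ∷ rest) ∷ʳ y)
      inside : All D (first ∷ rest)
      ends : EndsAt final (first ∷ rest)

  record Link (D : V → Set) (x y : V) : Set where
    constructor link
    field
      {start stop} : V
      leave : E x start
      walk : Walk G D start stop
      arrive : E stop y

  -- Shortcutting gives an induced path in `D` with `x` and `y` added. Each end occurs on it once,
  -- so the interior lies in `D`; it is nonempty because `x` and `y` are distinct and nonadjacent.
  link⇒arc : ∀ {D : V → Set} {x y} → Far x y → ¬ D x → ¬ D y → Link D x y → Arc D x y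
  link⇒arc {D} {x} {y} fxy ¬dx ¬dy (link xu wk vy) = build (walk⇒ipath wk′)
    where
    D′ : V → Set
    D′ v = v ≡ x ⊎ v ≡ y ⊎ D v
    wk′ : Walk G D′ x y
    wk′ = step (inj₁ refl) xu (walk-snoc (walk-map (inj₂ ∘ inj₂) wk) vy (inj₂ (inj₁ refl)))
    build : IPath D′ x y → Arc D x y
    build (ipath [] p ds here) = ⊥-elim (proj₁ fxy refl)
    build (ipath [] p ds (there ()))
    build (ipath (u ∷ t) p ds (there en)) with endsAt-snoc en
    build (ipath (u ∷ .[]) (cons e _ _) ds (there en)) | [] , refl = ⊥-elim (proj₂ fxy e)
    build (ipath (u ∷ .(t′ ∷ʳ y)) p ds (there en)) | .u ∷ t′ , refl = arc u t′ (proj₁ fin) p inner (proj₂ fin)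
      where
      fin : ∃[ f ] EndsAt f (u ∷ t′)
      fin = lastOf u t′
      in-mid : ∀ {v} → v ∈ u ∷ t′ → D v
      in-mid {v} i with All.lookup ds (there (∈-++⁺ˡ i))
      ... | inj₁ refl = ⊥-elim (ip-≢ p (∈-++⁺ˡ i) refl)
      ... | inj₂ (inj₁ refl) = ⊥-elim (ip-disjoint (x ∷ u ∷ t′) p (there i) (here refl) refl)
      ... | inj₂ (inj₂ d) = d
      inner : All D (u ∷ t′)
      inner = All.tabulate in-mid

  Anticomplete : (V → Set) → (V → Set) → Set
  Anticomplete A B = ∀ {u v} → A u → B v → Far u v

  arc-pair-odd : ∀ {A B x y} → Far x y → Anticomplete A B → ¬ A x → ¬ A y → ¬ B x → ¬ B y →
    (P : Arc A x y) (Q : Arc B x y) →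
    odd (pw (x ∷ (Arc.first P ∷ Arc.rest P) ∷ʳ y) + pw (x ∷ (Arc.first Q ∷ Arc.rest Q) ∷ʳ y)) ≡ true
  arc-pair-odd {A} {B} {x} {y} fxy anti ¬ax ¬ay ¬bx ¬by (arc u p f ip ins en) (arc u′ p′ f′ ip′ ins′ en′) =
    subst (λ m → odd m ≡ true) weight
      (two-path-ring ip (snoc-endsAt (u ∷ p)) mid en′ (E-sym (fy ip′ en′)) (E-sym (xu ip′)) cross)
    where
    xu : ∀ {u p} → IP (x ∷ u ∷ p) → E x u
    xu (cons e _ _) = e
    fy : ∀ {u p f} → IP (x ∷ (u ∷ p) ∷ʳ y) → EndsAt f (u ∷ p) → E f y
    fy {u} {p} ip en with endsAt-snoc en
    ... | l , eq = ip-mid-edge (x ∷ l) (subst (λ l → IP (x ∷ l)) (trans (cong (_∷ʳ y) eq) (++-assoc l _ _)) ip)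
    mid : IP (u′ ∷ p′)
    mid = ip-suffix (x ∷ []) (ip-prefix {x ∷ u′ ∷ p′} ip′ refl)
    cross : ∀ {a b} → a ∈ x ∷ (u ∷ p) ∷ʳ y → b ∈ u′ ∷ p′ → a ≢ b × (E a b → (a ≡ y × b ≡ f′) ⊎ (a ≡ x × b ≡ u′))
    cross (here refl) j = ip-≢ ip′ (∈-++⁺ˡ j) , λ e → inj₂ (refl , nbr (ip-head ip′ (∈-++⁺ˡ j) e))
      where
      nbr : ∀ {b} → ∃[ r ] ((u′ ∷ p′) ∷ʳ y ≡ b ∷ r) → b ≡ u′
      nbr (_ , refl) = refl
    cross {a} {b} (there i) j with ∈-++⁻ (u ∷ p) i
    ... | inj₁ k = let c = anti (All.lookup ins k) (All.lookup ins′ j) in proj₁ c , λ e → ⊥-elim (proj₂ c e)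
    ... | inj₂ (here refl) with endsAt-snoc en′
    ...   | l , eq = (λ e → ip-disjoint (x ∷ u′ ∷ p′) ip′ (there j) (here refl) (sym e)) ,
            λ e → inj₁ (refl , proj₁ (ip-cut (x ∷ l) (subst (λ l → IP (x ∷ l)) (trans (cong (_∷ʳ y) eq) (++-assoc l _ _)) ip′)
              (there (subst (b ∈_) eq j)) (here refl) (E-sym e)))
    weight : pw (x ∷ (u ∷ p) ∷ʳ y) + pw (u′ ∷ p′) + (w y f′ + w u′ x) ≡ pw (x ∷ (u ∷ p) ∷ʳ y) + pw (x ∷ (u′ ∷ p′) ∷ʳ y)
    weight = trans (arith (pw (x ∷ (u ∷ p) ∷ʳ y)) (pw (u′ ∷ p′)) (w y f′) (w u′ x))
      (cong₂ (λ a b → pw (x ∷ (u ∷ p) ∷ʳ y) + (a + b)) (w-sym u′ x)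
        (trans (cong (λ m → pw (u′ ∷ p′) + (m + 0)) (w-sym y f′)) (sym (pw-join (u′ ∷ p′) en′ y []))))
      where
      arith : ∀ a b c d → a + b + (c + d) ≡ a + (d + (b + (c + 0)))
      arith = solve-∀

  no-theta : ∀ {A B C : V → Set} {x y} → Far x y →
    ¬ A x → ¬ A y → ¬ B x → ¬ B y → ¬ C x → ¬ C y →
    Anticomplete A B → Anticomplete A C → Anticomplete B C →
    Link A x y → Link B x y → Link C x y → ⊥
  no-theta {x = x} {y} fxy ¬ax ¬ay ¬bx ¬by ¬cx ¬cy ab ac bc la lb lc =
    three-odd-pairs (W P) (W Q) (W R)
      (arc-pair-odd fxy ab ¬ax ¬ay ¬bx ¬by P Q)
      (arc-pair-odd fxy ac ¬ax ¬ay ¬cx ¬cy P R)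
      (arc-pair-odd fxy bc ¬bx ¬by ¬cx ¬cy Q R)
    where
    P = link⇒arc fxy ¬ax ¬ay la
    Q = link⇒arc fxy ¬bx ¬by lb
    R = link⇒arc fxy ¬cx ¬cy lc
    W : ∀ {D} → Arc D x y → ℕ
    W P = pw (x ∷ (Arc.first P ∷ Arc.rest P) ∷ʳ y)

  Crossing : (A : V → Set) (a b : V) (B : V → Set) (a′ b′ : V) → Set
  Crossing A a b B a′ b′ = ∀ {u v} → A u → B v → u ≢ v × (E u v → (u ≡ a × v ≡ a′) ⊎ (u ≡ b × v ≡ b′))

  no-prism : ∀ {A B C : V → Set} {a₁ a₂ a₃ b₁ b₂ b₃} → Far a₂ b₂ → Far a₃ b₃ →
    E a₁ a₂ → E a₁ a₃ → E a₂ a₃ → E b₁ b₂ → E b₁ b₃ → E b₂ b₃ →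
    Crossing A a₁ b₁ B a₂ b₂ → Crossing A a₁ b₁ C a₃ b₃ → Crossing B a₂ b₂ C a₃ b₃ →
    Walk G A a₁ b₁ → Walk G B a₂ b₂ → Walk G C a₃ b₃ → ⊥
  no-prism {A} {B} {C} {a₁} {a₂} {a₃} {b₁} {b₂} {b₃} f₂ f₃ a₁₂ a₁₃ a₂₃ b₁₂ b₁₃ b₂₃ AB AC BC wa wb wc =
    go (walk⇒ipath wa) (walk⇒ipath wb) (walk⇒ipath wc)
    where
    triangle : ∀ {x y z} → E x y → E x z → E y z → odd (w x y + (w y z + w z x)) ≡ true
    triangle {x} {y} {z} xy xz yz = subst (λ m → odd m ≡ true) (arith (w x y) (w y z) (w z x))
      (two-path-ring {z = x} {y} {[]} {y} {z} {[]} {z} (cons xy [] [-]) here [-] here yz (E-sym xz)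
        λ { (here refl) (here refl) → E⇒≢ xz , λ _ → inj₂ (refl , refl)
          ; (there (here refl)) (here refl) → E⇒≢ yz , λ _ → inj₁ (refl , refl) })
      where
      arith : ∀ a b c → a + 0 + 0 + (b + c) ≡ a + (b + c)
      arith = solve-∀
    ring : ∀ {A B : V → Set} {a b a′ b′} → Far a′ b′ → E a a′ → E b b′ → Crossing A a b B a′ b′ →
      (P : IPath A a b) (Q : IPath B a′ b′) →
      odd (pw (a′ ∷ IPath.tail Q) + pw (a ∷ IPath.tail P) + (w b′ b + w a a′)) ≡ true
    ring f e₁ e₂ X (ipath p ip ins en) (ipath [] iq insq here) = ⊥-elim (proj₁ f refl)
    ring f e₁ e₂ X (ipath p ip ins en) (ipath (x ∷ q) iq insq (there enq)) =
      two-path-ring iq enq ip en (E-sym e₂) e₁ λ {u} {v} i j →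
        let c = X (All.lookup ins j) (All.lookup insq i) in
        (λ e → proj₁ c (sym e)) , λ e → [ (λ { (p , q) → inj₂ (q , p) }) , (λ { (p , q) → inj₁ (q , p) }) ]′ (proj₂ c (E-sym e))
    go : IPath A a₁ b₁ → IPath B a₂ b₂ → IPath C a₃ b₃ → ⊥
    go P Q R = five-odd (q + p + (w b₂ b₁ + w a₁ a₂)) (r + p + (w b₃ b₁ + w a₁ a₃)) (r + q + (w b₃ b₂ + w a₂ a₃))
      (w a₁ a₂ + (w a₂ a₃ + w a₃ a₁)) (w b₁ b₂ + (w b₂ b₃ + w b₃ b₁))
      (p + q + r + (w a₁ a₂ + w a₁ a₃ + w a₂ a₃) + (w b₁ b₂ + w b₁ b₃ + w b₂ b₃))
      (ring f₂ a₁₂ b₁₂ AB P Q) (ring f₃ a₁₃ b₁₃ AC P R) (ring f₃ a₂₃ b₂₃ BC Q R)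
      (triangle a₁₂ a₁₃ a₂₃) (triangle b₁₂ b₁₃ b₂₃)
      total
      where
      p = pw (a₁ ∷ IPath.tail P)
      q = pw (a₂ ∷ IPath.tail Q)
      r = pw (a₃ ∷ IPath.tail R)
      total : q + p + (w b₂ b₁ + w a₁ a₂) + (r + p + (w b₃ b₁ + w a₁ a₃)) + (r + q + (w b₃ b₂ + w a₂ a₃))
            + (w a₁ a₂ + (w a₂ a₃ + w a₃ a₁)) + (w b₁ b₂ + (w b₂ b₃ + w b₃ b₁))
            ≡ (p + q + r + (w a₁ a₂ + w a₁ a₃ + w a₂ a₃) + (w b₁ b₂ + w b₁ b₃ + w b₂ b₃))
            + (p + q + r + (w a₁ a₂ + w a₁ a₃ + w a₂ a₃) + (w b₁ b₂ + w b₁ b₃ + w b₂ b₃))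
      total rewrite w-sym b₂ b₁ | w-sym b₃ b₁ | w-sym b₃ b₂ | w-sym a₃ a₁ =
        arith p q r (w a₁ a₂) (w a₁ a₃) (w a₂ a₃) (w b₁ b₂) (w b₁ b₃) (w b₂ b₃)
        where
        arith : ∀ p q r x y z x′ y′ z′ →
          q + p + (x′ + x) + (r + p + (y′ + y)) + (r + q + (z′ + z)) + (x + (z + y)) + (x′ + (z′ + y′))
          ≡ (p + q + r + (x + y + z) + (x′ + y′ + z′)) + (p + q + r + (x + y + z) + (x′ + y′ + z′))
        arith = solve-∀

-- Pyramids

module Pyramids {n : ℕ} (G : Graph n) where

  open Paths G

  -- `p i` omits the apex: its length is the number of edges of the path, and different paths are
  -- disjoint without exception. `β` is the induced subgraph in which the pyramid lies.
  record Pyramid (β : V → Set) (ℓ : ℕ) : Set where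
    field
      a : V
      b : Fin 3 → V
      p : Fin 3 → List V
      induced : ∀ i → IP (a ∷ p i)
      ends : ∀ i → EndsAt (b i) (p i)
      triangle : ∀ {i j} → i ≢ j → E (b i) (b j)
      cross : ∀ {i j} → i ≢ j → ∀ {u v} → u ∈ p i → v ∈ p j → u ≢ v × (E u v → u ≡ b i × v ≡ b j)
      long : ∀ i → ℓ ≤ length (p i)
      apexIn : β a
      pathIn : ∀ i → All β (p i)

  pyramid-map : ∀ {β β′ : V → Set} {ℓ} → (∀ {v} → β v → β′ v) → Pyramid β ℓ → Pyramid β′ ℓ
  pyramid-map f P = record
    { a = a ; b = b ; p = p ; induced = induced ; ends = ends ; triangle = triangle ; cross = cross ; long = long
    ; apexIn = f apexIn ; pathIn = λ i → All.map f (pathIn i) }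
    where open Pyramid P

  linkDown : ∀ {D : V → Set} {x c l v} → IP (x ∷ c ∷ l) → All D (c ∷ l) → v ∈ c ∷ l → E x c × Walk G D c v
  linkDown (cons e _ p) ds v∈ = e , ip-walk-from-start p ds v∈

each : ∀ {ℓ} {P : Fin 3 → Set ℓ} → P 0F → P 1F → P 2F → ∀ i → P i
each a b c 0F = a
each a b c 1F = b
each a b c 2F = c

third : (i j : Fin 3) → i ≢ j → ∃[ k ] (k ≢ i × k ≢ j × ∀ l → l ≡ i ⊎ l ≡ j ⊎ l ≡ k)
third 0F 0F ne = ⊥-elim (ne refl)
third 0F 1F ne = 2F , (λ ()) , (λ ()) , each (inj₁ refl) (inj₂ (inj₁ refl)) (inj₂ (inj₂ refl))
third 0F 2F ne = 1F , (λ ()) , (λ ()) , each (inj₁ refl) (inj₂ (inj₂ refl)) (inj₂ (inj₁ refl))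
third 1F 0F ne = 2F , (λ ()) , (λ ()) , each (inj₂ (inj₁ refl)) (inj₁ refl) (inj₂ (inj₂ refl))
third 1F 1F ne = ⊥-elim (ne refl)
third 1F 2F ne = 0F , (λ ()) , (λ ()) , each (inj₂ (inj₂ refl)) (inj₁ refl) (inj₂ (inj₁ refl))
third 2F 0F ne = 1F , (λ ()) , (λ ()) , each (inj₂ (inj₁ refl)) (inj₂ (inj₂ refl)) (inj₁ refl)
third 2F 1F ne = 0F , (λ ()) , (λ ()) , each (inj₂ (inj₂ refl)) (inj₂ (inj₁ refl)) (inj₁ refl)
third 2F 2F ne = ⊥-elim (ne refl)

-- A pyramid separates its three paths

module PyramidSeparation {n : ℕ} (G : Graph n) (signing : OddSignable G) where

  open Paths G
  open Holes G signing
  open Pyramids G public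

  -- The neighbours of `m` on a path, sorted by the configuration they create: a single foot becomes
  -- a branch vertex of a theta, two consecutive feet form a triangle with `m`, and if the first and
  -- the last foot are not consecutive, `m` itself becomes the branch vertex.
  data Feet (m : V) (l : List V) : Set where
    one : ∀ pre g suf → l ≡ pre ++ g ∷ suf → E m g → All (¬_ ∘ E m) pre → All (¬_ ∘ E m) suf → Feet m l
    two : ∀ pre g g′ suf → l ≡ (pre ∷ʳ g) ++ g′ ∷ suf → E m g → E m g′ →
      All (¬_ ∘ E m) pre → All (¬_ ∘ E m) suf → Feet m l
    wide : ∀ pre g x mid g′ suf → l ≡ (pre ∷ʳ g) ++ x ∷ mid ++ g′ ∷ suf → E m g → E m g′ →
      All (¬_ ∘ E m) pre → All (¬_ ∘ E m) suf → Feet m l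

  feet : ∀ m l → Any (E m) l → Feet m l
  feet m l a with firstSat (E? m) l a
  ... | pre , g , suf , refl , e , n₁ with Any.any? (E? m) suf
  ...   | no none = one pre g suf refl e n₁ (¬Any⇒All¬ suf none)
  ...   | yes some with lastSat (E? m) suf some
  ...     | [] , g′ , suf′ , refl , e′ , n₂ = two pre g g′ suf′ (sym (++-assoc pre _ _)) e e′ n₁ n₂
  ...     | x ∷ mid , g′ , suf′ , refl , e′ , n₂ = wide pre g x mid g′ suf′ (sym (++-assoc pre _ _)) e e′ n₁ n₂

  module Separation {β : V → Set} {ℓ : ℕ} (P : Pyramid β ℓ) where

    open Pyramid P

    Touch : Fin 3 → V → Set
    Touch i y = Any (E y) (p i)

    Out : V → Set
    Out y = ∀ i → ¬ (y ∈ p i)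

    record Clear (y : V) : Set where
      field
        apex : Far y a
        heads : ∀ i {u} → u ∈ p i → E a u → Far y u
        bases : ∀ i → Far y (b i)
    open Clear

    touch? : ∀ i y → Dec (Touch i y)
    touch? i y = Any.any? (E? y) (p i)

    touch : ∀ {i y u} → u ∈ p i → E y u → Touch i y
    touch = lose

    head-walk : ∀ i {v} {D : V → Set} → (∀ {u} → u ∈ p i → D u) → v ∈ p i → ∃[ c ] (E a c × c ∈ p i × Walk G D c v)
    head-walk i {v} {D} d v∈ = go (p i) refl v∈
      where
      go : ∀ l → p i ≡ l → v ∈ l → ∃[ c ] (E a c × c ∈ p i × Walk G D c v)
      go (c ∷ l) eq v∈ with linkDown (subst (IP ∘ (a ∷_)) eq (induced i)) (All.tabulate λ j → d (subst (_ ∈_) (sym eq) j)) v∈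
      ... | e , wk = c , e , subst (c ∈_) (sym eq) (here refl) , wk

    -- Without its base vertex a path has no edge to the other two, so low parts can be legs of a
    -- theta at the apex.
    LowPart : Fin 3 → V → Set
    LowPart i v = v ∈ p i × v ≢ b i

    low-walk : ∀ i {v} → v ∈ p i → v ≢ b i → ∃[ c ] (E a c × Walk G (LowPart i) c v)
    low-walk i {v} v∈ ne with endsAt-snoc (ends i)
    ... | l , eq = go l eq (init l eq)
      where
      init : ∀ l → p i ≡ l ∷ʳ b i → v ∈ l
      init l eq with ∈-++⁻ l (subst (v ∈_) eq v∈)
      ... | inj₁ j = j
      ... | inj₂ (here refl) = ⊥-elim (ne refl)
      go : ∀ l → p i ≡ l ∷ʳ b i → v ∈ l → ∃[ c ] (E a c × Walk G (LowPart i) c v)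
      go (c ∷ l) eq v∈ with linkDown (ip-prefix {a ∷ c ∷ l} ip′ refl)
          (All.tabulate λ j → subst (_ ∈_) (sym eq) (∈-++⁺ˡ j) , ip-disjoint (a ∷ c ∷ l) ip′ (there j) (here refl)) v∈
        where
        ip′ : IP ((a ∷ c ∷ l) ++ b i ∷ [])
        ip′ = subst (IP ∘ (a ∷_)) eq (induced i)
      ... | e , wk = c , e , wk

    apex∉ : ∀ i → ¬ (a ∈ p i)
    apex∉ i j = ip-≢ (induced i) j refl

    -- The detour from `c` up to the base, across to path `k` and down to a neighbour of the apex.
    -- It avoids everything on path `i` below `c`.
    over : ∀ {i k} → i ≢ k → ∀ pre {c t} → p i ≡ pre ++ c ∷ t →
      ∃[ h ] (E h a × Walk G (λ v → v ∈ c ∷ t ⊎ v ∈ p k) c h)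
    over {i} {k} ne pre {c} {t} eq with head-walk k {D = λ v → v ∈ c ∷ t ⊎ v ∈ p k} inj₂ (endsAt-∈ (ends k))
    ... | h , ah , _ , wk = h , E-sym ah ,
      walk-++ (ip-walk (ip-suffix (a ∷ pre) (subst (IP ∘ (a ∷_)) eq (induced i))) (All.tabulate inj₁)
                (endsAt-++ pre (subst (EndsAt (b i)) eq (ends i))))
              (step (inj₁ (endsAt-∈ (endsAt-++ pre (subst (EndsAt (b i)) eq (ends i))))) (triangle ne) (walk-reverse wk))

    ends-edge : ∀ {xs f g t} → EndsAt f xs → IP (xs ++ g ∷ t) → E f g
    ends-edge en ip with endsAt-snoc en
    ... | l , refl = ip-mid-edge l (subst IP (++-assoc l _ _) ip)

    base∈suffix : ∀ {i} pre {c t} → p i ≡ pre ++ c ∷ t → b i ∈ c ∷ t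
    base∈suffix {i} pre eq = endsAt-∈ (endsAt-++ pre (subst (EndsAt (b i)) eq (ends i)))

    ip-at : ∀ {i l} → p i ≡ l → IP (a ∷ l)
    ip-at eq = subst (IP ∘ (a ∷_)) eq (induced _)

    cross-low : ∀ {i j u v} → i ≢ j → u ∈ p i → LowPart j v → Far u v
    cross-low ne u∈ (v∈ , v≢) = proj₁ (cross ne u∈ v∈) , λ e → v≢ (proj₂ (proj₂ (cross ne u∈ v∈) e))

    cross-prefix : ∀ {i k u v} → i ≢ k → ∀ xs {c t} → p i ≡ xs ++ c ∷ t → u ∈ xs → v ∈ p k → Far u v
    cross-prefix {i} {k} {u} ne xs {c} {t} eq u∈ v∈ = proj₁ cr ,
      λ e → ip-disjoint (a ∷ xs) (ip-at eq) (there u∈) (base∈suffix xs eq) (proj₁ (proj₂ cr e))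
      where cr = cross ne (subst (u ∈_) (sym eq) (∈-++⁺ˡ u∈)) v∈

    -- The low parts of the three paths are the legs of a theta with ends `a` and `y`; feet at base
    -- vertices are excluded by `Clear`.
    no-triple : ∀ {y} → Clear y → Out y → (∀ i → Touch i y) → ⊥
    no-triple {y} cl out t = no-theta {A = LowPart 0F} {LowPart 1F} {LowPart 2F}
      (far-sym (apex cl))
      (apex∉ _ ∘ proj₁) (out _ ∘ proj₁) (apex∉ _ ∘ proj₁) (out _ ∘ proj₁) (apex∉ _ ∘ proj₁) (out _ ∘ proj₁)
      (λ u v → cross-low (λ ()) (proj₁ u) v) (λ u v → cross-low (λ ()) (proj₁ u) v) (λ u v → cross-low (λ ()) (proj₁ u) v)
      (arm 0F) (arm 1F) (arm 2F)
      where
      arm : ∀ i → Link (LowPart i) a y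
      arm i with find (t i)
      ... | u , u∈ , e with low-walk i u∈ (λ { refl → proj₂ (bases cl i) e })
      ...   | c , ac , wk = link ac wk (E-sym e)

    module Bridge {i j k : Fin 3} (i≢j : i ≢ j) (k≢i : k ≢ i) (k≢j : k ≢ j) where

      -- The region of a bridge from path `i` to path `j`, with ends `m` and `m′`. The third path
      -- stays untouched because the detour through the base may have to use it.
      record Q (m m′ y : V) : Set where
        constructor mkQ
        field
          clear : Clear y
          out : Out y
          touchˡ : Touch i y → y ≡ m
          touchʳ : Touch j y → y ≡ m′
          free : ¬ Touch k y
      open Q

      i≢k : i ≢ k
      i≢k e = k≢i (sym e)

      foot-≢base : ∀ {m u l} → Clear m → E m u → u ≢ b l
      foot-≢base {l = l} cl e refl = proj₂ (bases cl l) e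

      foot-apex : ∀ {m u l} → Clear m → u ∈ p l → E m u → Far u a
      foot-apex {l = l} cl u∈ e = (λ { refl → apex∉ l u∈ }) , λ e′ → proj₂ (heads cl l u∈ (E-sym e′)) e

      exit : ∀ {m m′} → Q m m′ m′ → Touch j m′ → ∃[ f ] ∃[ h ] (E m′ f × Walk G (LowPart j) f h × E h a)
      exit q t with find t
      ... | f , f∈ , e with low-walk j f∈ (foot-≢base (clear q) e)
      ...   | c , ac , wk = f , c , e , walk-reverse wk , E-sym ac

      q-far : ∀ {m m′ u v} → u ∈ p i → ¬ E m u → Q m m′ v → Far u v
      q-far u∈ ¬e q = (λ { refl → out q i u∈ }) , λ e → ¬e (subst (λ z → E z _) (touchˡ q (touch u∈ (E-sym e))) (E-sym e))

      q-far-k : ∀ {m m′ u v} → u ∈ p k → Q m m′ v → Far u v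
      q-far-k u∈ q = (λ { refl → out q k u∈ }) , λ e → free q (touch u∈ (E-sym e))

      -- A theta with ends `g` and `a`. Its legs go down path `i`, up path `i` and back along path
      -- `k`, and over the bridge and down path `j`. `Clear` makes `g` nonadjacent to `a` and
      -- different from the base vertex.
      not-one : ∀ {m m′} → Walk G (Q m m′) m m′ → Touch j m′ →
        ∀ pre g suf → p i ≡ pre ++ g ∷ suf → E m g → All (¬_ ∘ E m) pre → All (¬_ ∘ E m) suf → ⊥
      not-one {m} {m′} wk tj pre g suf eq e nopre nosuf =
        no-theta {A = D₁} {D₂} {D₃} (foot-apex (clear qm) g∈ e)
          (λ g∈pre → ip-disjoint (a ∷ pre) ip (there g∈pre) (here refl) refl) (apex∉ i ∘ pre⊂)
          (λ { (inj₁ s) → ip-≢ (ip-suffix (a ∷ pre) ip) s refl ; (inj₂ s) → proj₁ (cross i≢k g∈ s) refl })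
          (λ { (inj₁ s) → apex∉ i (suf⊂ s) ; (inj₂ s) → apex∉ k s })
          (λ { (inj₁ q) → out q i g∈ ; (inj₂ s) → proj₁ (cross i≢j g∈ (proj₁ s)) refl })
          (λ { (inj₁ q) → proj₁ (apex (clear q)) refl ; (inj₂ s) → apex∉ j (proj₁ s) })
          (λ { u∈ (inj₁ s) → ip-sep (a ∷ pre) ip (there u∈) s ; u∈ (inj₂ s) → cross-prefix i≢k pre eq u∈ s })
          (λ { u∈ (inj₁ q) → q-far (pre⊂ u∈) (All.lookup nopre u∈) q ; u∈ (inj₂ s) → cross-low i≢j (pre⊂ u∈) s })
          (λ { (inj₁ u∈) (inj₁ q) → q-far (suf⊂ u∈) (All.lookup nosuf u∈) q
             ; (inj₁ u∈) (inj₂ s) → cross-low i≢j (suf⊂ u∈) s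
             ; (inj₂ u∈) (inj₁ q) → q-far-k u∈ q
             ; (inj₂ u∈) (inj₂ s) → cross-low k≢j u∈ s })
          (arm₁ pre eq) (arm₂ suf eq) arm₃
        where
        qm = walk-source wk
        ip : IP ((a ∷ pre) ++ g ∷ suf)
        ip = ip-at eq
        g∈ : g ∈ p i
        g∈ = subst (g ∈_) (sym eq) (∈-++⁺ʳ pre (here refl))
        pre⊂ : ∀ {u} → u ∈ pre → u ∈ p i
        pre⊂ u∈ = subst (_ ∈_) (sym eq) (∈-++⁺ˡ u∈)
        suf⊂ : ∀ {u} → u ∈ suf → u ∈ p i
        suf⊂ u∈ = subst (_ ∈_) (sym eq) (∈-++⁺ʳ pre (there u∈))
        D₁ D₂ D₃ : V → Set
        D₁ v = v ∈ pre
        D₂ v = v ∈ suf ⊎ v ∈ p k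
        D₃ v = Q m m′ v ⊎ LowPart j v
        arm₁ : ∀ pre → p i ≡ pre ++ g ∷ suf → Link (_∈ pre) g a
        arm₁ [] eq with ip-at eq
        ... | cons ag _ _ = ⊥-elim (proj₂ (foot-apex (clear qm) g∈ e) (E-sym ag))
        arm₁ (c ∷ pre) eq with lastOf c pre
        ... | f , en with linkDown (ip-prefix {a ∷ c ∷ pre} (ip-at eq) refl) (All.tabulate id) (endsAt-∈ en)
        ...   | ac , wk₁ = link (E-sym (ends-edge (there en) (ip-at eq))) (walk-reverse wk₁) (E-sym ac)
        arm₂ : ∀ suf → p i ≡ pre ++ g ∷ suf → Link (λ v → v ∈ suf ⊎ v ∈ p k) g a
        arm₂ [] eq with base∈suffix pre eq
        ... | here refl = ⊥-elim (foot-≢base (clear qm) e refl)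
        arm₂ (s ∷ suf) eq with over i≢k (pre ∷ʳ g) (trans eq (sym (++-assoc pre _ _)))
        ... | h , ha , wk₂ = link (ip-mid-edge (a ∷ pre) (ip-at eq)) wk₂ ha
        arm₃ : Link D₃ g a
        arm₃ with exit (walk-target wk) tj
        ... | f , h , e′ , wk′ , ha = link (E-sym e) (walk-++ (walk-map inj₁ wk) (step (inj₁ (walk-target wk)) e′ (walk-map inj₂ wk′))) ha

      -- A theta with ends `m` and `a`. Its legs go from `g` down path `i`, from `g′` up path `i`
      -- and back along path `k`, and over the bridge and down path `j`. The vertex `x` between the
      -- feet keeps the first two apart.
      not-wide : ∀ {m m′} → Walk G (Q m m′) m m′ → Touch j m′ →
        ∀ pre g x mid g′ suf → p i ≡ (pre ∷ʳ g) ++ x ∷ mid ++ g′ ∷ suf → E m g → E m g′ →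
        All (¬_ ∘ E m) pre → All (¬_ ∘ E m) suf → ⊥
      not-wide {m} {m′} wk tj pre g x mid g′ suf eq e e′ nopre nosuf =
        no-theta {A = D₁} {D₂} {D₃} (apex (clear qm))
          (out qm i ∘ pre⊂) (apex∉ i ∘ pre⊂)
          (λ { (inj₁ s) → out qm i (suf⊂ s) ; (inj₂ s) → out qm k s })
          (λ { (inj₁ s) → apex∉ i (suf⊂ s) ; (inj₂ s) → apex∉ k s })
          (λ { (inj₁ q) → proj₂ q refl ; (inj₂ s) → out qm j (proj₁ s) })
          (λ { (inj₁ q) → proj₁ (apex (clear (proj₁ q))) refl ; (inj₂ s) → apex∉ j (proj₁ s) })
          (λ { u∈ (inj₁ s) → ip-sep (a ∷ (pre ∷ʳ g)) (ip-at eq) (there u∈) (∈-++⁺ʳ mid s)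
             ; u∈ (inj₂ s) → cross-prefix i≢k (pre ∷ʳ g) eq u∈ s })
          (λ { u∈ (inj₁ q) → q′-far (pre⊂ u∈) q ; u∈ (inj₂ s) → cross-low i≢j (pre⊂ u∈) s })
          (λ { (inj₁ u∈) (inj₁ q) → q′-far (suf⊂ u∈) q
             ; (inj₁ u∈) (inj₂ s) → cross-low i≢j (suf⊂ u∈) s
             ; (inj₂ u∈) (inj₁ q) → q-far-k u∈ (proj₁ q)
             ; (inj₂ u∈) (inj₂ s) → cross-low k≢j u∈ s })
          (arm₁ (pre ∷ʳ g) eq (∈-++⁺ʳ pre (here refl))) arm₂ arm₃
        where
        qm = walk-source wk
        pre⊂ : ∀ {u} → u ∈ pre ∷ʳ g → u ∈ p i
        pre⊂ u∈ = subst (_ ∈_) (sym eq) (∈-++⁺ˡ u∈)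
        suf⊂ : ∀ {u} → u ∈ g′ ∷ suf → u ∈ p i
        suf⊂ u∈ = subst (_ ∈_) (sym eq) (∈-++⁺ʳ (pre ∷ʳ g) (there (∈-++⁺ʳ mid u∈)))
        D₁ D₂ D₃ : V → Set
        D₁ v = v ∈ pre ∷ʳ g
        D₂ v = v ∈ g′ ∷ suf ⊎ v ∈ p k
        D₃ v = (Q m m′ v × v ≢ m) ⊎ LowPart j v
        q′-far : ∀ {u v} → u ∈ p i → Q m m′ v × v ≢ m → Far u v
        q′-far u∈ (q , ne) = (λ { refl → out q i u∈ }) , λ e → ne (touchˡ q (touch u∈ (E-sym e)))
        arm₁ : ∀ l {t} → p i ≡ l ++ t → g ∈ l → Link (_∈ l) m a
        arm₁ (c ∷ l) eq g∈ with linkDown (ip-prefix {a ∷ c ∷ l} (ip-at eq) refl) (All.tabulate id) g∈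
        ... | ac , wk₁ = link e (walk-reverse wk₁) (E-sym ac)
        arm₂ : Link D₂ m a
        arm₂ with over i≢k ((pre ∷ʳ g) ++ x ∷ mid) (trans eq (sym (++-assoc (pre ∷ʳ g) _ _)))
        ... | h , ha , wk₂ = link e′ wk₂ ha
        arm₃ : Link D₃ m a
        -- The end `m` of the theta must not lie in the leg, so the bridge is entered after its last
        -- visit to `m`.
        arm₃ with exit (walk-target wk) tj | walk-leave wk
        ... | f , h , e″ , wk′ , ha | inj₁ refl = link e″ (walk-map inj₂ wk′) ha
        ... | f , h , e″ , wk′ , ha | inj₂ (_ , mw , wk₀) =
          link mw (walk-++ (walk-map inj₁ wk₀) (step (inj₁ (walk-target wk₀)) e″ (walk-map inj₂ wk′))) ha

    module _ {i j k : Fin 3} (i≢j : i ≢ j) (k≢i : k ≢ i) (k≢j : k ≢ j) where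

      open Bridge i≢j k≢i k≢j

      q-swap : ∀ {m m′ y} → Q m m′ y → Bridge.Q (λ e → i≢j (sym e)) k≢j k≢i m′ m y
      q-swap q = Bridge.mkQ (Q.clear q) (Q.out q) (Q.touchʳ q) (Q.touchˡ q) (Q.free q)

      -- A prism with triangles `m`, `g`, `g′` and `m′`, `h`, `h′`: the bridge joins `m` to `m′`,
      -- the lower portions of paths `i` and `j` meet at the apex, and the upper portions are joined
      -- by a base edge.
      not-two : ∀ {m m′} → Walk G (Q m m′) m m′ →
        ∀ pre g g′ suf → p i ≡ (pre ∷ʳ g) ++ g′ ∷ suf → E m g → E m g′ → All (¬_ ∘ E m) pre → All (¬_ ∘ E m) suf →
        ∀ pre′ h h′ suf′ → p j ≡ (pre′ ∷ʳ h) ++ h′ ∷ suf′ → E m′ h → E m′ h′ → All (¬_ ∘ E m′) pre′ → All (¬_ ∘ E m′) suf′ → ⊥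
      not-two {m} {m′} wk pre g g′ suf eq e e′ nopre nosuf pre′ h h′ suf′ eq′ d d′ nopre′ nosuf′ =
        no-prism {A = Q m m′} {B} {C} {m} {g} {g′} {m′} {h} {h′}
          (cross-far g∈ h∈ (foot-≢base (Q.clear qm) e)) (cross-far g′∈ h′∈ (foot-≢base (Q.clear qm) e′))
          e e′ (ends-edge (there (snoc-endsAt pre)) (ip-at eq)) d d′ (ends-edge (there (snoc-endsAt pre′)) (ip-at eq′))
          QB QC BC wk walkB walkC
        where
        qm = walk-source wk
        B C : V → Set
        B v = v ∈ pre ∷ʳ g ⊎ v ≡ a ⊎ v ∈ pre′ ∷ʳ h
        C v = v ∈ g′ ∷ suf ⊎ v ∈ h′ ∷ suf′
        pre⊂ : ∀ {u} → u ∈ pre ∷ʳ g → u ∈ p i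
        pre⊂ u∈ = subst (_ ∈_) (sym eq) (∈-++⁺ˡ u∈)
        suf⊂ : ∀ {u} → u ∈ g′ ∷ suf → u ∈ p i
        suf⊂ u∈ = subst (_ ∈_) (sym eq) (∈-++⁺ʳ (pre ∷ʳ g) u∈)
        pre′⊂ : ∀ {u} → u ∈ pre′ ∷ʳ h → u ∈ p j
        pre′⊂ u∈ = subst (_ ∈_) (sym eq′) (∈-++⁺ˡ u∈)
        suf′⊂ : ∀ {u} → u ∈ h′ ∷ suf′ → u ∈ p j
        suf′⊂ u∈ = subst (_ ∈_) (sym eq′) (∈-++⁺ʳ (pre′ ∷ʳ h) u∈)
        g∈ = pre⊂ (∈-++⁺ʳ pre (here refl))
        h∈ = pre′⊂ (∈-++⁺ʳ pre′ (here refl))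
        g′∈ = suf⊂ (here refl)
        h′∈ = suf′⊂ (here refl)
        cross-far : ∀ {u v} → u ∈ p i → v ∈ p j → u ≢ b i → Far u v
        cross-far u∈ v∈ ne = proj₁ (cross i≢j u∈ v∈) , λ e → ne (proj₁ (proj₂ (cross i≢j u∈ v∈) e))
        atˡ : ∀ {u v x} → Q m m′ u → v ∈ p i → (E m v → v ≡ x) → u ≢ v × (E u v → (u ≡ m × v ≡ x) ⊎ (u ≡ m′ × v ≡ h))
        atˡ q v∈ f = (λ { refl → Q.out q i v∈ }) , λ e → let u≡m = Q.touchˡ q (touch v∈ e) in
          inj₁ (u≡m , f (subst (λ z → E z _) u≡m e))
        QB : Crossing (Q m m′) m m′ B g h
        QB q (inj₁ v∈) = atˡ q (pre⊂ v∈) (snoc-only nopre v∈)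
        QB q (inj₂ (inj₁ refl)) = proj₁ (apex (Q.clear q)) , λ e → ⊥-elim (proj₂ (apex (Q.clear q)) e)
        QB q (inj₂ (inj₂ v∈)) = (λ { refl → Q.out q j (pre′⊂ v∈) }) , λ e → let u≡m = Q.touchʳ q (touch (pre′⊂ v∈) e) in
          inj₂ (u≡m , snoc-only nopre′ v∈ (subst (λ z → E z _) u≡m e))
        QC : Crossing (Q m m′) m m′ C g′ h′
        QC q (inj₁ v∈) = (λ { refl → Q.out q i (suf⊂ v∈) }) , λ e → let u≡m = Q.touchˡ q (touch (suf⊂ v∈) e) in
          inj₁ (u≡m , cons-only nosuf v∈ (subst (λ z → E z _) u≡m e))
        QC q (inj₂ v∈) = (λ { refl → Q.out q j (suf′⊂ v∈) }) , λ e → let u≡m = Q.touchʳ q (touch (suf′⊂ v∈) e) in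
          inj₂ (u≡m , cons-only nosuf′ v∈ (subst (λ z → E z _) u≡m e))
        apex-far : ∀ xs {c t v} → IP (a ∷ xs ∷ʳ c ++ t) → v ∈ t → Far a v
        apex-far [] (cons _ f _) v∈ = All.lookup f v∈
        apex-far (x ∷ xs) (cons _ f _) v∈ = All.lookup f (∈-++⁺ʳ (xs ∷ʳ _) v∈)
        BC : Crossing B g h C g′ h′
        BC (inj₁ u∈) (inj₁ v∈) = ip-disjoint (a ∷ pre ∷ʳ g) (ip-at eq) (there u∈) v∈ ,
          λ e → inj₁ (ip-cut (a ∷ pre) (ip-at (trans eq (++-assoc pre _ _))) (there u∈) v∈ e)
        BC (inj₁ u∈) (inj₂ v∈) = let f = cross-prefix i≢j (pre ∷ʳ g) eq u∈ (suf′⊂ v∈) in proj₁ f , λ e → ⊥-elim (proj₂ f e)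
        BC (inj₂ (inj₁ refl)) (inj₁ v∈) = let f = apex-far pre (ip-at eq) v∈ in proj₁ f , λ e → ⊥-elim (proj₂ f e)
        BC (inj₂ (inj₁ refl)) (inj₂ v∈) = let f = apex-far pre′ (ip-at eq′) v∈ in proj₁ f , λ e → ⊥-elim (proj₂ f e)
        BC (inj₂ (inj₂ u∈)) (inj₁ v∈) =
          let f = cross-prefix (λ e → i≢j (sym e)) (pre′ ∷ʳ h) eq′ u∈ (suf⊂ v∈) in proj₁ f , λ e → ⊥-elim (proj₂ f e)
        BC (inj₂ (inj₂ u∈)) (inj₂ v∈) = ip-disjoint (a ∷ pre′ ∷ʳ h) (ip-at eq′) (there u∈) v∈ ,
          λ e → inj₂ (ip-cut (a ∷ pre′) (ip-at (trans eq′ (++-assoc pre′ _ _))) (there u∈) v∈ e)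
        down : ∀ {i v} l {t} → p i ≡ l ++ t → v ∈ l → ∃[ c ] (E a c × Walk G (_∈ l) c v)
        down (c ∷ l) eq v∈ = c , linkDown (ip-prefix {a ∷ c ∷ l} (ip-at eq) refl) (All.tabulate id) v∈
        walkB : Walk G B g h
        walkB with down (pre ∷ʳ g) eq (∈-++⁺ʳ pre (here refl)) | down (pre′ ∷ʳ h) eq′ (∈-++⁺ʳ pre′ (here refl))
        ... | c , ac , wk₁ | c′ , ac′ , wk₂ =
          walk-++ (walk-map inj₁ (walk-reverse wk₁))
            (step (inj₁ (walk-source wk₁)) (E-sym ac) (step (inj₂ (inj₁ refl)) ac′ (walk-map (inj₂ ∘ inj₂) wk₂)))
        up : ∀ {i} pre {c t} → p i ≡ pre ++ c ∷ t → Walk G (_∈ c ∷ t) c (b i)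
        up {i} pre eq = ip-walk (ip-suffix (a ∷ pre) (ip-at eq)) (All.tabulate id) (endsAt-++ pre (subst (EndsAt (b i)) eq (ends i)))
        walkC : Walk G C g′ h′
        walkC = walk-++ (walk-map inj₁ (up (pre ∷ʳ g) eq))
          (step (inj₁ (base∈suffix (pre ∷ʳ g) eq)) (triangle i≢j) (walk-map inj₂ (walk-reverse (up (pre′ ∷ʳ h) eq′))))

    no-bridge : ∀ {i j k} (i≢j : i ≢ j) (k≢i : k ≢ i) (k≢j : k ≢ j) {m m′} →
      Walk G (Bridge.Q i≢j k≢i k≢j m m′) m m′ → Touch i m → Touch j m′ → ⊥
    no-bridge {i} {j} i≢j k≢i k≢j {m} {m′} wk t t′ with feet m (p i) t | feet m′ (p j) t′
    ... | one pre g suf eq e x y | _ = Bridge.not-one i≢j k≢i k≢j wk t′ pre g suf eq e x y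
    ... | wide pre g x mid g′ suf eq e e′ y z | _ = Bridge.not-wide i≢j k≢i k≢j wk t′ pre g x mid g′ suf eq e e′ y z
    ... | two _ _ _ _ _ _ _ _ _ | one pre g suf eq e x y =
      Bridge.not-one (λ e → i≢j (sym e)) k≢j k≢i (walk-reverse (walk-map (q-swap i≢j k≢i k≢j) wk)) t pre g suf eq e x y
    ... | two _ _ _ _ _ _ _ _ _ | wide pre g x mid g′ suf eq e e′ y z =
      Bridge.not-wide (λ e → i≢j (sym e)) k≢j k≢i (walk-reverse (walk-map (q-swap i≢j k≢i k≢j) wk)) t pre g x mid g′ suf eq e e′ y z
    ... | two a₁ a₂ a₃ a₄ a₅ a₆ a₇ a₈ a₉ | two b₁ b₂ b₃ b₄ b₅ b₆ b₇ b₈ b₉ =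
      not-two i≢j k≢i k≢j wk a₁ a₂ a₃ a₄ a₅ a₆ a₇ a₈ a₉ b₁ b₂ b₃ b₄ b₅ b₆ b₇ b₈ b₉

    -- Unless `y` touches the third path as well, it is a bridge by itself.
    no-double : ∀ {y i j} → Clear y → Out y → i ≢ j → Touch i y → Touch j y → ⊥
    no-double {y} {i} {j} cl out i≢j ti tj with third i j i≢j
    ... | k , k≢i , k≢j , only with touch? k y
    ...   | no ¬tk = no-bridge i≢j k≢i k≢j (here (Bridge.mkQ cl out (λ _ → refl) (λ _ → refl) ¬tk)) ti tj
    ...   | yes tk = no-triple cl out all
      where
      all : ∀ l → Touch l y
      all l with only l
      ... | inj₁ refl = ti
      ... | inj₂ (inj₁ refl) = tj
      ... | inj₂ (inj₂ refl) = tk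

    data Status (y : V) : Set where
      on : ∀ k → y ∈ p k → Status y
      away : Out y → (∀ k → ¬ Touch k y) → Status y
      touching : Out y → ∀ k → Touch k y → (∀ l → Touch l y → l ≡ k) → Status y

    status : ∀ {y} → Clear y → Status y
    status {y} cl with any? (λ k → Any.any? (y ≟ᶠ_) (p k))
    ... | yes (k , i) = on k i
    ... | no ¬on with any? (λ k → touch? k y)
    ...   | no ¬t = away (λ k i → ¬on (k , i)) λ k t → ¬t (k , t)
    ...   | yes (k , t) = touching out k t only
      where
      out : Out y
      out k i = ¬on (k , i)
      only : ∀ l → Touch l y → l ≡ k
      only l t′ with l ≟ᶠ k
      ... | yes e = e
      ... | no ne = ⊥-elim (no-double cl out ne t′ t)

    -- A vertex of a walk that starts at m and has met no path of the pyramid since then.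
    record Since (i : Fin 3) (m y : V) : Set where
      constructor mkSince
      field
        clear : Clear y
        out : Out y
        fresh : ∀ k → Touch k y → k ≡ i × y ≡ m

    -- The walk is followed while the path met last is remembered. `inside` is on that path;
    -- `outside` has left it and keeps the stretch since the last vertex `m` touching it, which
    -- turns into a bridge as soon as another path is touched.
    separated : ∀ {Y : V → Set} → (∀ {y} → Y y → Clear y) → ∀ {i j u v} → u ∈ p i → v ∈ p j → Walk G Y u v → i ≡ j
    separated {Y} clear {j = j} {v = v} u∈ v∈ wk = inside u∈ wk
      where
      inside : ∀ {i y} → y ∈ p i → Walk G Y y v → i ≡ j
      outside : ∀ {i m y} → Touch i m → Walk G (Since i m) m y → Walk G Y y v → i ≡ j
      inside {i} y∈ (here _) with i ≟ᶠ j
      ... | yes e = e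
      ... | no ne = ⊥-elim (proj₁ (cross ne y∈ v∈) refl)
      inside {i} {y} y∈ (step d e wk) with status (clear (walk-source wk))
      ... | away out none = ⊥-elim (none i (touch y∈ (E-sym e)))
      ... | touching out k t only with only i (touch y∈ (E-sym e))
      ...   | refl = outside t (here (mkSince (clear (walk-source wk)) out λ l t′ → only l t′ , refl)) wk
      inside {i} {y} y∈ (step d e wk) | on k z∈ with i ≟ᶠ k
      ... | yes refl = inside z∈ wk
      -- An edge leading directly from one path to another is a base edge, and base vertices are not
      -- `Clear`.
      ... | no ne = ⊥-elim (proj₁ (Clear.bases (clear d) i) (proj₁ (proj₂ (cross ne y∈ z∈) e)))
      outside {i} t wk₀ (here _) = ⊥-elim (Since.out (walk-target wk₀) j v∈)
      outside {i} {m} {y} t wk₀ (step d e wk) with status (clear (walk-source wk))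
      ... | away out none = outside t (walk-snoc wk₀ e (mkSince (clear (walk-source wk)) out λ k t′ → ⊥-elim (none k t′))) wk
      ... | on k z∈ with Since.fresh (walk-target wk₀) k (touch z∈ e)
      ...   | refl , refl = inside z∈ wk
      outside {i} {m} {y} t wk₀ (step d e wk) | touching out k t′ only with i ≟ᶠ k
      ... | yes refl = outside t′ (here (mkSince (clear (walk-source wk)) out λ l t″ → only l t″ , refl)) wk
      ... | no i≢k with third i k i≢k
      ...   | l , l≢i , l≢k , _ = ⊥-elim (no-bridge i≢k l≢i l≢k
              (walk-snoc (walk-map old wk₀) e (Bridge.mkQ (clear (walk-source wk)) out (λ t″ → ⊥-elim (i≢k (only i t″))) (λ _ → refl)
                λ t″ → l≢k (only l t″))) t t′)
        where
        old : ∀ {x} → Since i m x → Bridge.Q i≢k l≢i l≢k m _ x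
        old s = Bridge.mkQ (Since.clear s) (Since.out s) (λ t″ → proj₂ (Since.fresh s i t″))
          (λ t″ → ⊥-elim (i≢k (sym (proj₁ (Since.fresh s k t″))))) λ t″ → l≢i (proj₁ (Since.fresh s l t″))

-- Trees

-- The property climbs from `i₀` to the last index, wraps around to 0 and climbs to `j`.
next-closed : ∀ {k} {P : Fin (suc k) → Set} → (∀ i → P i → P (next i)) → ∀ {i} → P i → ∀ j → P j
next-closed {k} {P} next-step {i₀} p₀ j =
  up (toℕ j) {0F} {j} (subst P (next-last (fromℕ k) (toℕ-fromℕ k)) (next-step _ at-end)) (sym (ℕP.+-identityʳ _))
  where
  up : ∀ d {i j} → P i → toℕ j ≡ d + toℕ i → P j
  up zero p e = subst P (toℕ-injective (sym e)) p
  up (suc d) {i} {j} p e = up d (next-step i p)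
    (trans e (trans (sym (ℕP.+-suc d (toℕ i))) (cong (d +_) (sym (toℕ-next i not-last)))))
    where
    not-last : toℕ i ≢ k
    not-last i≡k = ℕP.<⇒≱ (toℕ<n j) (subst (suc k ≤_) (sym e) (s≤s (subst (_≤ d + toℕ i) i≡k (ℕP.m≤n+m (toℕ i) d))))
  at-end : P (fromℕ k)
  at-end = up (k ∸ toℕ i₀) p₀ (trans (toℕ-fromℕ k) (sym (ℕP.m∸n+n≡m (ℕP.≤-pred (toℕ<n i₀)))))

next-next : ∀ {k} → 2 ≤ k → (i : Fin (suc k)) → next (next i) ≢ i
next-next {k} 2≤k i e with next-cases i (next i) refl | next-cases (next i) (next (next i)) refl
... | inj₁ p | inj₁ q = ℕP.<⇒≢ (ℕP.m<n⇒m<1+n (ℕP.n<1+n (toℕ i))) (trans (cong toℕ (sym e)) (trans q (cong suc p)))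
... | inj₁ p | inj₂ (q , z) = ℕP.<⇒≢ 2≤k (trans (cong suc (cong toℕ (trans (sym z) e))) (trans (sym p) q))
... | inj₂ (p , z) | inj₁ q = ℕP.<⇒≢ 2≤k (trans (cong suc (cong toℕ (sym z))) (trans (sym q) (trans (cong toℕ e) p)))
... | inj₂ (p , z) | inj₂ (q , _) = ℕP.<⇒≢ (ℕP.<-trans (s≤s z≤n) 2≤k) (trans (cong toℕ (sym z)) q)

module Join {m₁ m₂ : ℕ} (T₁ : Graph m₁) (T₂ : Graph m₂) (a : Fin m₁) (b : Fin m₂) where

  adj⊎ : Fin m₁ ⊎ Fin m₂ → Fin m₁ ⊎ Fin m₂ → Bool
  adj⊎ (inj₁ u) (inj₁ v) = adj T₁ u v
  adj⊎ (inj₂ u) (inj₂ v) = adj T₂ u v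
  adj⊎ (inj₁ u) (inj₂ v) = ⌊ u ≟ᶠ a ⌋ ∧ ⌊ v ≟ᶠ b ⌋
  adj⊎ (inj₂ u) (inj₁ v) = ⌊ v ≟ᶠ a ⌋ ∧ ⌊ u ≟ᶠ b ⌋

  adj⊎-sym : ∀ x y → adj⊎ x y ≡ adj⊎ y x
  adj⊎-sym (inj₁ u) (inj₁ v) = Graph.sym T₁ u v
  adj⊎-sym (inj₂ u) (inj₂ v) = Graph.sym T₂ u v
  adj⊎-sym (inj₁ u) (inj₂ v) = refl
  adj⊎-sym (inj₂ u) (inj₁ v) = refl

  adj⊎-irrefl : ∀ x → adj⊎ x x ≡ false
  adj⊎-irrefl (inj₁ u) = irrefl T₁ u
  adj⊎-irrefl (inj₂ u) = irrefl T₂ u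

  tree : Graph (m₁ + m₂)
  tree = record
    { adj = λ x y → adj⊎ (splitAt m₁ x) (splitAt m₁ y)
    ; sym = λ x y → adj⊎-sym (splitAt m₁ x) (splitAt m₁ y)
    ; irrefl = λ x → adj⊎-irrefl (splitAt m₁ x) }

  inl : Fin m₁ → Fin (m₁ + m₂)
  inl u = u ↑ˡ m₂

  inr : Fin m₂ → Fin (m₁ + m₂)
  inr v = m₁ ↑ʳ v

  view : ∀ x → (∃[ u ] x ≡ inl u) ⊎ (∃[ v ] x ≡ inr v)
  view x with splitAt m₁ x in eq
  ... | inj₁ u = inj₁ (u , sym (splitAt⁻¹-↑ˡ eq))
  ... | inj₂ v = inj₂ (v , sym (splitAt⁻¹-↑ʳ eq))

  adj-ll : ∀ u v → adj tree (inl u) (inl v) ≡ adj T₁ u v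
  adj-ll u v rewrite splitAt-↑ˡ m₁ u m₂ | splitAt-↑ˡ m₁ v m₂ = refl

  adj-rr : ∀ u v → adj tree (inr u) (inr v) ≡ adj T₂ u v
  adj-rr u v rewrite splitAt-↑ʳ m₁ m₂ u | splitAt-↑ʳ m₁ m₂ v = refl

  bridge : adj tree (inl a) (inr b) ≡ true
  bridge rewrite splitAt-↑ˡ m₁ a m₂ | splitAt-↑ʳ m₁ m₂ b with a ≟ᶠ a | b ≟ᶠ b
  ... | yes _ | yes _ = refl
  ... | no ne | _ = ⊥-elim (ne refl)
  ... | yes _ | no ne = ⊥-elim (ne refl)

  bridge-only : ∀ u v → adj tree (inl u) (inr v) ≡ true → u ≡ a × v ≡ b
  bridge-only u v rewrite splitAt-↑ˡ m₁ u m₂ | splitAt-↑ʳ m₁ m₂ v with u ≟ᶠ a | v ≟ᶠ b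
  ... | yes p | yes q = λ _ → p , q
  ... | yes _ | no _ = λ ()
  ... | no _ | _ = λ ()

  inl≢inr : ∀ {u v} → inl u ≢ inr v
  inl≢inr {u} {v} e with trans (sym (splitAt-↑ˡ m₁ u m₂)) (trans (cong (splitAt m₁) e) (splitAt-↑ʳ m₁ m₂ v))
  ... | ()

  walk-inl : ∀ {P : Fin m₁ → Set} {P′ : Fin (m₁ + m₂) → Set} → (∀ {x} → P x → P′ (inl x)) →
    ∀ {u v} → Walk T₁ P u v → Walk tree P′ (inl u) (inl v)
  walk-inl f (here p) = here (f p)
  walk-inl f (step p e w) = step (f p) (trans (adj-ll _ _) e) (walk-inl f w)

  walk-inr : ∀ {P : Fin m₂ → Set} {P′ : Fin (m₁ + m₂) → Set} → (∀ {x} → P x → P′ (inr x)) →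
    ∀ {u v} → Walk T₂ P u v → Walk tree P′ (inr u) (inr v)
  walk-inr f (here p) = here (f p)
  walk-inr f (step p e w) = step (f p) (trans (adj-rr _ _) e) (walk-inr f w)

  connected : Connected T₁ → Connected T₂ → Connected tree
  connected c₁ c₂ s t with view s | view t
  ... | inj₁ (u , refl) | inj₁ (v , refl) = walk-inl id (c₁ u v)
  ... | inj₂ (u , refl) | inj₂ (v , refl) = walk-inr id (c₂ u v)
  ... | inj₁ (u , refl) | inj₂ (v , refl) = walk-++ (walk-inl id (c₁ u a)) (step tt bridge (walk-inr id (c₂ b v)))
  ... | inj₂ (u , refl) | inj₁ (v , refl) =
    walk-++ (walk-inr id (c₂ u b)) (step tt (adj-sym {T = tree} bridge) (walk-inl id (c₁ a v)))

  -- A cycle crossing from left to right must cross back, and both crossings use the edge between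
  -- `a` and `b`. So it returns to `a` after two steps, contrary to `next-next`. A cycle that never
  -- crosses lies in one of the trees.
  acyclic : ¬ HasCycle T₁ → ¬ HasCycle T₂ → ¬ HasCycle tree
  acyclic ac₁ ac₂ (k , c , 2≤k , inj , cyc) with any? (λ i → Left? (c i) ×-dec Right? (c (next i)))
    where
    Left? : ∀ x → Dec (∃[ u ] x ≡ inl u)
    Left? x = any? λ u → x ≟ᶠ inl u
    Right? : ∀ x → Dec (∃[ v ] x ≡ inr v)
    Right? x = any? λ v → x ≟ᶠ inr v
  ... | yes (i , (u , eu) , (v , ev)) with any? (λ j → any? (λ v → c j ≟ᶠ inr v) ×-dec any? (λ u → c (next j) ≟ᶠ inl u))
  ...   | yes (j , (v′ , ev′) , (u′ , eu′)) = next-next 2≤k i (inj (trans (cong (c ∘ next) (sym j≡)) (trans eu′ (trans (cong inl (trans (proj₁ ba′) (sym (proj₁ ba)))) (sym eu)))))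
    where
    ba : u ≡ a × v ≡ b
    ba = bridge-only u v (subst₂ (λ x y → adj tree x y ≡ true) eu ev (cyc i))
    ba′ : u′ ≡ a × v′ ≡ b
    ba′ = bridge-only u′ v′ (adj-sym {T = tree} (subst₂ (λ x y → adj tree x y ≡ true) ev′ eu′ (cyc j)))
    j≡ : j ≡ next i
    j≡ = inj (trans ev′ (trans (cong inr (trans (proj₂ ba′) (sym (proj₂ ba)))) (sym ev)))
  ...   | no none with next-closed {P = λ j → ∃[ v ] c j ≡ inr v} closed {next i} (v , ev) i
    where
    closed : ∀ j → (∃[ v ] c j ≡ inr v) → ∃[ v ] c (next j) ≡ inr v
    closed j r with view (c (next j))
    ... | inj₂ r′ = r′
    ... | inj₁ l = ⊥-elim (none (j , r , l))
  ...     | v′ , e = inl≢inr (trans (sym eu) e)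
  acyclic ac₁ ac₂ (k , c , 2≤k , inj , cyc) | no none with any? (λ i → any? (λ u → c i ≟ᶠ inl u))
  ... | yes (i , l) = ac₁ (k , proj₁ ∘ left , 2≤k ,
      (λ {x} {y} e → inj (trans (proj₂ (left x)) (trans (cong inl e) (sym (proj₂ (left y)))))) ,
      λ x → trans (sym (adj-ll _ _)) (subst₂ (λ p q → adj tree p q ≡ true) (proj₂ (left x)) (proj₂ (left (next x))) (cyc x)))
    where
    closed : ∀ j → (∃[ u ] c j ≡ inl u) → ∃[ u ] c (next j) ≡ inl u
    closed j r with view (c (next j))
    ... | inj₁ r′ = r′
    ... | inj₂ l = ⊥-elim (none (j , r , l))
    left : ∀ j → ∃[ u ] c j ≡ inl u
    left = next-closed closed l
  ... | no noleft = ac₂ (k , proj₁ ∘ right , 2≤k ,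
      (λ {x} {y} e → inj (trans (proj₂ (right x)) (trans (cong inr e) (sym (proj₂ (right y)))))) ,
      λ x → trans (sym (adj-rr _ _)) (subst₂ (λ p q → adj tree p q ≡ true) (proj₂ (right x)) (proj₂ (right (next x))) (cyc x)))
    where
    right : ∀ j → ∃[ v ] c j ≡ inr v
    right j with view (c j)
    ... | inj₁ l = ⊥-elim (noleft (j , l))
    ... | inj₂ r = r

  isTree : IsTree T₁ → IsTree T₂ → IsTree tree
  isTree (1≤ , c₁ , a₁) (_ , c₂ , a₂) = ℕP.≤-trans 1≤ (ℕP.m≤m+n m₁ m₂) , connected c₁ c₂ , acyclic a₁ a₂

point : Graph 1
point = record { adj = λ _ _ → false ; sym = λ _ _ → refl ; irrefl = λ _ → refl }

point-isTree : IsTree point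
point-isTree = s≤s z≤n , (λ { 0F 0F → here tt }) , λ { (k , c , 2≤k , _ , cyc) → absurd (cyc 0F) }
  where
  absurd : false ≡ true → ⊥
  absurd ()

-- Tree decompositions modulo a relation

module Decompositions {n : ℕ} (G : Graph n) where

  open Paths G

  -- The bag of a node t consists of the vertices of Y that are related to one of the at most k representatives of t.
  record TD (Y : V → Set) (_≈_ : V → V → Set) (k : ℕ) : Set where
    field
      {m} : ℕ
      tree : Graph m
      isTree : IsTree tree
      reps : Fin m → List V
      width : ∀ t → length (reps t) ≤ k
      repsIn : ∀ {t r} → r ∈ reps t → Y r
    In : Fin m → V → Set
    In t x = ∃[ r ] (r ∈ reps t × r ≈ x)
    field
      cover : ∀ {u v} → Y u → Y v → Near u v → ∃[ t ] (In t u × In t v)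
      conn : ∀ {x s t} → Y x → In s x → In t x → Walk tree (λ q → In q x) s t

    -- Consecutive vertices of the walk share a bag. Thus the nodes whose bags meet a connected
    -- vertex set are connected in the tree.
    spread : ∀ {D : V → Set} → (∀ {z} → D z → Y z) → ∀ {x y s t} → Walk G D x y → In s x → In t y →
      Walk tree (λ q → ∃[ z ] (D z × In q z)) s t
    spread D⊂Y (here d) is it = walk-map (λ i → _ , d , i) (conn (D⊂Y d) is it)
    spread D⊂Y (step d e wk) is it with cover (D⊂Y d) (D⊂Y (walk-source wk)) (inj₂ e)
    ... | q , ix , iw = walk-++ (walk-map (λ i → _ , d , i) (conn (D⊂Y d) is ix)) (spread D⊂Y wk iw it)

  open TD using (In)

  single : ∀ {Y : V → Set} {_≈_ : V → V → Set} {k} (l : List V) → length l ≤ k → (∀ {r} → r ∈ l → Y r) →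
    (∀ {v} → Y v → ∃[ r ] (r ∈ l × r ≈ v)) → TD Y _≈_ k
  single l len l⊂ cov = record
    { tree = point ; isTree = point-isTree ; reps = λ _ → l ; width = λ _ → len ; repsIn = l⊂
    ; cover = λ u v _ → 0F , cov u , cov v
    ; conn = λ { {s = 0F} {0F} _ i _ → here i } }

  transport : ∀ {Y Y′ : V → Set} {_≈_ : V → V → Set} {k} → (∀ {v} → Y v → Y′ v) → (∀ {v} → Y′ v → Y v) → TD Y _≈_ k → TD Y′ _≈_ k
  transport f g D = record
    { tree = tree ; isTree = isTree ; reps = reps ; width = width ; repsIn = λ i → f (repsIn i)
    ; cover = λ u v → cover (g u) (g v) ; conn = λ y → conn (g y) }
    where open TD D hiding (In)

  -- One tree edge suffices because the bags of `s` and `t` contain all common vertices. A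
  -- representative stands for a whole class, so both sides must be closed under `_≈_`. The
  -- embedding of the nodes of `A` is returned to keep a root bag at hand for the next gluing.
  glue : ∀ {Y₁ Y₂ Y : V → Set} {_≈_ : V → V → Set} {k} (A : TD Y₁ _≈_ k) (B : TD Y₂ _≈_ k) (s : Fin (TD.m A)) (t : Fin (TD.m B)) →
    (∀ {v} → Y₁ v → Y v) → (∀ {v} → Y₂ v → Y v) →
    (∀ {u v} → Y u → Y v → Near u v → (Y₁ u × Y₁ v) ⊎ (Y₂ u × Y₂ v)) →
    (∀ {v} → Y₁ v → Y₂ v → In A s v × In B t v) →
    (∀ {r v} → Y₁ r → r ≈ v → Y v → Y₁ v) → (∀ {r v} → Y₂ r → r ≈ v → Y v → Y₂ v) →
    Σ (TD Y _≈_ k) λ C → ∀ u → ∃[ u′ ] ∀ {v} → In A u v → In C u′ v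
  glue {Y₁} {Y₂} {Y} {_≈_} {k} A B s t Y₁⊂ Y₂⊂ edge common sat₁ sat₂ = C , λ u → J.inl u , inˡ
    where
    module A = TD A
    module B = TD B
    module J = Join A.tree B.tree s t
    reps : Fin (A.m + B.m) → List V
    reps x = [ A.reps , B.reps ]′ (splitAt A.m x)
    reps-inl : ∀ u → reps (J.inl u) ≡ A.reps u
    reps-inl u = cong [ A.reps , B.reps ]′ (splitAt-↑ˡ A.m u B.m)
    reps-inr : ∀ u → reps (J.inr u) ≡ B.reps u
    reps-inr u = cong [ A.reps , B.reps ]′ (splitAt-↑ʳ A.m B.m u)
    In′ : Fin (A.m + B.m) → V → Set
    In′ x v = ∃[ r ] (r ∈ reps x × r ≈ v)
    inˡ : ∀ {u v} → In A u v → In′ (J.inl u) v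
    inˡ {u} (r , i , e) = r , subst (r ∈_) (sym (reps-inl u)) i , e
    inʳ : ∀ {u v} → In B u v → In′ (J.inr u) v
    inʳ {u} (r , i , e) = r , subst (r ∈_) (sym (reps-inr u)) i , e
    inˡ⁻ : ∀ {u v} → In′ (J.inl u) v → In A u v
    inˡ⁻ {u} (r , i , e) = r , subst (r ∈_) (reps-inl u) i , e
    inʳ⁻ : ∀ {u v} → In′ (J.inr u) v → In B u v
    inʳ⁻ {u} (r , i , e) = r , subst (r ∈_) (reps-inr u) i , e
    width : ∀ x → length (reps x) ≤ k
    width x with J.view x
    ... | inj₁ (u , refl) = subst (λ l → length l ≤ k) (sym (reps-inl u)) (A.width u)
    ... | inj₂ (u , refl) = subst (λ l → length l ≤ k) (sym (reps-inr u)) (B.width u)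
    repsIn : ∀ {x r} → r ∈ reps x → Y r
    repsIn {x} {r} i with J.view x
    ... | inj₁ (u , refl) = Y₁⊂ (A.repsIn (subst (r ∈_) (reps-inl u) i))
    ... | inj₂ (u , refl) = Y₂⊂ (B.repsIn (subst (r ∈_) (reps-inr u) i))
    cover : ∀ {u v} → Y u → Y v → Near u v → ∃[ x ] (In′ x u × In′ x v)
    cover yu yv e with edge yu yv e
    ... | inj₁ (a , b) with A.cover a b e
    ...   | q , iu , iv = J.inl q , inˡ iu , inˡ iv
    cover yu yv e | inj₂ (a , b) with B.cover a b e
    ...   | q , iu , iv = J.inr q , inʳ iu , inʳ iv
    y₁ : ∀ {u v} → Y v → In A u v → Y₁ v
    y₁ y (r , i , e) = sat₁ (A.repsIn i) e y
    y₂ : ∀ {u v} → Y v → In B u v → Y₂ v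
    y₂ y (r , i , e) = sat₂ (B.repsIn i) e y
    across : ∀ {x p q} → Y x → In A p x → In B q x → Walk J.tree (λ r → In′ r x) (J.inl p) (J.inr q)
    across y ip iq with common (y₁ y ip) (y₂ y iq)
    ... | cs , ct = walk-++ (J.walk-inl inˡ (A.conn (y₁ y ip) ip cs)) (step (inˡ cs) J.bridge (J.walk-inr inʳ (B.conn (y₂ y iq) ct iq)))
    conn : ∀ {x p q} → Y x → In′ p x → In′ q x → Walk J.tree (λ r → In′ r x) p q
    conn {x} {p} {q} y ip iq with J.view p | J.view q
    ... | inj₁ (u , refl) | inj₁ (v , refl) = J.walk-inl inˡ (A.conn (y₁ y (inˡ⁻ ip)) (inˡ⁻ ip) (inˡ⁻ iq))
    ... | inj₂ (u , refl) | inj₂ (v , refl) = J.walk-inr inʳ (B.conn (y₂ y (inʳ⁻ ip)) (inʳ⁻ ip) (inʳ⁻ iq))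
    ... | inj₁ (u , refl) | inj₂ (v , refl) = across y (inˡ⁻ ip) (inʳ⁻ iq)
    ... | inj₂ (u , refl) | inj₁ (v , refl) = walk-reverse (across y (inˡ⁻ iq) (inʳ⁻ ip))
    C : TD Y _≈_ k
    C = record { tree = J.tree ; isTree = J.isTree A.isTree B.isTree ; reps = reps ; width = width ; repsIn = λ {x} → repsIn {x}
               ; cover = cover ; conn = conn }

  -- The classes are connected in the graph, so by `spread` the nodes whose bags meet a class form a
  -- subtree. The representatives, and with them the width, stay the same.
  coarsen : ∀ {Y : V → Set} {_≈_ : V → V → Set} {k} → IsEquivalence _≈_ →
    (∀ {x y} → Y x → Y y → x ≈ y → Walk G (λ z → Y z × x ≈ z) x y) → TD Y _≡_ k → TD Y _≈_ k
  coarsen {Y} {_≈_} eqv cells A = record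
    { tree = A.tree ; isTree = A.isTree ; reps = A.reps ; width = A.width ; repsIn = λ {t} → A.repsIn {t}
    ; cover = λ u v e → map₂ (λ { ((r , i , refl) , (r′ , i′ , refl)) → (r , i , re) , (r′ , i′ , re) }) (A.cover u v e)
    ; conn = λ { y (r , i , e) (r′ , i′ , e′) →
        walk-map (λ { (z , (yz , rz) , (_ , j , refl)) → z , j , tr (sy rz) e })
          (A.spread proj₁ (cells (A.repsIn i) (A.repsIn i′) (tr e (sy e′))) (r , i , refl) (r′ , i′ , refl)) } }
    where
    module A = TD A
    open IsEquivalence eqv renaming (refl to re; sym to sy; trans to tr)

  concatMap-length : ∀ {κ} (f : V → List V) → (∀ v → length (f v) ≤ κ) → ∀ l → length (concatMap f l) ≤ length l * κ
  concatMap-length f len [] = z≤n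
  concatMap-length {κ} f len (x ∷ l) = subst (_≤ κ + length l * κ) (sym (length-++ (f x))) (ℕP.+-mono-≤ (len x) (concatMap-length f len l))

  refine : ∀ {Y : V → Set} {_≈_ : V → V → Set} {k κ} (cell : V → List V) →
    (∀ {r x} → Y x → r ≈ x → x ∈ cell r) → (∀ {r x} → Y r → x ∈ cell r → Y x × r ≈ x) → (∀ v → length (cell v) ≤ κ) →
    TD Y _≈_ k → TD Y _≡_ (k * κ)
  refine {Y} {_≈_} {k} {κ} cell in-cell cell-in len A = record
    { tree = A.tree ; isTree = A.isTree ; reps = λ t → concatMap cell (A.reps t)
    ; width = λ t → ℕP.≤-trans (concatMap-length cell len (A.reps t)) (ℕP.*-monoˡ-≤ κ (A.width t))
    ; repsIn = λ {t} i → proj₁ (proj₂ (proj₂ (proj₂ (split t i))))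
    ; cover = λ u v e → map₂ (λ { (p , q) → to u p , to v q }) (A.cover u v e)
    ; conn = λ { {s = s} {t} y (r , i , refl) (r′ , i′ , refl) → walk-map (to y) (A.conn y (from s i) (from t i′)) } }
    where
    module A = TD A
    split : ∀ t {x} → x ∈ concatMap cell (A.reps t) → ∃[ r ] (r ∈ A.reps t × x ∈ cell r × Y x × r ≈ x)
    split t i with find (∈-concatMap⁻ cell i)
    ... | r , r∈ , x∈ = r , r∈ , x∈ , cell-in (A.repsIn r∈) x∈
    to : ∀ {t x} → Y x → In A t x → ∃[ r ] (r ∈ concatMap cell (A.reps t) × r ≡ x)
    to {t} {x} y (r , r∈ , e) = x , ∈-concatMap⁺ cell (lose r∈ (in-cell y e)) , refl
    from : ∀ t {x} → x ∈ concatMap cell (A.reps t) → In A t x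
    from t i with split t i
    ... | r , r∈ , _ , _ , e = r , r∈ , e

  -- Contracting R into the cell of b makes the cells of a and b share a bag.
  contract : ∀ {Y₁ Y R : V → Set} {_≈₁_ _≈_ : V → V → Set} {k} (a b : V) →
    IsEquivalence _≈₁_ → IsEquivalence _≈_ →
    (∀ {v} → Y v → Y₁ v) → (∀ {v} → R v → Y₁ v) → (∀ {v} → Y₁ v → Y v ⊎ R v) → (∀ {v} → Y v → ¬ R v) → Y b →
    (∀ {x y} → Y x → Y y → x ≈ y → x ≈₁ y) → (∀ {x y} → Y₁ x → Y y → x ≈₁ y → Y x × x ≈ y) → (∀ {x y} → Y₁ x → R y → x ≈₁ y → R x) →
    (∀ {x y} → R x → R y → Walk G R x y) →
    (∀ {x} → R x → ∃[ r ] ∃[ y ] (R r × Y y × b ≈ y × E r y)) →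
    (∃[ x ] ∃[ y ] (Y x × Y y × a ≈ x × b ≈ y × Near x y)) ⊎ (∃[ r ] ∃[ y ] (R r × Y y × a ≈ y × E r y)) →
    TD Y₁ _≈₁_ k → Σ (TD Y _≈_ k) λ C → ∃[ t ] ∀ {v} → Y v → a ≈ v ⊎ b ≈ v → In C t v
  contract {Y₁} {Y} {R} {_≈₁_} {_≈_} {k} a b eqv₁ eqv Y⊂ R⊂ Y₁-split disj yb to₁ from₁ R-sat R-conn anchor touching A = C , final touching
    where
    module A = TD A
    open IsEquivalence eqv renaming (refl to re; sym to sy; trans to tr)
    open IsEquivalence eqv₁ using () renaming (refl to re₁; trans to tr₁)
    data Rep (t : Fin A.m) (x : V) : Set where
      old : ∀ {r} → r ∈ A.reps t → Y r → r ≈ x → Rep t x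
      new : ∀ {r} → r ∈ A.reps t → R r → b ≈ x → Rep t x
    -- Representatives in `R` turn into `b` and the others stay; being one for one, this preserves
    -- the width.
    newRep : ∀ {l} → (∀ {r} → r ∈ l → Y₁ r) → List V
    newRep {[]} h = []
    newRep {r ∷ l} h = [ (λ _ → r) , (λ _ → b) ]′ (Y₁-split (h (here refl))) ∷ newRep {l} (λ i → h (there i))
    newRep-length : ∀ {l} (h : ∀ {r} → r ∈ l → Y₁ r) → length (newRep {l} h) ≡ length l
    newRep-length {[]} h = refl
    newRep-length {r ∷ l} h = cong suc (newRep-length {l} (λ i → h (there i)))
    newRep-∈ : ∀ {l} (h : ∀ {r} → r ∈ l → Y₁ r) {x} → x ∈ newRep {l} h → ∃[ r ] (r ∈ l × ((Y r × x ≡ r) ⊎ (R r × x ≡ b)))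
    newRep-∈ {r ∷ l} h i with Y₁-split (h (here refl))
    newRep-∈ {r ∷ l} h (here refl) | inj₁ y = r , here refl , inj₁ (y , refl)
    newRep-∈ {r ∷ l} h (here refl) | inj₂ y = r , here refl , inj₂ (y , refl)
    newRep-∈ {r ∷ l} h (there i) | _ with newRep-∈ {l} (λ i → h (there i)) i
    ... | r′ , i′ , c = r′ , there i′ , c
    newRep-Y : ∀ {l} (h : ∀ {r} → r ∈ l → Y₁ r) {r} → r ∈ l → Y r → r ∈ newRep {l} h
    newRep-Y {_ ∷ l} h (here refl) y with Y₁-split (h (here refl))
    ... | inj₁ _ = here refl
    ... | inj₂ z = ⊥-elim (disj y z)
    newRep-Y {_ ∷ l} h (there i) y = there (newRep-Y {l} (λ i → h (there i)) i y)
    newRep-R : ∀ {l} (h : ∀ {r} → r ∈ l → Y₁ r) {r} → r ∈ l → R r → b ∈ newRep {l} h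
    newRep-R {_ ∷ l} h (here refl) z with Y₁-split (h (here refl))
    ... | inj₁ y = ⊥-elim (disj y z)
    ... | inj₂ _ = here refl
    newRep-R {_ ∷ l} h (there i) z = there (newRep-R {l} (λ i → h (there i)) i z)
    reps : Fin A.m → List V
    reps t = newRep {A.reps t} A.repsIn
    In′ : Fin A.m → V → Set
    In′ t x = ∃[ r ] (r ∈ reps t × r ≈ x)
    to : ∀ {t x} → Rep t x → In′ t x
    to (old i y e) = _ , newRep-Y A.repsIn i y , e
    to (new i z e) = _ , newRep-R A.repsIn i z , e
    from : ∀ {t x} → In′ t x → Rep t x
    from {t} (r , i , e) with newRep-∈ {A.reps t} A.repsIn i
    ... | r′ , i′ , inj₁ (y , refl) = old i′ y e
    ... | r′ , i′ , inj₂ (z , refl) = new i′ z e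
    keep : ∀ {t x} → Y x → In A t x → Rep t x
    keep y (r , i , e) = let p = from₁ (A.repsIn i) y e in old i (proj₁ p) (proj₂ p)
    carry : ∀ {t y} → R y → In A t y → ∃[ r ] (r ∈ A.reps t × R r)
    carry z (r , i , e) = r , i , R-sat (A.repsIn i) z e
    shift : ∀ {t x y} → Y x → Y y → x ≈ y → In A t x → In A t y
    shift yx yy e (r , i , e′) = r , i , tr₁ e′ (to₁ yx yy e)
    -- If `t` received `x` through a representative in `R`, the tree is followed along a walk in `R`
    -- to a bag covering an edge from `R` to the cell of `b`, which contained `x` before the
    -- contraction.
    hub : ∀ {t x} → Y x → Rep t x → ∃[ q ] (In A q x × Walk A.tree (λ p → In′ p x) t q)
    hub y (old i yr e) = let ix = _ , i , to₁ yr y e in _ , ix , here (to (keep y ix))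
    hub y (new i z e) with anchor z
    ... | r₀ , y₀ , z₀ , yy₀ , e₀ , edge with A.cover (R⊂ z₀) (Y⊂ yy₀) (inj₂ edge)
    ...   | q , ir , iy = q , shift yy₀ y (tr (sy e₀) e) iy ,
            walk-map (λ { (_ , zz , iz) → let c = carry zz iz in to (new (proj₁ (proj₂ c)) (proj₂ (proj₂ c)) e) })
              (A.spread R⊂ (R-conn z z₀) (_ , i , re₁) ir)
    C : TD Y _≈_ k
    C = record
      { tree = A.tree ; isTree = A.isTree ; reps = reps
      ; width = λ t → subst (_≤ k) (sym (newRep-length {A.reps t} A.repsIn)) (A.width t)
      ; repsIn = λ {t} i → repY t (newRep-∈ {A.reps t} A.repsIn i)
      ; cover = λ yu yv e → let c = A.cover (Y⊂ yu) (Y⊂ yv) e in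
          proj₁ c , to (keep yu (proj₁ (proj₂ c))) , to (keep yv (proj₂ (proj₂ c)))
      ; conn = conn }
      where
      repY : ∀ t {x} → ∃[ r ] (r ∈ A.reps t × ((Y r × x ≡ r) ⊎ (R r × x ≡ b))) → Y x
      repY t (_ , _ , inj₁ (y , refl)) = y
      repY t (_ , _ , inj₂ (_ , refl)) = yb
      conn : ∀ {x s t} → Y x → In′ s x → In′ t x → Walk A.tree (λ q → In′ q x) s t
      conn y is it with hub y (from is) | hub y (from it)
      ... | q , iq , w₁ | q′ , iq′ , w₂ =
        walk-++ w₁ (walk-++ (walk-map (to ∘ keep y) (A.conn (Y⊂ y) iq iq′)) (walk-reverse w₂))
    final : (∃[ x ] ∃[ y ] (Y x × Y y × a ≈ x × b ≈ y × Near x y)) ⊎ (∃[ r ] ∃[ y ] (R r × Y y × a ≈ y × E r y)) →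
      ∃[ t ] ∀ {v} → Y v → a ≈ v ⊎ b ≈ v → In C t v
    final (inj₁ (x , y , yx , yy , ax , by , e)) with A.cover (Y⊂ yx) (Y⊂ yy) e
    ... | q , ix , iy = q , λ { yv (inj₁ av) → to (keep yv (shift yx yv (tr (sy ax) av) ix))
                              ; yv (inj₂ bv) → to (keep yv (shift yy yv (tr (sy by) bv) iy)) }
    final (inj₂ (r , y , z , yy , ay , e)) with A.cover (R⊂ z) (Y⊂ yy) (inj₂ e)
    ... | q , ir , iy = q , λ { yv (inj₁ av) → to (keep yv (shift yy yv (tr (sy ay) av) iy))
                              ; yv (inj₂ bv) → let c = carry z ir in to (new (proj₁ (proj₂ c)) (proj₂ (proj₂ c)) bv) }

-- Distances, balls and decidability of walks

module Metric {n : ℕ} (G : Graph n) where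

  open Paths G

  data Reach (Y : V → Set) : ℕ → V → V → Set where
    stop : ∀ {d u} → Y u → Reach Y d u u
    hop : ∀ {d u w v} → Y u → E u w → Reach Y d w v → Reach Y (suc d) u v

  Anywhere : V → Set
  Anywhere _ = ⊤

  reach-map : ∀ {Y Y′ : V → Set} → (∀ {v} → Y v → Y′ v) → ∀ {d u v} → Reach Y d u v → Reach Y′ d u v
  reach-map f (stop y) = stop (f y)
  reach-map f (hop y e r) = hop (f y) e (reach-map f r)

  module _ {Y : V → Set} where

    reach-target : ∀ {d u v} → Reach Y d u v → Y v
    reach-target (stop y) = y
    reach-target (hop _ _ r) = reach-target r

    reach-≤ : ∀ {d e u v} → d ≤ e → Reach Y d u v → Reach Y e u v
    reach-≤ le (stop y) = stop y
    reach-≤ (s≤s le) (hop y e r) = hop y e (reach-≤ le r)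

    reach-++ : ∀ {d e u v w} → Reach Y d u v → Reach Y e v w → Reach Y (d + e) u w
    reach-++ {zero} (stop y) r = r
    reach-++ {suc d} {e} (stop y) r = reach-≤ (ℕP.m≤n+m e (suc d)) r
    reach-++ (hop y e r) r′ = hop y e (reach-++ r r′)

    reach-snoc : ∀ {d u v w} → Reach Y d u v → E v w → Y w → Reach Y (suc d) u w
    reach-snoc (stop y) e y′ = hop y e (stop y′)
    reach-snoc (hop y e r) e′ y′ = hop y e (reach-snoc r e′ y′)

    reach-sym : ∀ {d u v} → Reach Y d u v → Reach Y d v u
    reach-sym (stop y) = stop y
    reach-sym (hop y e r) = reach-snoc (reach-sym r) (E-sym e) y

    -- Every vertex of the walk is reached by a prefix of it; hence balls are connected within
    -- themselves.
    reach-hull : ∀ {d u v} → Reach Y d u v → Reach (Reach Y d u) d u v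
    reach-hull (stop y) = stop (stop y)
    reach-hull (hop y e r) = hop (stop y) e (reach-map (hop y e) (reach-hull r))

    reach⇒walk : ∀ {d u v} → Reach Y d u v → Walk G Y u v
    reach⇒walk (stop y) = here y
    reach⇒walk (hop y e r) = step y e (reach⇒walk r)

    reach? : Decidable Y → ∀ d u v → Dec (Reach Y d u v)
    reach? Y? zero u v = map′ (λ { (y , refl) → stop y }) (λ { (stop y) → y , refl }) (Y? u ×-dec (u ≟ᶠ v))
    reach? Y? (suc d) u v = map′
      (λ { (y , inj₁ refl) → stop y ; (y , inj₂ (w , e , r)) → hop y e r })
      (λ { (stop y) → y , inj₁ refl ; (hop y e r) → y , inj₂ (_ , e , r) })
      (Y? u ×-dec ((u ≟ᶠ v) ⊎-dec any? (λ w → E? u w ×-dec reach? Y? d w v)))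

    ip⇒reach : ∀ {x l y} → IP (x ∷ l) → All Y (x ∷ l) → EndsAt y (x ∷ l) → Reach Y (length l) x y
    ip⇒reach [-] (d ∷ []) here = stop d
    ip⇒reach [-] (d ∷ []) (there ())
    ip⇒reach (cons e f p) (d ∷ ds) (there en) = hop d e (ip⇒reach p ds en)

  ip-length-≤ : ∀ {l} ys → IP l → (∀ {v} → v ∈ l → v ∈ ys) → length l ≤ length ys
  ip-length-≤ {l} ys p sub = injective⇒≤ {f = f} λ {i} {j} e → ip-injective p i j
    (trans (lookup-index (sub (∈-lookup i))) (trans (cong (lookup ys) e) (sym (lookup-index (sub (∈-lookup j))))))
    where
    f : Fin (length l) → Fin (length ys)
    f i = Any.index (sub (∈-lookup i))

  -- An induced path repeats no vertex, so `n` steps suffice. This makes the existence of walks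
  -- decidable.
  walk⇒reach : ∀ {Y : V → Set} {u v} → Walk G Y u v → Reach Y n u v
  walk⇒reach wk with walk⇒ipath wk
  ... | ipath t p ds en = reach-≤ (ℕP.≤-trans (ℕP.n≤1+n _) (subst (suc (length t) ≤_) (length-tabulate id) (ip-length-≤ (allFin n) p λ {v} _ → ∈-allFin v)))
          (ip⇒reach p ds en)

  walk? : ∀ {Y : V → Set} → Decidable Y → ∀ u v → Dec (Walk G Y u v)
  walk? Y? u v = map′ reach⇒walk walk⇒reach (reach? Y? n u v)

  -- The measure that decreases in the recursions over induced subgraphs.
  size : ∀ {Y : V → Set} → Decidable Y → ℕ
  size Y? = length (filter Y? (allFin n))

  size-< : ∀ {Y Z : V → Set} (Y? : Decidable Y) (Z? : Decidable Z) → (∀ {v} → Y v → Z v) → ∀ v → Z v → ¬ Y v → size Y? < size Z?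
  size-< {Y} {Z} Y? Z? Y⊂Z v zv ¬yv = go (allFin n) (∈-allFin v)
    where
    weak : ∀ l → length (filter Y? l) ≤ length (filter Z? l)
    weak [] = z≤n
    weak (x ∷ l) with Y? x | Z? x
    ... | yes y | yes z = s≤s (weak l)
    ... | yes y | no ¬z = ⊥-elim (¬z (Y⊂Z y))
    ... | no _ | yes z = ℕP.m≤n⇒m≤1+n (weak l)
    ... | no _ | no _ = weak l
    go : ∀ l → v ∈ l → length (filter Y? l) < length (filter Z? l)
    go (x ∷ l) (here refl) with Y? x | Z? x
    ... | yes y | _ = ⊥-elim (¬yv y)
    ... | no _ | yes z = s≤s (weak l)
    ... | no _ | no ¬z = ⊥-elim (¬z zv)
    go (x ∷ l) (there i) with Y? x | Z? x
    ... | yes y | yes z = s≤s (go l i)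
    ... | yes y | no ¬z = ⊥-elim (¬z (Y⊂Z y))
    ... | no _ | yes z = ℕP.m≤n⇒m≤1+n (go l i)
    ... | no _ | no _ = go l i

  nbrs : V → List V
  nbrs v = filter (E? v) (allFin n)

  nbrs-length : ∀ v → length (nbrs v) ≡ degree G v
  nbrs-length v = go (allFin n)
    where
    go : ∀ l → length (filter (E? v) l) ≡ sum (map (λ u → if adj G v u then 1 else 0) l)
    go [] = refl
    go (u ∷ l) with adj G v u
    ... | true = cong suc (go l)
    ... | false = go l

  ball : ℕ → V → List V
  ball zero v = v ∷ []
  ball (suc d) v = v ∷ concatMap (ball d) (nbrs v)

  ∈-ball : ∀ {Y d u v} → Reach Y d u v → v ∈ ball d u
  ∈-ball {d = zero} (stop y) = here refl
  ∈-ball {d = suc d} (stop y) = here refl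
  ∈-ball {d = suc d} (hop y e r) = there (∈-concatMap⁺ (ball d) (lose (∈-filter⁺ (E? _) (∈-allFin _) e) (∈-ball r)))

ballBound : ℕ → ℕ → ℕ
ballBound δ zero = 1
ballBound δ (suc d) = suc (δ * ballBound δ d)

module Bounded {n : ℕ} (G : Graph n) {δ : ℕ} (deg : MaxDegree≤ G δ) where

  open Paths G
  open Metric G
  open Decompositions G using (concatMap-length)

  ball-length : ∀ d v → length (ball d v) ≤ ballBound δ d
  ball-length zero v = s≤s z≤n
  ball-length (suc d) v = s≤s (ℕP.≤-trans (concatMap-length (ball d) (ball-length d) (nbrs v))
    (ℕP.*-monoˡ-≤ (ballBound δ d) (subst (_≤ δ) (sym (nbrs-length v)) (deg v))))

-- Cells: the balls of radius 2 around the vertices with one of two colours, two of them being merged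
-- when they intersect.  Balls that meet a common cell have centres at distance at most 12.

module Cells {n : ℕ} (G : Graph n) {M : ℕ} (col : Fin n → Fin M)
  (proper : ∀ {u v} → Metric.Reach G (Metric.Anywhere G) 12 u v → col u ≡ col v → u ≡ v) (c₁ c₂ : Fin M) where

  open Paths G
  open Metric G

  Centre : V → Set
  Centre v = col v ≡ c₁ ⊎ col v ≡ c₂

  module _ (β : V → Set) where

    Ball : V → V → Set
    Ball = Reach β 2

    record Pair (v v′ : V) : Set where
      constructor pair
      field
        centre : Centre v
        centre′ : Centre v′
        {meet} : V
        left : Ball v meet
        right : Ball v′ meet

    -- `v` = `v′` is allowed and yields a single ball. Two centres are enough for a cell: with only
    -- two colours, a chain of intersecting balls never has three different centres.
    _≈_ : V → V → Set
    x ≈ y = x ≡ y ⊎ ∃[ v ] ∃[ v′ ] (Pair v v′ × (Ball v x ⊎ Ball v′ x) × (Ball v y ⊎ Ball v′ y))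

    any-reach : ∀ {d u v} → Reach β d u v → Reach Anywhere d u v
    any-reach = reach-map _

    pair-dist : ∀ {v v′} → Pair v v′ → Reach Anywhere 4 v v′
    pair-dist (pair _ _ l r) = any-reach (reach-++ l (reach-sym r))

    -- Two distinct nearby centres carry both colours, so a third nearby centre is one of them.
    third-centre : ∀ {v v′ u} → v ≢ v′ → Pair v v′ → Centre u → Reach Anywhere 12 v u → Reach Anywhere 12 v′ u → u ≡ v ⊎ u ≡ v′
    third-centre {v} {v′} {u} ne P cu r r′ = pick (Pair.centre P) (Pair.centre′ P) cu
      where
      same : ∀ {c} → col v ≡ c → col v′ ≡ c → ⊥
      same p q = ne (proper (reach-≤ (ℕP.m≤n+m 4 8) (pair-dist P)) (trans p (sym q)))
      is : ∀ {c} → col v ≡ c → col u ≡ c → u ≡ v ⊎ u ≡ v′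
      is p q = inj₁ (sym (proper r (trans p (sym q))))
      is′ : ∀ {c} → col v′ ≡ c → col u ≡ c → u ≡ v ⊎ u ≡ v′
      is′ p q = inj₂ (sym (proper r′ (trans p (sym q))))
      pick : Centre v → Centre v′ → Centre u → u ≡ v ⊎ u ≡ v′
      pick (inj₁ p) (inj₁ q) _ = ⊥-elim (same p q)
      pick (inj₂ p) (inj₂ q) _ = ⊥-elim (same p q)
      pick (inj₁ p) (inj₂ q) (inj₁ s) = is p s
      pick (inj₁ p) (inj₂ q) (inj₂ s) = is′ q s
      pick (inj₂ p) (inj₁ q) (inj₁ s) = is′ q s
      pick (inj₂ p) (inj₁ q) (inj₂ s) = is p s

    ≈-sym : ∀ {x y} → x ≈ y → y ≈ x
    ≈-sym (inj₁ e) = inj₁ (sym e)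
    ≈-sym (inj₂ (v , v′ , P , bx , by)) = inj₂ (v , v′ , P , by , bx)

    -- If one of the pairs has two different centres, these carry both colours, and the centres of
    -- the other pair, being near, are among them. Otherwise there are two single balls, which meet
    -- in `y` and form a new pair.
    ≈-trans : ∀ {x y z} → x ≈ y → y ≈ z → x ≈ z
    ≈-trans (inj₁ refl) r = r
    ≈-trans r@(inj₂ _) (inj₁ refl) = r
    ≈-trans {x} {y} {z} (inj₂ (v , v′ , P , bx , by)) (inj₂ (u , u′ , Q , by′ , bz)) with v ≟ᶠ v′ | u ≟ᶠ u′
    ... | no ne | _ = inj₂ (v , v′ , P , bx , move bz)
      where
      -- The origin of 12: from `v` or `v′` to `y` there are at most 4 + 2 steps, from `y` to `w` at
      -- most 2 + 4.
      to : ∀ {w} → Reach Anywhere 4 u w → Reach Anywhere 4 u′ w → Reach Anywhere 12 v w × Reach Anywhere 12 v′ w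
      to ru ru′ = reach-++ (proj₁ (rv by)) (near by′ ru ru′) , reach-++ (proj₂ (rv by)) (near by′ ru ru′)
        where
        rv : Ball v y ⊎ Ball v′ y → Reach Anywhere 6 v y × Reach Anywhere 6 v′ y
        rv (inj₁ b) = reach-≤ (ℕP.m≤n+m 2 4) (any-reach b) , reach-++ (reach-sym (pair-dist P)) (any-reach b)
        rv (inj₂ b) = reach-++ (pair-dist P) (any-reach b) , reach-≤ (ℕP.m≤n+m 2 4) (any-reach b)
        near : ∀ {w} → Ball u y ⊎ Ball u′ y → Reach Anywhere 4 u w → Reach Anywhere 4 u′ w → Reach Anywhere 6 y w
        near (inj₁ b) r r′ = reach-++ (reach-sym (any-reach b)) r
        near (inj₂ b) r r′ = reach-++ (reach-sym (any-reach b)) r′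
      move : Ball u z ⊎ Ball u′ z → Ball v z ⊎ Ball v′ z
      move (inj₁ b) with to (stop tt) (reach-sym (pair-dist Q))
      ... | r , r′ with third-centre ne P (Pair.centre Q) r r′
      ...   | inj₁ refl = inj₁ b
      ...   | inj₂ refl = inj₂ b
      move (inj₂ b) with to (pair-dist Q) (stop tt)
      ... | r , r′ with third-centre ne P (Pair.centre′ Q) r r′
      ...   | inj₁ refl = inj₁ b
      ...   | inj₂ refl = inj₂ b
    ... | yes refl | no ne = inj₂ (u , u′ , Q , move , bz)
      where
      dist : Ball u y ⊎ Ball u′ y → Reach Anywhere 12 u v × Reach Anywhere 12 u′ v
      dist (inj₁ b) = reach-≤ (ℕP.m≤n+m 4 8) uv , reach-≤ (ℕP.m≤n+m 8 4) (reach-++ (reach-sym (pair-dist Q)) uv)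
        where uv = reach-++ (any-reach b) (reach-sym (any-reach (reduce by)))
      dist (inj₂ b) = reach-≤ (ℕP.m≤n+m 8 4) (reach-++ (pair-dist Q) uv) , reach-≤ (ℕP.m≤n+m 4 8) uv
        where uv = reach-++ (any-reach b) (reach-sym (any-reach (reduce by)))
      move : Ball u x ⊎ Ball u′ x
      move with dist by′
      ... | r , r′ with third-centre ne Q (Pair.centre P) r r′
      ...   | inj₁ refl = inj₁ (reduce bx)
      ...   | inj₂ refl = inj₂ (reduce bx)
    ... | yes refl | yes refl = inj₂ (v , u , pair (Pair.centre P) (Pair.centre Q) (reduce by) (reduce by′) , inj₁ (reduce bx) , inj₂ (reduce bz))

    ≈-equivalence : IsEquivalence _≈_
    ≈-equivalence = record { refl = inj₁ refl ; sym = ≈-sym ; trans = ≈-trans }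

    -- 8 = 2 + 4 + 2: to a centre, to the other centre of the pair, and out again.
    ≈-dist : ∀ {x y} → x ≈ y → Reach Anywhere 8 x y
    ≈-dist (inj₁ refl) = stop tt
    ≈-dist (inj₂ (v , v′ , P , inj₁ bx , inj₁ by)) = reach-≤ (ℕP.m≤n+m 4 4) (reach-++ (reach-sym (any-reach bx)) (any-reach by))
    ≈-dist (inj₂ (v , v′ , P , inj₂ bx , inj₂ by)) = reach-≤ (ℕP.m≤n+m 4 4) (reach-++ (reach-sym (any-reach bx)) (any-reach by))
    ≈-dist (inj₂ (v , v′ , P , inj₁ bx , inj₂ by)) = reach-++ (reach-sym (any-reach bx)) (reach-++ (pair-dist P) (any-reach by))
    ≈-dist (inj₂ (v , v′ , P , inj₂ bx , inj₁ by)) = reach-++ (reach-sym (any-reach bx)) (reach-++ (reach-sym (pair-dist P)) (any-reach by))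

    ≈? : Decidable β → ∀ x y → Dec (x ≈ y)
    ≈? β? x y = (x ≟ᶠ y) ⊎-dec any? λ v → any? λ v′ → pair? v v′ ×-dec
      ((ball? v x ⊎-dec ball? v′ x) ×-dec (ball? v y ⊎-dec ball? v′ y))
      where
      ball? : ∀ v x → Dec (Ball v x)
      ball? = reach? β? 2
      centre? : ∀ v → Dec (Centre v)
      centre? v = (col v ≟ᶠ c₁) ⊎-dec (col v ≟ᶠ c₂)
      pair? : ∀ v v′ → Dec (Pair v v′)
      pair? v v′ = map′ (λ { (c , c′ , z , l , r) → pair c c′ l r }) (λ { (pair c c′ l r) → c , c′ , _ , l , r })
        (centre? v ×-dec (centre? v′ ×-dec any? λ z → ball? v z ×-dec ball? v′ z))

    ≈-ball : ∀ {v x y} → Centre v → Ball v x → Ball v y → x ≈ y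
    ≈-ball c bx by = inj₂ (_ , _ , pair c c bx bx , inj₁ bx , inj₁ by)

    ≈-walk : ∀ {x y} → β x → β y → x ≈ y → Walk G (λ z → β z × x ≈ z) x y
    ≈-walk bx by (inj₁ refl) = here (bx , inj₁ refl)
    ≈-walk {x} {y} _ _ (inj₂ (v , v′ , P , bx , by)) = walk-++ (walk-reverse (fromMeet bx)) (fromMeet by)
      where
      inside : ∀ {z} → Ball v z ⊎ Ball v′ z → β z × x ≈ z
      inside b = [ reach-target , reach-target ]′ b , inj₂ (v , v′ , P , bx , b)
      spoke : ∀ {u z} → (∀ {z} → Ball u z → Ball v z ⊎ Ball v′ z) → Ball u z → Walk G (λ z → β z × x ≈ z) u z
      spoke f b = walk-map (inside ∘ f) (reach⇒walk (reach-hull b))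
      fromMeet : ∀ {z} → Ball v z ⊎ Ball v′ z → Walk G (λ z → β z × x ≈ z) (Pair.meet P) z
      fromMeet (inj₁ b) = walk-++ (walk-reverse (spoke inj₁ (Pair.left P))) (spoke inj₁ b)
      fromMeet (inj₂ b) = walk-++ (walk-reverse (spoke inj₂ (Pair.right P))) (spoke inj₂ b)

  ≈-mono : ∀ {β β′ : V → Set} → (∀ {v} → β v → β′ v) → ∀ {x y} → _≈_ β x y → _≈_ β′ x y
  ≈-mono f (inj₁ e) = inj₁ e
  ≈-mono f (inj₂ (v , v′ , pair c c′ l r , bx , by)) =
    inj₂ (v , v′ , pair c c′ (reach-map f l) (reach-map f r) , both bx , both by)
    where
    both : ∀ {x} → _ ⊎ _ → Ball _ v x ⊎ Ball _ v′ x
    both (inj₁ b) = inj₁ (reach-map f b)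
    both (inj₂ b) = inj₂ (reach-map f b)

  -- Balls depend on the region. But by `reach-hull` the walks that witness `_≈_` stay in the cell
  -- of `x`, hence in the saturated set `F`, and so they survive in any region containing `F`.
  ≈-local : ∀ {β β₁ F : V → Set} → (∀ {v} → F v → β₁ v) → (∀ {x y} → F x → β y → _≈_ β x y → F y) →
    ∀ {x y} → F x → _≈_ β x y → _≈_ β₁ x y
  ≈-local F⊂ sat fx (inj₁ e) = inj₁ e
  ≈-local {β} {β₁} {F} F⊂ sat {x} fx (inj₂ (v , v′ , P@(pair c c′ l r) , bx , by)) =
    inj₂ (v , v′ , pair c c′ (moveˡ l) (moveʳ r) , both bx , both by)
    where
    inside : ∀ {z} → Ball β v z ⊎ Ball β v′ z → β₁ z
    inside b = F⊂ (sat fx ([ reach-target , reach-target ]′ b) (inj₂ (v , v′ , P , bx , b)))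
    moveˡ : ∀ {z} → Ball β v z → Ball β₁ v z
    moveˡ b = reach-map (inside ∘ inj₁) (reach-hull b)
    moveʳ : ∀ {z} → Ball β v′ z → Ball β₁ v′ z
    moveʳ b = reach-map (inside ∘ inj₂) (reach-hull b)
    both : ∀ {z} → Ball β v z ⊎ Ball β v′ z → Ball β₁ v z ⊎ Ball β₁ v′ z
    both (inj₁ b) = inj₁ (moveˡ b)
    both (inj₂ b) = inj₂ (moveʳ b)

-- Cells have diameter at most 8, so two of them cannot cover a path with this many vertices.
pathLength : ℕ → ℕ
pathLength δ = suc (ballBound δ 8 + ballBound δ 8)

-- Each colour pair costs one passage from cells back to vertices.
widthAfter : ∀ {A : Set} → ℕ → List A → ℕ → ℕ
widthAfter δ [] k = k
widthAfter δ (_ ∷ L) k = widthAfter δ L (k * ballBound δ 8)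

-- Splitting along pyramids and eliminating colour pairs

module Splitting {n : ℕ} (G : Graph n) (signing : OddSignable G) {δ : ℕ} (deg : MaxDegree≤ G δ)
  {M : ℕ} (col : Fin n → Fin M)
  (proper : ∀ {u v} → Metric.Reach G (Metric.Anywhere G) 12 u v → col u ≡ col v → u ≡ v) where

  open Paths G
  open PyramidSeparation G signing
  open Decompositions G
  open Metric G
  open Bounded G deg

  ℓ : ℕ
  ℓ = pathLength δ

  module Split (c₁ c₂ : Fin M) {β : V → Set} (β? : Decidable β) (P : Pyramid β ℓ)
    (apexColour : col (Pyramid.a P) ≡ c₁) (baseColour : col (Pyramid.b P 0F) ≡ c₂) where

    open Pyramid P
    open Separation P
    open Cells G col proper c₁ c₂

    _~_ : V → V → Set
    _~_ = _≈_ β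

    ~-equivalence : IsEquivalence _~_
    ~-equivalence = ≈-equivalence β

    open IsEquivalence ~-equivalence using () renaming (refl to ~-refl; sym to ~-sym; trans to ~-trans)

    b₀ : V
    b₀ = b 0F

    baseIn : ∀ i → β (b i)
    baseIn i = All.lookup (pathIn i) (endsAt-∈ (ends i))

    X Y : V → Set
    X z = β z × (a ~ z ⊎ b₀ ~ z)
    Y z = β z × ¬ X z

    X? : Decidable X
    X? z = β? z ×-dec (≈? β β? a z ⊎-dec ≈? β β? b₀ z)

    Y? : Decidable Y
    Y? z = β? z ×-dec ¬? (X? z)

    ballˡ : ∀ {z} → Ball β a z → X z
    ballˡ r = reach-target r , inj₁ (≈-ball β (inj₁ apexColour) (stop apexIn) r)

    ballʳ : ∀ {z} → Ball β b₀ z → X z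
    ballʳ r = reach-target r , inj₂ (≈-ball β (inj₂ baseColour) (stop (baseIn 0F)) r)

    b₀~b : ∀ i → b₀ ~ b i
    b₀~b i = ≈-ball β (inj₂ baseColour) (stop (baseIn 0F)) (baseBall i)
      where
      baseBall : ∀ i → Ball β b₀ (b i)
      baseBall 0F = stop (baseIn 0F)
      baseBall (fsuc i) = hop (baseIn 0F) (triangle λ ()) (stop (baseIn (fsuc i)))

    -- The reason for radius 2: the neighbours of `a` on the paths and the base vertices are within
    -- distance 1 of `a` and `b₀` respectively, so their neighbours still lie in the two balls.
    clear : ∀ {y} → Y y → Clear y
    clear {y} (yβ , y∉X) = record
      { apex = (λ { refl → y∉X (ballˡ (stop apexIn)) }) , λ e → y∉X (ballˡ (hop apexIn (E-sym e) (stop yβ)))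
      ; heads = λ i {u} u∈ au → let uβ = All.lookup (pathIn i) u∈ in
          (λ { refl → y∉X (ballˡ (hop apexIn au (stop uβ))) }) , λ e → y∉X (ballˡ (hop apexIn au (hop uβ (E-sym e) (stop yβ))))
      ; bases = bases }
      where
      bases : ∀ i → Far y (b i)
      bases 0F = (λ { refl → y∉X (ballʳ (stop yβ)) }) , λ e → y∉X (ballʳ (hop (baseIn 0F) (E-sym e) (stop yβ)))
      bases (fsuc i) = (λ { refl → y∉X (ballʳ (hop (baseIn 0F) (triangle λ ()) (stop yβ))) }) ,
        λ e → y∉X (ballʳ (hop (baseIn 0F) (triangle λ ()) (hop (baseIn (fsuc i)) (E-sym e) (stop yβ))))

    -- A path inside `X` would be covered by two balls of radius 8, which have fewer vertices than
    -- the path.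
    escape : ∀ i → ∃[ v ] (v ∈ p i × Y v)
    escape i with Any.any? (λ v → ¬? (X? v)) (p i)
    ... | yes some with find some
    ...   | v , v∈ , v∉X = v , v∈ , All.lookup (pathIn i) v∈ , v∉X
    escape i | no none = ⊥-elim (ℕP.<⇒≱ (long i) (ℕP.≤-trans (ip-length-≤ (ball 8 a ++ ball 8 b₀) (path (p i) (induced i) (ends i)) near)
        (subst (_≤ ballBound δ 8 + ballBound δ 8) (sym (length-++ (ball 8 a))) (ℕP.+-mono-≤ (ball-length 8 a) (ball-length 8 b₀)))))
      where
      path : ∀ l → IP (a ∷ l) → EndsAt (b i) l → IP l
      path (x ∷ l) (cons _ _ q) _ = q
      near : ∀ {v} → v ∈ p i → v ∈ ball 8 a ++ ball 8 b₀
      near {v} v∈ with X? v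
      ... | no v∉X = ⊥-elim (none (lose v∈ v∉X))
      ... | yes (_ , inj₁ e) = ∈-++⁺ˡ (∈-ball (≈-dist β e))
      ... | yes (_ , inj₂ e) = ∈-++⁺ʳ (ball 8 a) (∈-ball (≈-dist β e))

    record Run (i : Fin 3) (c : V) : Set where
      field
        run : List V
        start : c ∈ run
        connect : ∀ {z} → z ∈ run → Walk G (_∈ run) c z
        onPath : ∀ {z} → z ∈ run → z ∈ p i × ¬ X z
        {stop′ y} : V
        stop∈ : stop′ ∈ run
        yβ : β y
        b₀~y : b₀ ~ y
        arrive : E stop′ y

    -- The link between the two cells along path `i`: either they meet or are adjacent, or a run
    -- outside `X` leads from one to the other.
    data Segment (i : Fin 3) : Set where
      touching : ∀ {x y} → β x → β y → a ~ x → b₀ ~ y → Near x y → Segment i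
      running : ∀ {x c} → β x → a ~ x → E x c → Run i c → Segment i

    -- The path is scanned from the apex, and each return to the cell of `a` discards the current
    -- run. So the run that is finally kept reaches the cell of `b₀` without meeting `X`.
    segment : ∀ i → Segment i
    segment i = fromA ~-refl (induced i) (apexIn ∷ pathIn i) (All.tabulate id) (endsThere (p i) (ends i))
      where
      endsThere : ∀ l → EndsAt (b i) l → EndsAt (b i) (a ∷ l)
      endsThere l en = there en
      fromA : ∀ {x t} → a ~ x → IP (x ∷ t) → All β (x ∷ t) → All (_∈ p i) t → EndsAt (b i) (x ∷ t) → Segment i
      scan : ∀ {c t} → ¬ X c → IP (c ∷ t) → All β (c ∷ t) → All (_∈ p i) (c ∷ t) → EndsAt (b i) (c ∷ t) → Run i c ⊎ Segment i
      fromA {x} {[]} ax ip (xβ ∷ []) _ here = touching xβ xβ ax (b₀~b i) (inj₁ refl)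
      fromA {x} {[]} ax ip (xβ ∷ []) _ (there ())
      fromA {x} {c ∷ t} ax (cons e f ip) (xβ ∷ cβ ∷ ds) (c∈ ∷ os) (there en) with ≈? β β? b₀ c | ≈? β β? a c
      ... | yes bc | _ = touching xβ cβ ax bc (inj₂ e)
      ... | no _ | yes ac = fromA ac ip (cβ ∷ ds) os en
      ... | no ¬bc | no ¬ac with scan ([ ¬ac , ¬bc ]′ ∘ proj₂) ip (cβ ∷ ds) (c∈ ∷ os) en
      ...   | inj₁ r = running xβ ax e r
      ...   | inj₂ s = s
      scan {c} {[]} c∉X ip (cβ ∷ []) os here = ⊥-elim (c∉X (cβ , inj₂ (b₀~b i)))
      scan {c} {[]} c∉X ip (cβ ∷ []) os (there ())
      scan {c} {d ∷ t} c∉X (cons e f ip) (cβ ∷ dβ ∷ ds) (c∈ ∷ d∈ ∷ os) (there en) with ≈? β β? b₀ d | ≈? β β? a d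
      ... | yes bd | _ = inj₁ record
        { run = c ∷ [] ; start = here refl ; connect = λ { (here refl) → here (here refl) }
        ; onPath = λ { (here refl) → c∈ , c∉X } ; stop∈ = here refl ; yβ = dβ ; b₀~y = bd ; arrive = e }
      ... | no _ | yes ad = inj₂ (fromA ad ip (dβ ∷ ds) os en)
      ... | no ¬bd | no ¬ad with scan ([ ¬ad , ¬bd ]′ ∘ proj₂) ip (dβ ∷ ds) (d∈ ∷ os) en
      ...   | inj₂ s = inj₂ s
      ...   | inj₁ r = inj₁ record
        { run = c ∷ run ; start = here refl
        ; connect = λ { (here refl) → here (here refl) ; (there z∈) → step (here refl) e (walk-map there (connect z∈)) }
        ; onPath = λ { (here refl) → c∈ , c∉X ; (there z∈) → onPath z∈ }
        ; stop∈ = there stop∈ ; yβ = yβ ; b₀~y = b₀~y ; arrive = arrive }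
        where open Run r

    -- In effect a union of components of the graph that `X` leaves.
    record Part (F : V → Set) : Set where
      field
        sub : ∀ {v} → F v → Y v
        closed : ∀ {u v} → F u → Y v → Near u v → F v
        F? : Decidable F

      closed-walk : ∀ {u v} → F u → Walk G Y u v → F v
      closed-walk f (here _) = f
      closed-walk f (step _ e w) = closed-walk (closed f (walk-source w) (inj₂ e)) w

      -- A cell other than the two in `X` is connected and disjoint from `X`, so it lies in a single
      -- component.
      saturated : ∀ {x y} → F x ⊎ X x → β y → x ~ y → F y ⊎ X y
      saturated {x} {y} fx yβ xy with X? y
      ... | yes yX = inj₂ yX
      saturated {x} {y} (inj₂ (_ , c)) yβ xy | no y∉X = ⊥-elim (y∉X (yβ , [ (λ ax → inj₁ (~-trans ax xy)) , (λ bx → inj₂ (~-trans bx xy)) ]′ c))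
      saturated {x} {y} (inj₁ f) yβ xy | no y∉X = inj₁ (closed-walk f (walk-map avoid (≈-walk β (proj₁ (sub f)) yβ xy)))
        where
        avoid : ∀ {z} → β z × x ~ z → Y z
        avoid (zβ , xz) = zβ , λ { (_ , inj₁ az) → proj₂ (sub f) (proj₁ (sub f) , inj₁ (~-trans az (~-sym xz)))
                                 ; (_ , inj₂ bz) → proj₂ (sub f) (proj₁ (sub f) , inj₂ (~-trans bz (~-sym xz))) }

    open Part

    Piece : (F R : V → Set) → V → Set
    Piece F R v = (F v ⊎ X v) ⊎ R v

    -- The parts overlap exactly in `X`, so a bag containing all of `X` is the place to glue them.
    Rooted : (V → Set) → ℕ → Set
    Rooted F k = Σ (TD (λ v → F v ⊎ X v) _~_ k) λ C → ∃[ t ] ∀ {v} → X v → TD.In C t v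

    piece-in : ∀ {F R : V → Set} → Part F → (∀ {v} → R v → Y v) → ∀ {v} → Piece F R v → β v
    piece-in part R⊂ (inj₁ (inj₁ f)) = proj₁ (sub part f)
    piece-in part R⊂ (inj₁ (inj₂ x)) = proj₁ x
    piece-in part R⊂ (inj₂ r) = proj₁ (R⊂ r)

    -- Cells of the piece are computed inside the piece. On `F` and `X` they agree with those of
    -- `β`, by `≈-local` and saturation, and none of them runs into `R`; so `contract` applies and
    -- removes the run.
    root : ∀ {F R : V → Set} {k} (part : Part F) (R⊂ : ∀ {v} → R v → Y v) → (∀ {v} → F v → ¬ R v) →
      (∀ {x y} → R x → R y → Walk G R x y) →
      (∀ {x} → R x → ∃[ r ] ∃[ y ] (R r × (F y ⊎ X y) × b₀ ~ y × E r y)) →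
      (∃[ x ] ∃[ y ] ((F x ⊎ X x) × (F y ⊎ X y) × a ~ x × b₀ ~ y × Near x y)) ⊎ (∃[ r ] ∃[ y ] (R r × (F y ⊎ X y) × a ~ y × E r y)) →
      TD (Piece F R) (_≈_ (Piece F R)) k → Rooted F k
    root {F} {R} {k} part R⊂ F∩R R-conn anchor touch D = C , t , λ x → at (inj₂ x) (proj₂ x)
      where
      FX : V → Set
      FX v = F v ⊎ X v
      FX-in : ∀ {v} → FX v → β v
      FX-in f = piece-in {R = R} part R⊂ (inj₁ f)
      FX∩R : ∀ {v} → FX v → ¬ R v
      FX∩R (inj₁ f) = F∩R f
      FX∩R (inj₂ x) r = proj₂ (R⊂ r) x
      widen : ∀ {x y} → _≈_ (Piece F R) x y → x ~ y
      widen = ≈-mono (piece-in part R⊂)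
      result = contract {Y₁ = Piece F R} {FX} {R} {_≈_ (Piece F R)} {_~_} {k} a b₀ (≈-equivalence (Piece F R)) ~-equivalence
        inj₁ inj₂ id FX∩R (inj₂ (ballʳ (stop (baseIn 0F))))
        (λ fx fy e → ≈-local inj₁ (saturated part) fx e)
        (λ x₁ fy e → saturated part fy (piece-in part R⊂ x₁) (~-sym (widen e)) , widen e)
        (λ { (inj₁ fx) ry e → ⊥-elim (FX∩R (saturated part fx (proj₁ (R⊂ ry)) (widen e)) ry) ; (inj₂ rx) _ _ → rx })
        R-conn anchor touch D
      C = proj₁ result
      t = proj₁ (proj₂ result)
      at : ∀ {v} → FX v → a ~ v ⊎ b₀ ~ v → TD.In C t v
      at = proj₂ (proj₂ result)

    Component : Fin 3 → V → Set
    Component i z = ∃[ u ] (u ∈ p i × Walk G Y u z)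

    component : ∀ i → Part (Component i)
    component i = record
      { sub = λ { (_ , _ , wk) → walk-target wk }
      ; closed = λ { f _ (inj₁ refl) → f ; (u , u∈ , wk) y (inj₂ e) → u , u∈ , walk-snoc wk e y }
      ; F? = λ z → any? λ u → Any.any? (u ≟ᶠ_) (p i) ×-dec walk? Y? u z }

    Remainder : V → Set
    Remainder z = Y z × ¬ Component 0F z × ¬ Component 1F z

    remainder : Part Remainder
    remainder = record
      { sub = proj₁
      ; closed = λ { (yu , n₀ , n₁) yv e → yv , (λ c → n₀ (closed (component _) c yu (near-sym e))) , λ c → n₁ (closed (component _) c yu (near-sym e)) }
      ; F? = λ z → Y? z ×-dec (¬? (F? (component 0F) z) ×-dec ¬? (F? (component 1F) z)) }

    component-misses : ∀ {i j v} → i ≢ j → v ∈ p j → Y v → ¬ Component i v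
    component-misses ne v∈ y (u , u∈ , wk) = ne (separated clear u∈ v∈ wk)

    components-disjoint : ∀ {i j v} → Component i v → Component j v → i ≡ j
    components-disjoint (u , u∈ , wk) (u′ , u′∈ , wk′) = separated clear u∈ u′∈ (walk-++ wk (walk-reverse wk′))

    module Recursion {k : ℕ} {Bad : (V → Set) → Set} (bad-map : ∀ {β′} → (∀ {v} → β′ v → β v) → Bad β′ → Bad β)
      (solve : ∀ (β′ : V → Set) → Decidable β′ → (∀ {v} → β′ v → β v) → (∃[ v ] (β v × ¬ β′ v)) → TD β′ (_≈_ β′) k ⊎ Bad β′) where

      -- Of the two paths missed by `F`, path `i` supplies the run and path `j` a vertex outside the
      -- piece. Hence the piece is smaller than `β` and `solve` applies to it.
      rooted : ∀ {F : V → Set} (part : Part F) i j → i ≢ j → (∀ {v} → v ∈ p i → Y v → ¬ F v) → (∀ {v} → v ∈ p j → Y v → ¬ F v) →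
        Rooted F k ⊎ Bad β
      rooted {F} part i j i≢j miss-i miss-j with segment i | escape j
      ... | touching xβ yβ ax by e | v , v∈ , y = go (solve (Piece F (λ _ → ⊥)) (λ z → (F? part z ⊎-dec X? z) ⊎-dec no λ ())
              (piece-in part ⊥-elim) (v , proj₁ y , λ { (inj₁ (inj₁ f)) → miss-j v∈ y f ; (inj₁ (inj₂ x)) → proj₂ y x ; (inj₂ ()) }))
        where
        go : _ → Rooted F k ⊎ Bad β
        go (inj₁ D) = inj₁ (root part ⊥-elim (λ _ ()) (λ ()) (λ ())
          (inj₁ (_ , _ , inj₂ (xβ , inj₁ ax) , inj₂ (yβ , inj₂ by) , ax , by , e)) D)
        go (inj₂ B) = inj₂ (bad-map (piece-in part ⊥-elim) B)
      ... | running {x} xβ ax e r | v , v∈ , y = go (solve (Piece F (_∈ run)) (λ z → (F? part z ⊎-dec X? z) ⊎-dec Any.any? (z ≟ᶠ_) run)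
              (piece-in part R⊂) (v , proj₁ y , λ { (inj₁ (inj₁ f)) → miss-j v∈ y f ; (inj₁ (inj₂ x)) → proj₂ y x
                                                  ; (inj₂ v∈run) → proj₁ (cross i≢j (proj₁ (onPath v∈run)) v∈) refl }))
        where
        open Run r using (run; start; connect; onPath; stop∈; b₀~y; arrive)
        R⊂ : ∀ {v} → v ∈ run → Y v
        R⊂ v∈ = let o = onPath v∈ in All.lookup (pathIn i) (proj₁ o) , proj₂ o
        go : _ → Rooted F k ⊎ Bad β
        go (inj₁ D) = inj₁ (root part R⊂ (λ f v∈ → miss-i (proj₁ (onPath v∈)) (R⊂ v∈) f)
          (λ x∈ y∈ → walk-++ (walk-reverse (connect x∈)) (connect y∈))
          (λ _ → _ , _ , stop∈ , inj₂ (Run.yβ r , inj₂ b₀~y) , b₀~y , arrive)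
          (inj₂ (_ , _ , start , inj₂ (xβ , inj₁ ax) , ax , E-sym e)) D)
        go (inj₂ B) = inj₂ (bad-map (piece-in part R⊂) B)

      join : ∀ {F F′ F″ : V → Set} → Part F → Part F′ → Part F″ → (∀ {v} → F v → ¬ F′ v) →
        (∀ {v} → F v → F″ v) → (∀ {v} → F′ v → F″ v) → (∀ {v} → F″ v → F v ⊎ F′ v) → Rooted F k → Rooted F′ k → Rooted F″ k
      join {F} {F′} {F″} part part′ part″ disj l r split (A , s , hs) (B , t , ht)
        with glue A B s t (λ { (inj₁ f) → inj₁ (l f) ; (inj₂ x) → inj₂ x }) (λ { (inj₁ f) → inj₁ (r f) ; (inj₂ x) → inj₂ x })
          edge common (λ fx e y → saturated part fx (FX-in y) e) (λ fx e y → saturated part′ fx (FX-in y) e)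
        where
        FX-in : ∀ {v} → F″ v ⊎ X v → β v
        FX-in (inj₁ f) = proj₁ (sub part″ f)
        FX-in (inj₂ x) = proj₁ x
        edge : ∀ {u v} → F″ u ⊎ X u → F″ v ⊎ X v → Near u v → ((F u ⊎ X u) × (F v ⊎ X v)) ⊎ ((F′ u ⊎ X u) × (F′ v ⊎ X v))
        edge (inj₂ x) (inj₂ x′) e = inj₁ (inj₂ x , inj₂ x′)
        edge (inj₁ f) fv e with split f
        edge (inj₁ f) (inj₂ x) e | inj₁ g = inj₁ (inj₁ g , inj₂ x)
        edge (inj₁ f) (inj₂ x) e | inj₂ g = inj₂ (inj₁ g , inj₂ x)
        edge (inj₁ f) (inj₁ f′) e | inj₁ g = inj₁ (inj₁ g , inj₁ (closed part g (sub part″ f′) e))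
        edge (inj₁ f) (inj₁ f′) e | inj₂ g = inj₂ (inj₁ g , inj₁ (closed part′ g (sub part″ f′) e))
        edge (inj₂ x) (inj₁ f) e with split f
        ... | inj₁ g = inj₁ (inj₂ x , inj₁ g)
        ... | inj₂ g = inj₂ (inj₂ x , inj₁ g)
        common : ∀ {v} → F v ⊎ X v → F′ v ⊎ X v → TD.In A s v × TD.In B t v
        common (inj₂ x) _ = hs x , ht x
        common _ (inj₂ x) = hs x , ht x
        common (inj₁ f) (inj₁ f′) = ⊥-elim (disj f f′)
      ... | C , lift = C , proj₁ (lift s) , λ x → proj₂ (lift s) (hs x)

      Both : V → Set
      Both v = Component 0F v ⊎ Component 1F v

      both : Part Both
      both = record
        { sub = [ sub (component _) , sub (component _) ]′
        ; closed = λ { (inj₁ f) y e → inj₁ (closed (component _) f y e) ; (inj₂ f) y e → inj₂ (closed (component _) f y e) }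
        ; F? = λ z → F? (component _) z ⊎-dec F? (component _) z }

      everything : Part Y
      everything = record { sub = id ; closed = λ _ y _ → y ; F? = Y? }

      result : TD β _~_ k ⊎ Bad β
      result with rooted (component 0F) 2F 1F (λ ()) (component-misses λ ()) (component-misses λ ())
      ... | inj₂ B = inj₂ B
      ... | inj₁ T₀ with rooted (component 1F) 2F 0F (λ ()) (component-misses λ ()) (component-misses λ ())
      ...   | inj₂ B = inj₂ B
      ...   | inj₁ T₁ with rooted remainder 0F 1F (λ ()) (λ v∈ y c → proj₁ (proj₂ c) (_ , v∈ , here y)) (λ v∈ y c → proj₂ (proj₂ c) (_ , v∈ , here y))
      ...     | inj₂ B = inj₂ B
      ...     | inj₁ T₂ = inj₁ (transport [ proj₁ , proj₁ ]′ back (proj₁ whole))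
        where
        disj : ∀ {v} → Component 0F v → ¬ Component 1F v
        disj c c′ with components-disjoint c c′
        ... | ()
        decide : ∀ {v} → Y v → Both v ⊎ Remainder v
        decide {v} y with F? both v
        ... | yes c = inj₁ c
        ... | no ¬c = inj₂ (y , ¬c ∘ inj₁ , ¬c ∘ inj₂)
        whole : Rooted Y k
        whole = join both remainder everything (λ { (inj₁ c) r → proj₁ (proj₂ r) c ; (inj₂ c) r → proj₂ (proj₂ r) c })
          (sub both) (sub remainder) decide
          (join (component _) (component _) both disj inj₁ inj₂ id T₀ T₁) T₂
        back : ∀ {v} → β v → Y v ⊎ X v
        back {v} vβ with X? v
        ... | yes x = inj₂ x
        ... | no ¬x = inj₁ (vβ , ¬x)

  Coloured : List (Fin M × Fin M) → (V → Set) → Set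
  Coloured L β = Σ (Pyramid β ℓ) λ P → (col (Pyramid.a P) , col (Pyramid.b P 0F)) ∈ L

  coloured-map : ∀ {L} {β β′ : V → Set} → (∀ {v} → β′ v → β v) → Coloured L β′ → Coloured L β
  coloured-map f (P , c) = pyramid-map f P , c

  -- All regions are included because the elimination of a pair recurses into the pieces of a split.
  Claim : List (Fin M × Fin M) → ℕ → Set₁
  Claim L k = ∀ (β : V → Set) → Decidable β → TD β _≡_ k ⊎ Coloured L β

  -- `coarsen` enters the recursion `cells` without loss and each split preserves `k`; only the
  -- closing `refine` multiplies the width.
  eliminate : ∀ {c₁ c₂ L k} → Claim ((c₁ , c₂) ∷ L) k → Claim L (k * ballBound δ 8)
  eliminate {c₁} {c₂} {L} {k} claim β β? with cells β β? (<-wellFounded (size β?))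
    where
    open Cells G col proper c₁ c₂
    cells : ∀ β (β? : Decidable β) → Acc _<_ (size β?) → TD β (_≈_ β) k ⊎ Coloured L β
    cells β β? (acc rec) with claim β β?
    ... | inj₁ D = inj₁ (coarsen (≈-equivalence β) (≈-walk β) D)
    ... | inj₂ (P , there i) = inj₂ (P , i)
    ... | inj₂ (P , here refl) = Split.Recursion.result (col (Pyramid.a P)) (col (Pyramid.b P 0F)) β? P refl refl {k} {Coloured L} coloured-map
        λ β′ β′? β′⊂ (v , vβ , ¬v) → cells β′ β′? (rec (size-< β′? β? β′⊂ v vβ ¬v))
  ... | inj₂ B = inj₂ B
  ... | inj₁ D = inj₁ (refine cell (λ {r} {x} xβ e → ∈-filter⁺ (λ z → β? z ×-dec ≈? β β? r z) (∈-ball (≈-dist β e)) (xβ , e))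
        (λ {r} {x} _ i → proj₂ (∈-filter⁻ (λ z → β? z ×-dec ≈? β β? r z) {xs = ball 8 r} i))
        (λ v → ℕP.≤-trans (length-filter (λ z → β? z ×-dec ≈? β β? v z) (ball 8 v)) (ball-length 8 v)) D)
    where
    open Cells G col proper c₁ c₂
    cell : V → List V
    cell r = filter (λ z → β? z ×-dec ≈? β β? r z) (ball 8 r)

  eliminate-all : ∀ L {k} → Claim L k → ∀ (β : V → Set) → Decidable β → TD β _≡_ (widthAfter δ L k)
  eliminate-all [] claim β β? with claim β β?
  ... | inj₁ D = D
  ... | inj₂ (_ , ())
  eliminate-all (c ∷ L) claim = eliminate-all L (eliminate claim)

pairwise : ∀ {Q : Fin 3 → Fin 3 → Set} → (∀ {i j} → Q i j → Q j i) →
  Q 0F 1F → Q 0F 2F → Q 1F 2F → ∀ {i j} → i ≢ j → Q i j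
pairwise sy a b c {0F} {0F} ne = ⊥-elim (ne refl)
pairwise sy a b c {0F} {1F} ne = a
pairwise sy a b c {0F} {2F} ne = b
pairwise sy a b c {1F} {0F} ne = sy a
pairwise sy a b c {1F} {1F} ne = ⊥-elim (ne refl)
pairwise sy a b c {1F} {2F} ne = c
pairwise sy a b c {2F} {0F} ne = sy b
pairwise sy a b c {2F} {1F} ne = sy c
pairwise sy a b c {2F} {2F} ne = ⊥-elim (ne refl)

three : ∀ {ℓ} {A : Set ℓ} → A → A → A → Fin 3 → A
three a b c 0F = a
three a b c 1F = b
three a b c 2F = c

-- Three vertices joined by a claw or a triangle

module Tripods {n : ℕ} (G : Graph n) (signing : OddSignable G) where

  open Paths G
  open Holes G signing
  open PyramidSeparation G signing

  -- A leg `A i` may use `U` and its own `k′ i` only, so that the legs of an upper and a lower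
  -- tripod can be concatenated through columns.
  data Tripod (U : V → Set) (k′ : Fin 3 → V) : Set₁ where
    claw : ∀ z → U z → (A : Fin 3 → V → Set) → (∀ i {v} → A i v → U v ⊎ v ≡ k′ i) →
      (∀ i → ∃[ y ] (E y z × Walk G (A i) (k′ i) y)) → (∀ i → ¬ A i z) →
      (∀ {i j} → i ≢ j → Anticomplete (A i) (A j)) → Tripod U k′
    tri : (z : Fin 3 → V) → (A : Fin 3 → V → Set) → (∀ i {v} → A i v → U v ⊎ v ≡ k′ i) →
      (∀ i → Walk G (A i) (k′ i) (z i)) → (∀ {i j} → i ≢ j → E (z i) (z j)) →
      (∀ {i j} → i ≢ j → ∀ {u v} → A i u → A j v → u ≢ v × (E u v → u ≡ z i × v ≡ z j)) → Tripod U k′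

  module _ {U : V → Set} (k k′ : Fin 3 → V) (k′∉U : ∀ i → ¬ U (k′ i)) (kk′ : ∀ i → E (k′ i) (k i))
    (only : ∀ i {u} → U u → E (k′ i) u → u ≡ k i) (k′-far : ∀ {i j} → i ≢ j → Far (k′ i) (k′ j))
    (walk₀₁ : Walk G U (k 0F) (k 1F)) (walk₂₀ : Walk G U (k 2F) (k 0F)) where

    private
      i₀ i₁ i₂ : Fin 3
      i₀ = 0F
      i₁ = 1F
      i₂ = 2F

      D : V → Set
      D v = U v ⊎ v ≡ k′ i₀ ⊎ v ≡ k′ i₁

    -- An induced path `R` joins the first two of the `k′ i` through `U`; a walk from the third is
    -- followed to its first vertex `t` touching `R`. A single foot of `t` is the centre of a claw,
    -- a wide pair makes `t` the centre, and two consecutive feet form a triangle with `t`.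
    tripod : Tripod U k′
    tripod = onPath (walk⇒ipath (step (inj₂ (inj₁ refl)) (kk′ i₀) (walk-snoc (walk-map inj₁ walk₀₁) (E-sym (kk′ i₁)) (inj₂ (inj₂ refl)))))
      where
      onPath : IPath D (k′ i₀) (k′ i₁) → Tripod U k′
      onPath (ipath [] ip ds en) with endsAt-∈ en
      ... | here e = ⊥-elim (proj₁ (k′-far {i₁} {i₀} (λ ())) e)
      onPath (ipath (r₁ ∷ r) ip ds en) = attach
        where
        R : List V
        R = k′ i₀ ∷ r₁ ∷ r
        D∈ : ∀ {v} → v ∈ R → D v
        D∈ = All.lookup ds
        nbr : ∀ i {v} → v ∈ R → E (k′ i) v → v ≡ k i
        nbr i v∈ e with D∈ v∈
        ... | inj₁ u = only i u e
        nbr 0F v∈ e | inj₂ (inj₁ refl) = ⊥-elim (E-irrefl e)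
        nbr (fsuc i) v∈ e | inj₂ (inj₁ refl) = ⊥-elim (proj₂ (k′-far {fsuc i} {i₀} λ ()) e)
        nbr 0F v∈ e | inj₂ (inj₂ refl) = ⊥-elim (proj₂ (k′-far {i₀} {i₁} λ ()) e)
        nbr 1F v∈ e | inj₂ (inj₂ refl) = ⊥-elim (E-irrefl e)
        nbr 2F v∈ e | inj₂ (inj₂ refl) = ⊥-elim (proj₂ (k′-far {i₂} {i₁} λ ()) e)
        k₀∈ : k i₀ ∈ R
        k₀∈ = subst (_∈ R) (nbr i₀ (there (here refl)) (ip-mid-edge [] ip)) (there (here refl))
        before-end : ∀ {x y l e} → IP (x ∷ y ∷ l) → EndsAt e (x ∷ y ∷ l) → ∃[ z ] (z ∈ x ∷ y ∷ l × E e z)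
        before-end (cons xy _ _) (there here) = _ , here refl , E-sym xy
        before-end (cons _ _ p@(cons _ _ _)) (there (there en)) with before-end p (there en)
        ... | z , z∈ , e = z , there z∈ , e
        k₁∈ : k i₁ ∈ R
        k₁∈ with before-end ip en
        ... | z , z∈ , e = subst (_∈ R) (nbr i₁ z∈ e) z∈
        k′₂∉ : ¬ k′ i₂ ∈ R
        k′₂∉ i with D∈ i
        ... | inj₁ u = k′∉U i₂ u
        ... | inj₂ (inj₁ e) = proj₁ (k′-far {i₂} {i₀} λ ()) e
        ... | inj₂ (inj₂ e) = proj₁ (k′-far {i₂} {i₁} λ ()) e
        Touch : V → Set
        Touch y = Any (E y) R
        record Q (t y : V) : Set where
          constructor mkQ
          field
            at : U y ⊎ y ≡ k′ i₂
            out : ¬ y ∈ R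
            fresh : Touch y → y ≡ t
        approach : ∀ {y z} → ¬ y ∈ R → Walk G (λ v → U v ⊎ v ≡ k′ i₂) y z → Touch z → ∃[ t ] (Touch t × Walk G (Q t) y t)
        approach {y} y∉ wk t with Any.any? (E? y) R
        ... | yes ty = y , ty , here (mkQ (walk-source wk) y∉ λ _ → refl)
        approach {y} y∉ (here _) t | no ¬ty = ⊥-elim (¬ty t)
        approach {y} y∉ (step d e wk) t | no ¬ty with approach (λ w∈ → ¬ty (lose w∈ e)) wk t
        ... | t′ , tt′ , wk′ = t′ , tt′ , step (mkQ d y∉ λ ty → ⊥-elim (¬ty ty)) e wk′
        attach : Tripod U k′
        attach with approach k′₂∉ (step (inj₂ refl) (kk′ i₂) (walk-map inj₁ walk₂₀)) (here (E-sym (kk′ i₀)))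
        ... | t , touch , wk = build (feet t R touch)
          where
          qt : Q t t
          qt = walk-target wk
          -- The only neighbour of `k′ i` in `U` is `k i`, which lies on `R`, while `t` does not. So
          -- the ends of `R` are no feet of `t`, and cutting `R` at the feet leaves each end in its
          -- own leg.
          no-end : ∀ i → k i ∈ R → i ≢ i₂ → ¬ E t (k′ i)
          no-end i k∈ ne e with Q.at qt
          ... | inj₁ u = Q.out qt (subst (_∈ R) (sym (only i u (E-sym e))) k∈)
          ... | inj₂ refl = proj₂ (k′-far (ne ∘ sym)) e
          head⇒ : ∀ xs {c l} → R ≡ xs ++ c ∷ l → E t c → ∃[ xs′ ] (xs ≡ k′ i₀ ∷ xs′)
          head⇒ [] eq e = ⊥-elim (no-end i₀ k₀∈ (λ ()) (subst (E t) (sym (∷-injectiveˡ eq)) e))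
          head⇒ (x ∷ xs) eq e = xs , cong (_∷ xs) (sym (∷-injectiveˡ eq))
          head⇒∷ʳ : ∀ xs {c l} → R ≡ (xs ∷ʳ c) ++ l → E t c → ∃[ xs′ ] (xs ∷ʳ c ≡ k′ i₀ ∷ xs′)
          head⇒∷ʳ [] eq e = ⊥-elim (no-end i₀ k₀∈ (λ ()) (subst (E t) (sym (∷-injectiveˡ eq)) e))
          head⇒∷ʳ (x ∷ xs) eq e = xs ∷ʳ _ , cong (_∷ xs ∷ʳ _) (sym (∷-injectiveˡ eq))
          end-of : ∀ xs {c l} → R ≡ xs ++ c ∷ l → EndsAt (k′ i₁) (c ∷ l)
          end-of xs eq = endsAt-++ xs (subst (EndsAt (k′ i₁)) eq en)
          ip-eq : ∀ {l} → R ≡ l → IP l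
          ip-eq eq = subst IP eq ip
          inR : ∀ {l} → R ≡ l → ∀ {v} → v ∈ l → v ∈ R
          inR eq = subst (_ ∈_) (sym eq)
          left-part : ∀ xs {c l} → R ≡ xs ++ c ∷ l → ∀ {v} → v ∈ xs → U v ⊎ v ≡ k′ i₀
          left-part xs eq v∈ with D∈ (inR eq (∈-++⁺ˡ v∈))
          ... | inj₁ u = inj₁ u
          ... | inj₂ (inj₁ e) = inj₂ e
          ... | inj₂ (inj₂ refl) = ⊥-elim (ip-disjoint xs (ip-eq eq) v∈ (endsAt-∈ (end-of xs eq)) refl)
          right-part : ∀ xs {l} → R ≡ xs ++ l → (∃[ xs′ ] (xs ≡ k′ i₀ ∷ xs′)) → ∀ {v} → v ∈ l → U v ⊎ v ≡ k′ i₁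
          right-part xs eq (_ , refl) v∈ with D∈ (inR eq (∈-++⁺ʳ xs v∈))
          ... | inj₁ u = inj₁ u
          ... | inj₂ (inj₁ refl) = ⊥-elim (ip-disjoint xs (ip-eq eq) (here refl) v∈ refl)
          ... | inj₂ (inj₂ e) = inj₂ e
          left-walk : ∀ xs {c l} → R ≡ xs ++ c ∷ l → (∃[ xs′ ] (xs ≡ k′ i₀ ∷ xs′)) → ∀ {v} → v ∈ xs → Walk G (_∈ xs) (k′ i₀) v
          left-walk xs eq (xs′ , refl) v∈ = ip-walk-from-start (ip-prefix {xs} (ip-eq eq) refl) (All.tabulate id) v∈
          right-walk : ∀ xs {c l} → R ≡ xs ++ c ∷ l → Walk G (_∈ c ∷ l) (k′ i₁) c
          right-walk xs eq = walk-reverse (ip-walk (ip-suffix xs (ip-eq eq)) (All.tabulate id) (end-of xs eq))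
          last-of : ∀ xs {c l} → R ≡ xs ++ c ∷ l → (∃[ xs′ ] (xs ≡ k′ i₀ ∷ xs′)) → ∃[ f ] (f ∈ xs × E f c)
          last-of .(k′ i₀ ∷ xs) {c} {l} eq (xs , refl) with lastOf (k′ i₀) xs
          ... | f , enf with endsAt-snoc enf
          ...   | l′ , eq′ = f , endsAt-∈ enf ,
                  ip-mid-edge l′ (subst IP (trans (cong (_++ c ∷ l) eq′) (++-assoc l′ (f ∷ []) (c ∷ l))) (ip-eq eq))
          not-foot : ∀ {xs v} → All (¬_ ∘ E t) xs → v ∈ xs → v ∈ R → ∀ {y} → Q t y → Far v y
          not-foot n v∈ v∈R q = (λ { refl → Q.out q v∈R }) , λ e →
            All.lookup n v∈ (subst (λ z → E z _) (Q.fresh q (lose v∈R (E-sym e))) (E-sym e))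
          third-leg : ∀ {y} → Q t y → U y ⊎ y ≡ k′ i₂
          third-leg = Q.at
          anti-sym : ∀ {A : Fin 3 → V → Set} {i j} → Anticomplete (A i) (A j) → Anticomplete (A j) (A i)
          anti-sym f u v = far-sym (f v u)
          build : Feet t R → Tripod U k′
          build (one pre g [] eq e nopre nosuf) with end-of pre eq
          ... | here = ⊥-elim (no-end i₁ k₁∈ (λ ()) e)
          build (one pre g (s ∷ suf) eq e nopre nosuf) = claw g g∈U (three (_∈ pre) (_∈ s ∷ suf) (Q t))
            (each (left-part pre eq) (right-part (pre ∷ʳ g) eq′ hd′) third-leg)
            (each leg₀ (s , E-sym (ip-mid-edge pre (ip-eq eq)) , right-walk (pre ∷ʳ g) eq′) (t , e , wk))
            (each (λ g∈ → ip-disjoint pre (ip-eq eq) g∈ (here refl) refl) (λ g∈ → ip-≢ (ip-suffix pre (ip-eq eq)) g∈ refl)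
              (λ q → Q.out q g∈R))
            (pairwise {λ i j → Anticomplete (three (_∈ pre) (_∈ s ∷ suf) (Q t) i) (three (_∈ pre) (_∈ s ∷ suf) (Q t) j)}
              (λ {i} {j} → anti-sym {three (_∈ pre) (_∈ s ∷ suf) (Q t)} {i} {j})
              (λ u∈ v∈ → ip-sep pre (ip-eq eq) u∈ v∈)
              (λ u∈ q → not-foot nopre u∈ (inR eq (∈-++⁺ˡ u∈)) q)
              (λ u∈ q → not-foot nosuf u∈ (inR eq (∈-++⁺ʳ pre (there u∈))) q))
            where
            eq′ : R ≡ (pre ∷ʳ g) ++ s ∷ suf
            eq′ = trans eq (sym (++-assoc pre _ _))
            hd = head⇒ pre eq e
            hd′ : ∃[ xs′ ] (pre ∷ʳ g ≡ k′ i₀ ∷ xs′)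
            hd′ with hd
            ... | xs′ , refl = xs′ ∷ʳ g , refl
            g∈R : g ∈ R
            g∈R = inR eq (∈-++⁺ʳ pre (here refl))
            g∈U : U g
            g∈U with D∈ g∈R
            ... | inj₁ u = u
            ... | inj₂ (inj₁ refl) = ⊥-elim (no-end i₀ k₀∈ (λ ()) e)
            ... | inj₂ (inj₂ refl) = ⊥-elim (no-end i₁ k₁∈ (λ ()) e)
            leg₀ : ∃[ y ] (E y g × Walk G (_∈ pre) (k′ i₀) y)
            leg₀ with last-of pre eq hd
            ... | f , f∈ , fg = f , fg , left-walk pre eq hd f∈
          build (wide pre g x mid g′ suf eq e e′ nopre nosuf) = claw t t∈U A
            (each (left-part (pre ∷ʳ g) eq) (right-part ((pre ∷ʳ g) ++ x ∷ mid) eq′ (grow hd)) (third-leg ∘ proj₁))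
            (each (g , E-sym e , left-walk (pre ∷ʳ g) eq hd (∈-++⁺ʳ pre (here refl))) (g′ , E-sym e′ , right-walk ((pre ∷ʳ g) ++ x ∷ mid) eq′) leg₂)
            (each (λ t∈ → Q.out qt (inR eq (∈-++⁺ˡ t∈))) (λ t∈ → Q.out qt (inR eq′ (∈-++⁺ʳ ((pre ∷ʳ g) ++ x ∷ mid) t∈))) (λ q → proj₂ q refl))
            (pairwise {λ i j → Anticomplete (A i) (A j)} (λ {i} {j} → anti-sym {A} {i} {j})
              (λ u∈ v∈ → ip-sep (pre ∷ʳ g) (ip-eq eq) u∈ (∈-++⁺ʳ mid v∈))
              (λ u∈ q → free (inR eq (∈-++⁺ˡ u∈)) q)
              (λ u∈ q → free (inR eq′ (∈-++⁺ʳ ((pre ∷ʳ g) ++ x ∷ mid) u∈)) q))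
            where
            A : Fin 3 → V → Set
            A = three (_∈ pre ∷ʳ g) (_∈ g′ ∷ suf) (λ v → Q t v × v ≢ t)
            eq′ : R ≡ ((pre ∷ʳ g) ++ x ∷ mid) ++ g′ ∷ suf
            eq′ = trans eq (sym (++-assoc (pre ∷ʳ g) _ _))
            hd : ∃[ xs′ ] (pre ∷ʳ g ≡ k′ i₀ ∷ xs′)
            hd = head⇒∷ʳ pre eq e
            grow : (∃[ xs′ ] (pre ∷ʳ g ≡ k′ i₀ ∷ xs′)) → ∃[ xs′ ] ((pre ∷ʳ g) ++ x ∷ mid ≡ k′ i₀ ∷ xs′)
            grow (xs′ , q) = xs′ ++ x ∷ mid , cong (_++ x ∷ mid) q
            free : ∀ {v y} → v ∈ R → Q t y × y ≢ t → Far v y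
            free v∈ (q , ne) = (λ { refl → Q.out q v∈ }) , λ e → ne (Q.fresh q (lose v∈ (E-sym e)))
            g≢g′ : g ≢ g′
            g≢g′ = ip-disjoint (pre ∷ʳ g) (ip-eq eq) (∈-++⁺ʳ pre (here refl)) (there (∈-++⁺ʳ mid (here refl)))
            -- The third of the `k′ i` sees at most one vertex of `R`, whereas `t` sees two.
            not-k′₂ : t ≢ k′ i₂
            not-k′₂ refl = g≢g′ (trans (nbr i₂ (inR eq (∈-++⁺ˡ (∈-++⁺ʳ pre (here refl)))) e)
              (sym (nbr i₂ (inR eq′ (∈-++⁺ʳ ((pre ∷ʳ g) ++ x ∷ mid) (here refl))) e′)))
            t∈U : U t
            t∈U with Q.at qt
            ... | inj₁ u = u
            ... | inj₂ e₂ = ⊥-elim (not-k′₂ e₂)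
            leg₂ : ∃[ y ] (E y t × Walk G (λ v → Q t v × v ≢ t) (k′ i₂) y)
            leg₂ with walk-leave (walk-reverse wk)
            ... | inj₁ e₂ = ⊥-elim (not-k′₂ e₂)
            ... | inj₂ (y , ty , wk′) = y , E-sym ty , walk-reverse wk′
          build (two pre g g′ suf eq e e′ nopre nosuf) = tri z A
            (each (left-part (pre ∷ʳ g) eq) (right-part (pre ∷ʳ g) eq hd) third-leg)
            (each (left-walk (pre ∷ʳ g) eq hd (∈-++⁺ʳ pre (here refl))) (right-walk (pre ∷ʳ g) eq) wk)
            (pairwise {λ i j → E (z i) (z j)} E-sym gg′ (E-sym e) (E-sym e′))
            (pairwise {λ i j → ∀ {u v} → A i u → A j v → u ≢ v × (E u v → u ≡ z i × v ≡ z j)} flip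
              (λ u∈ v∈ → ip-disjoint (pre ∷ʳ g) (ip-eq eq) u∈ v∈ , ip-cut pre (ip-eq (trans eq (++-assoc pre _ _))) u∈ v∈)
              (λ u∈ q → foot (inR eq (∈-++⁺ˡ u∈)) q (snoc-only nopre u∈))
              (λ u∈ q → foot (inR eq (∈-++⁺ʳ (pre ∷ʳ g) u∈)) q (cons-only nosuf u∈)))
            where
            z : Fin 3 → V
            z = three g g′ t
            A : Fin 3 → V → Set
            A = three (_∈ pre ∷ʳ g) (_∈ g′ ∷ suf) (Q t)
            gg′ : E g g′
            gg′ = ip-mid-edge pre (ip-eq (trans eq (++-assoc pre _ _)))
            hd : ∃[ xs′ ] (pre ∷ʳ g ≡ k′ i₀ ∷ xs′)
            hd = head⇒∷ʳ pre eq e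
            flip : ∀ {i j} → (∀ {u v} → A i u → A j v → u ≢ v × (E u v → u ≡ z i × v ≡ z j)) →
              ∀ {u v} → A j u → A i v → u ≢ v × (E u v → u ≡ z j × v ≡ z i)
            flip f u v = (λ q → proj₁ (f v u) (sym q)) , λ q → let r = proj₂ (f v u) (E-sym q) in proj₂ r , proj₁ r
            foot : ∀ {v y w} → v ∈ R → Q t y → (E t v → v ≡ w) → v ≢ y × (E v y → v ≡ w × y ≡ t)
            foot v∈ q f = (λ { refl → Q.out q v∈ }) , λ e₁ → let y≡t = Q.fresh q (lose v∈ (E-sym e₁)) in
              f (subst (λ z → E z _) y≡t (E-sym e₁)) , y≡t

-- Two tripods joined by three columns

module Struts {n : ℕ} (G : Graph n) (signing : OddSignable G) where

  open Paths G
  open Holes G signing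
  open PyramidSeparation G signing
  open Tripods G signing

  With : (V → Set) → (Fin 3 → V) → V → Set
  With U k′ v = U v ⊎ ∃[ i ] v ≡ k′ i

  -- Three long columns between an upper part U and a lower part L.
  record Frame (β : V → Set) (ℓ : ℕ) (U : V → Set) (k′ : Fin 3 → V) (L : V → Set) (l′ : Fin 3 → V) (mid : Fin 3 → V → Set) : Set where
    field
      column : ∀ i → Walk G (λ v → v ≡ k′ i ⊎ mid i v ⊎ v ≡ l′ i) (k′ i) (l′ i)
      upper-lower : Anticomplete (With U k′) (With L l′)
      U-mid : ∀ {i} → Anticomplete U (mid i)
      L-mid : ∀ {i} → Anticomplete L (mid i)
      k′-mid : ∀ {i j} → i ≢ j → ∀ {v} → mid j v → Far (k′ i) v
      l′-mid : ∀ {i j} → i ≢ j → ∀ {v} → mid j v → Far (l′ i) v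
      mid-mid : ∀ {i j} → i ≢ j → Anticomplete (mid i) (mid j)
      upper-in : ∀ {v} → With U k′ v → β v
      lower-in : ∀ {v} → With L l′ v → β v
      mid-in : ∀ {i v} → mid i v → β v
      -- The apex of the pyramid may arise in the upper or in the lower part, hence a length bound
      -- in either direction.
      down-long : ∀ {x y l} → With U k′ x → With L l′ y → IP (x ∷ l) → All β (x ∷ l) → EndsAt y (x ∷ l) → ℓ ≤ length l
      up-long : ∀ {x y l} → With L l′ x → With U k′ y → IP (x ∷ l) → All β (x ∷ l) → EndsAt y (x ∷ l) → ℓ ≤ length l

  frame-swap : ∀ {β ℓ U k′ L l′ mid} → Frame β ℓ U k′ L l′ mid → Frame β ℓ L l′ U k′ mid
  frame-swap F = record
    { column = λ i → walk-reverse (walk-map (λ { (inj₁ e) → inj₂ (inj₂ e) ; (inj₂ (inj₁ m)) → inj₂ (inj₁ m) ; (inj₂ (inj₂ e)) → inj₁ e }) (column i))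
    ; upper-lower = λ u v → far-sym (upper-lower v u) ; U-mid = L-mid ; L-mid = U-mid ; k′-mid = l′-mid ; l′-mid = k′-mid ; mid-mid = mid-mid
    ; upper-in = lower-in ; lower-in = upper-in ; mid-in = mid-in ; down-long = up-long ; up-long = down-long }
    where open Frame F

  module _ {β : V → Set} {ℓ : ℕ} {U : V → Set} {k′ : Fin 3 → V} {L : V → Set} {l′ : Fin 3 → V} {mid : Fin 3 → V → Set}
    (F : Frame β ℓ U k′ L l′ mid) where

    open Frame F

    private
      Upper Lower : V → Set
      Upper = With U k′
      Lower = With L l′

    Leg : (A A′ : Fin 3 → V → Set) → Fin 3 → V → Set
    Leg A A′ i v = A i v ⊎ mid i v ⊎ A′ i v

    module _ {A A′ : Fin 3 → V → Set} (A⊂ : ∀ i {v} → A i v → U v ⊎ v ≡ k′ i) (A′⊂ : ∀ i {v} → A′ i v → L v ⊎ v ≡ l′ i) where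

      up : ∀ {i v} → A i v → Upper v
      up {i} a with A⊂ i a
      ... | inj₁ u = inj₁ u
      ... | inj₂ e = inj₂ (i , e)

      low : ∀ {i v} → A′ i v → Lower v
      low {i} a with A′⊂ i a
      ... | inj₁ u = inj₁ u
      ... | inj₂ e = inj₂ (i , e)

      leg-in : ∀ {i v} → Leg A A′ i v → β v
      leg-in (inj₁ a) = upper-in (up a)
      leg-in (inj₂ (inj₁ m)) = mid-in m
      leg-in (inj₂ (inj₂ a)) = lower-in (low a)

      leg-walk : ∀ i → A i (k′ i) → A′ i (l′ i) → Walk G (Leg A A′ i) (k′ i) (l′ i)
      leg-walk i a a′ = walk-map (λ { (inj₁ refl) → inj₁ a ; (inj₂ (inj₁ m)) → inj₂ (inj₁ m) ; (inj₂ (inj₂ refl)) → inj₂ (inj₂ a′) }) (column i)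

      A-mid : ∀ {i j} → i ≢ j → ∀ {u v} → A i u → mid j v → Far u v
      A-mid {i} ne a m with A⊂ i a
      ... | inj₁ u = U-mid u m
      ... | inj₂ refl = k′-mid ne m

      A′-mid : ∀ {i j} → i ≢ j → ∀ {u v} → A′ i u → mid j v → Far u v
      A′-mid {i} ne a m with A′⊂ i a
      ... | inj₁ u = L-mid u m
      ... | inj₂ refl = l′-mid ne m

      -- Two legs can only be adjacent inside the upper part, as described by `P`, or inside the
      -- lower part, as described by `P′`; the columns contribute no edge.
      leg-cross : ∀ {P P′ : V → V → Set} {i j} → i ≢ j → (∀ {u v} → A i u → A j v → u ≢ v × (E u v → P u v)) →
        (∀ {u v} → A′ i u → A′ j v → u ≢ v × (E u v → P′ u v)) →
        ∀ {u v} → Leg A A′ i u → Leg A A′ j v → u ≢ v × (E u v → P u v ⊎ P′ u v)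
      leg-cross {P} {P′} {i} {j} ne f g = go
        where
        apart : ∀ {u v} → Far u v → u ≢ v × (E u v → P u v ⊎ P′ u v)
        apart (a , b) = a , λ e → ⊥-elim (b e)
        go : ∀ {u v} → Leg A A′ i u → Leg A A′ j v → u ≢ v × (E u v → P u v ⊎ P′ u v)
        go (inj₁ a) (inj₁ a′) = let r = f a a′ in proj₁ r , inj₁ ∘ proj₂ r
        go (inj₁ a) (inj₂ (inj₁ m)) = apart (A-mid ne a m)
        go (inj₁ a) (inj₂ (inj₂ b)) = apart (upper-lower (up a) (low b))
        go (inj₂ (inj₁ m)) (inj₁ a) = apart (far-sym (A-mid (ne ∘ sym) a m))
        go (inj₂ (inj₁ m)) (inj₂ (inj₁ m′)) = apart (mid-mid ne m m′)
        go (inj₂ (inj₁ m)) (inj₂ (inj₂ b)) = apart (far-sym (A′-mid (ne ∘ sym) b m))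
        go (inj₂ (inj₂ b)) (inj₁ a) = apart (far-sym (upper-lower (up a) (low b)))
        go (inj₂ (inj₂ b)) (inj₂ (inj₁ m)) = apart (A′-mid ne b m)
        go (inj₂ (inj₂ b)) (inj₂ (inj₂ b′)) = let r = g b b′ in proj₁ r , inj₂ ∘ proj₂ r

      ∉leg-upper : ∀ {i z} → U z → ¬ A i z → ¬ Leg A A′ i z
      ∉leg-upper u ¬a (inj₁ a) = ¬a a
      ∉leg-upper u ¬a (inj₂ (inj₁ m)) = proj₁ (U-mid u m) refl
      ∉leg-upper u ¬a (inj₂ (inj₂ a)) = proj₁ (upper-lower (inj₁ u) (low a)) refl

      ∉leg-lower : ∀ {i z} → L z → ¬ A′ i z → ¬ Leg A A′ i z
      ∉leg-lower u ¬a (inj₁ a) = proj₁ (upper-lower (up a) (inj₁ u)) refl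
      ∉leg-lower u ¬a (inj₂ (inj₁ m)) = proj₁ (L-mid u m) refl
      ∉leg-lower u ¬a (inj₂ (inj₂ a)) = ¬a a

    claw-claw : ∀ {z z′} {A A′ : Fin 3 → V → Set} → U z → L z′ →
      (∀ i {v} → A i v → U v ⊎ v ≡ k′ i) → (∀ i {v} → A′ i v → L v ⊎ v ≡ l′ i) →
      (∀ i → ∃[ y ] (E y z × Walk G (A i) (k′ i) y)) → (∀ i → ∃[ y ] (E y z′ × Walk G (A′ i) (l′ i) y)) →
      (∀ i → ¬ A i z) → (∀ i → ¬ A′ i z′) →
      (∀ {i j} → i ≢ j → Anticomplete (A i) (A j)) → (∀ {i j} → i ≢ j → Anticomplete (A′ i) (A′ j)) → ⊥
    claw-claw {z} {z′} {A} {A′} uz lz A⊂ A′⊂ legs legs′ ¬a ¬a′ anti anti′ =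
      no-theta {A = D 0F} {D 1F} {D 2F} (upper-lower (inj₁ uz) (inj₁ lz))
        (∉z _) (∉z′ _) (∉z _) (∉z′ _) (∉z _) (∉z′ _)
        (apart λ ()) (apart λ ()) (apart λ ()) (thread _) (thread _) (thread _)
      where
      D = Leg A A′
      ∉z : ∀ i → ¬ D i z
      ∉z i = ∉leg-upper A⊂ A′⊂ uz (¬a i)
      ∉z′ : ∀ i → ¬ D i z′
      ∉z′ i = ∉leg-lower A⊂ A′⊂ lz (¬a′ i)
      apart : ∀ {i j} → i ≢ j → Anticomplete (D i) (D j)
      apart ne a b with leg-cross A⊂ A′⊂ {λ _ _ → ⊥} {λ _ _ → ⊥} ne (anti ne) (anti′ ne) a b
      ... | p , q = p , λ e → [ id , id ]′ (q e)
      thread : ∀ i → Link (D i) z z′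
      thread i with legs i | legs′ i
      ... | y , yz , wk | y′ , yz′ , wk′ = link (E-sym yz)
        (walk-++ (walk-reverse (walk-map inj₁ wk)) (walk-++ (leg-walk A⊂ A′⊂ i (walk-source wk) (walk-source wk′)) (walk-map (inj₂ ∘ inj₂) wk′))) yz′

    tri-tri : ∀ {z z′ : Fin 3 → V} {A A′ : Fin 3 → V → Set} →
      (∀ i {v} → A i v → U v ⊎ v ≡ k′ i) → (∀ i {v} → A′ i v → L v ⊎ v ≡ l′ i) →
      (∀ i → Walk G (A i) (k′ i) (z i)) → (∀ i → Walk G (A′ i) (l′ i) (z′ i)) →
      (∀ {i j} → i ≢ j → E (z i) (z j)) → (∀ {i j} → i ≢ j → E (z′ i) (z′ j)) →
      (∀ {i j} → i ≢ j → ∀ {u v} → A i u → A j v → u ≢ v × (E u v → u ≡ z i × v ≡ z j)) →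
      (∀ {i j} → i ≢ j → ∀ {u v} → A′ i u → A′ j v → u ≢ v × (E u v → u ≡ z′ i × v ≡ z′ j)) → ⊥
    tri-tri {z} {z′} {A} {A′} A⊂ A′⊂ legs legs′ t t′ cr cr′ =
      no-prism {A = D 0F} {D 1F} {D 2F} (apart _) (apart _)
        (t λ ()) (t λ ()) (t λ ()) (t′ λ ()) (t′ λ ()) (t′ λ ()) (X λ ()) (X λ ()) (X λ ()) (thread _) (thread _) (thread _)
      where
      D = Leg A A′
      apart : ∀ i → Far (z i) (z′ i)
      apart i = upper-lower (up A⊂ A′⊂ (walk-target (legs i))) (low A⊂ A′⊂ (walk-target (legs′ i)))
      X : ∀ {i j} → i ≢ j → Crossing (D i) (z i) (z′ i) (D j) (z j) (z′ j)
      X ne = leg-cross A⊂ A′⊂ ne (cr ne) (cr′ ne)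
      thread : ∀ i → Walk G (D i) (z i) (z′ i)
      thread i = walk-++ (walk-reverse (walk-map inj₁ (legs i)))
        (walk-++ (leg-walk A⊂ A′⊂ i (walk-source (legs i)) (walk-source (legs′ i))) (walk-map (inj₂ ∘ inj₂) (legs′ i)))

    claw-tri : ∀ {z} {z′ : Fin 3 → V} {A A′ : Fin 3 → V → Set} → U z →
      (∀ i {v} → A i v → U v ⊎ v ≡ k′ i) → (∀ i {v} → A′ i v → L v ⊎ v ≡ l′ i) →
      (∀ i → ∃[ y ] (E y z × Walk G (A i) (k′ i) y)) → (∀ i → Walk G (A′ i) (l′ i) (z′ i)) →
      (∀ i → ¬ A i z) → (∀ {i j} → i ≢ j → E (z′ i) (z′ j)) →
      (∀ {i j} → i ≢ j → Anticomplete (A i) (A j)) →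
      (∀ {i j} → i ≢ j → ∀ {u v} → A′ i u → A′ j v → u ≢ v × (E u v → u ≡ z′ i × v ≡ z′ j)) → Pyramid β ℓ
    claw-tri {z} {z′} {A} {A′} uz A⊂ A′⊂ legs legs′ ¬a t′ anti cr′ = record
      { a = z ; b = z′ ; p = λ i → Path.list (path i) ; induced = λ i → Path.isIP (path i) ; ends = λ i → Path.ends (path i)
      ; triangle = t′
      ; cross = λ {i} {j} ne u∈ v∈ → let c = leg-cross A⊂ A′⊂ {λ _ _ → ⊥} ne (anti ne) (cr′ ne) (All.lookup (Path.inside (path i)) u∈) (All.lookup (Path.inside (path j)) v∈) in
          proj₁ c , λ e → [ ⊥-elim , id ]′ (proj₂ c e)
      ; long = λ i → down-long (inj₁ uz) (low A⊂ A′⊂ (walk-target (legs′ i))) (Path.isIP (path i)) (zβ ∷ inβ i) (there (Path.ends (path i)))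
      ; apexIn = zβ ; pathIn = inβ }
      where
      D = Leg A A′
      zβ : β z
      zβ = upper-in (inj₁ uz)
      record Path (i : Fin 3) : Set where
        field
          list : List V
          isIP : IP (z ∷ list)
          ends : EndsAt (z′ i) list
          inside : All (D i) list
      path : ∀ i → Path i
      path i with legs i
      ... | y , yz , wk = fromIPath (walk⇒ipath (step (inj₁ refl) (E-sym yz) (walk-map inj₂ down)))
        where
        down : Walk G (D i) y (z′ i)
        down = walk-++ (walk-reverse (walk-map inj₁ wk))
          (walk-++ (leg-walk A⊂ A′⊂ i (walk-source wk) (walk-source (legs′ i))) (walk-map (inj₂ ∘ inj₂) (legs′ i)))
        ∉z : ¬ D i z
        ∉z = ∉leg-upper A⊂ A′⊂ uz (¬a i)
        fromIPath : IPath (λ v → v ≡ z ⊎ D i v) z (z′ i) → Path i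
        fromIPath (ipath l ip ds en) = record
          { list = l ; isIP = ip ; ends = tailEnd l en
          ; inside = All.tabulate λ v∈ → [ (λ { refl → ⊥-elim (ip-≢ ip v∈ refl) }) , id ]′ (All.lookup ds (there v∈)) }
          where
          tailEnd : ∀ l → EndsAt (z′ i) (z ∷ l) → EndsAt (z′ i) l
          tailEnd [] en with endsAt-∈ en
          ... | here e = ⊥-elim (∉z (subst (D i) e (inj₂ (inj₂ (walk-target (legs′ i))))))
          tailEnd (x ∷ l) (there en) = en
      inβ : ∀ i → All β (Path.list (path i))
      inβ i = All.map (leg-in A⊂ A′⊂) (Path.inside (path i))

  -- Two claws would make a theta and two triangles a prism; a claw facing a triangle is a pyramid
  -- with its apex at the centre of the claw.
  strut : ∀ {β ℓ U k′ L l′ mid} → Frame β ℓ U k′ L l′ mid → Tripod U k′ → Tripod L l′ → Pyramid β ℓ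
  strut F (claw z uz A A⊂ legs ¬a anti) (claw z′ lz A′ A′⊂ legs′ ¬a′ anti′) =
    ⊥-elim (claw-claw F uz lz A⊂ A′⊂ legs legs′ ¬a ¬a′ anti anti′)
  strut F (tri z A A⊂ legs t cr) (tri z′ A′ A′⊂ legs′ t′ cr′) = ⊥-elim (tri-tri F A⊂ A′⊂ legs legs′ t t′ cr cr′)
  strut F (claw z uz A A⊂ legs ¬a anti) (tri z′ A′ A′⊂ legs′ t′ cr′) = claw-tri F uz A⊂ A′⊂ legs legs′ ¬a t′ anti cr′
  strut F (tri z A A⊂ legs t cr) (claw z′ lz A′ A′⊂ legs′ ¬a′ anti′) = claw-tri (frame-swap F) lz A′⊂ A⊂ legs′ legs ¬a′ t anti′ cr

-- 6 + `ℓ` is the depth `4 + h` to which ancestors are followed. Vertices at greater distance than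
-- this radius have no equal or adjacent ancestors within that depth.
reachRadius : ℕ → ℕ
reachRadius ℓ = (6 + ℓ) + suc (6 + ℓ)

clusterSize : ℕ → ℕ → ℕ
clusterSize δ ℓ = ballBound δ (reachRadius ℓ) + ballBound δ (reachRadius ℓ)

-- Three distant vertices of a layer yield a long pyramid

module Layering {n : ℕ} (G : Graph n) (signing : OddSignable G) {δ : ℕ} (deg : MaxDegree≤ G δ) (ℓ : ℕ) where

  open Paths G
  open Holes G signing using (Anticomplete)
  open PyramidSeparation G signing
  open Tripods G signing
  open Struts G signing
  open Decompositions G
  open Metric G
  open Bounded G deg

  -- The columns run from distance 2 to distance 2 + h below a layer.
  h : ℕ
  h = 2 + ℓ

  reachBound clusterBound : ℕ
  reachBound = reachRadius ℓ
  clusterBound = clusterSize δ ℓ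

  cancel : ∀ a k m b → a + (k + m) ≤ b + k → a + m ≤ b
  cancel a k m b le = ℕP.+-cancelʳ-≤ k (a + m) b (subst (_≤ b + k) (arith a k m) le)
    where
    arith : ∀ a k m → a + (k + m) ≡ a + m + k
    arith = solve-∀

  -- The properties of the distance from `root` that the layer argument uses.
  record Levels (C : V → Set) : Set where
    field
      C? : Decidable C
      root : V
      rootIn : C root
      lev : V → ℕ
      root-lev : lev root ≡ 0
      lev-root : ∀ {x} → C x → lev x ≡ 0 → x ≡ root
      down : ∀ {x d} → C x → lev x ≡ suc d → ∃[ y ] (C y × E x y × lev y ≡ d)
      lipschitz : ∀ {x y} → C x → C y → E x y → lev x ≤ suc (lev y)

  module WithLevels {C : V → Set} (levels : Levels C) where

    open Levels levels

    -- Outside `C` and at level 0 the value defaults to `x`, so that ancestors are defined for every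
    -- vertex.
    parentOf : ∀ {x} → Dec (C x) → ∀ l → lev x ≡ l → V
    parentOf (yes c) (suc d) e = proj₁ (down c e)
    parentOf {x} _ _ _ = x

    parent : V → V
    parent x = parentOf (C? x) (lev x) refl

    parent-spec : ∀ {x d} → C x → lev x ≡ suc d → C (parent x) × E x (parent x) × lev (parent x) ≡ d
    parent-spec {x} {d} c e = go (C? x) (lev x) refl e
      where
      go : ∀ (dec : Dec (C x)) l (e : lev x ≡ l) → l ≡ suc d → C (parentOf dec l e) × E x (parentOf dec l e) × lev (parentOf dec l e) ≡ d
      go (yes c′) (suc .d) e refl = proj₂ (down c′ e)
      go (no ¬c) l e _ = ⊥-elim (¬c c)

    anc : ℕ → V → V
    anc zero x = x
    anc (suc p) x = parent (anc p x)

    anc-spec : ∀ p {x} → C x → p ≤ lev x → C (anc p x) × lev (anc p x) + p ≡ lev x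
    anc-next : ∀ p {x} → C x → suc p ≤ lev x → C (anc (suc p) x) × E (anc p x) (anc (suc p) x) × suc (lev (anc (suc p) x)) ≡ lev (anc p x)
    anc-next p {x} c le with anc-spec p c (ℕP.≤-trans (ℕP.n≤1+n p) le)
    ... | cp , eq with positive _ eq le
      where
      positive : ∀ l {q} → l + p ≡ q → suc p ≤ q → ∃[ d ] l ≡ suc d
      positive zero eq le = ⊥-elim (ℕP.<⇒≢ le eq)
      positive (suc d) _ _ = d , refl
    ...   | d , eq′ with parent-spec cp eq′
    ...     | c′ , e , l = c′ , e , trans (cong suc l) (sym eq′)
    anc-spec zero c le = c , ℕP.+-identityʳ _
    anc-spec (suc p) {x} c le with anc-next p c le | anc-spec p c (ℕP.≤-trans (ℕP.n≤1+n p) le)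
    ... | c′ , e , l | _ , eq = c′ , trans (ℕP.+-suc _ p) (trans (cong (_+ p) l) eq)

    anc-reach : ∀ p {x} → C x → p ≤ lev x → Reach Anywhere p x (anc p x)
    anc-reach zero c le = stop tt
    anc-reach (suc p) c le = reach-snoc (anc-reach p c (ℕP.≤-trans (ℕP.n≤1+n p) le)) (proj₁ (proj₂ (anc-next p c le))) tt

    far-by-level : ∀ {u v} → C u → C v → lev v + 2 ≤ lev u → Far u v
    far-by-level {u} {v} cu cv le = (λ { refl → ℕP.<⇒≱ (ℕP.m<m+n (lev u) (s≤s z≤n)) le }) ,
      λ e → ℕP.<⇒≱ (subst (_≤ lev u) (ℕP.+-comm (lev v) 2) le) (lipschitz cu cv e)

    toRoot : ∀ l {x} → C x → lev x ≡ l → Walk G (λ v → C v × lev v ≤ l) x root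
    toRoot zero c e = subst (Walk G _ _) (lev-root c e) (here (c , ℕP.≤-reflexive e))
    toRoot (suc l) c e with down c e
    ... | y , cy , xy , ey = step (c , ℕP.≤-reflexive e) xy (walk-map (λ { (c , le) → c , ℕP.m≤n⇒m≤1+n le }) (toRoot l cy ey))

    path-level : ∀ {x l y} → IP (x ∷ l) → All C (x ∷ l) → EndsAt y (x ∷ l) → lev x ≤ length l + lev y × lev y ≤ length l + lev x
    path-level [-] _ here = ℕP.≤-refl , ℕP.≤-refl
    path-level [-] _ (there ())
    path-level {x} {y ∷ r} (cons e f p) (c ∷ c′ ∷ cs) (there en) with path-level p (c′ ∷ cs) en
    ... | le , le′ = ℕP.≤-trans (lipschitz c c′ e) (s≤s le) ,
      ℕP.≤-trans le′ (subst (length r + lev y ≤_) (ℕP.+-suc (length r) (lev x)) (ℕP.+-monoʳ-≤ (length r) (lipschitz c′ c (E-sym e))))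

    module FarCluster {i₀ : ℕ} {U : V → Set} (U⊂ : ∀ {v} → U v → C v × i₀ ≤ lev v) (x : Fin 3 → V) (xU : ∀ i → U (x i)) (xlev : ∀ i → lev (x i) ≡ i₀)
      (walk₀₁ : Walk G U (x 0F) (x 1F)) (walk₂₀ : Walk G U (x 2F) (x 0F))
      (apart : ∀ {i j} → i ≢ j → ¬ Reach Anywhere reachBound (x i) (x j)) where

      xC : ∀ i → C (x i)
      xC i = proj₁ (U⊂ (xU i))

      -- In a layer close to the root two of the vertices would be within `reachBound` of each other
      -- by way of the root.
      deep : 4 + h ≤ i₀
      deep with (4 + h) ℕP.≤? i₀
      ... | yes le = le
      ... | no nle = ⊥-elim (apart {0F} {1F} (λ ()) (reach-≤ bound (reach-++ (to-root 0F) (reach-sym (to-root 1F)))))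
        where
        to-root : ∀ i → Reach Anywhere i₀ (x i) root
        to-root i with anc-spec i₀ (xC i) (ℕP.≤-reflexive (sym (xlev i)))
        ... | c , eq = subst (Reach Anywhere i₀ (x i)) (lev-root c (ℕP.+-cancelʳ-≡ i₀ _ 0 (trans eq (xlev i)))) (anc-reach i₀ (xC i) (ℕP.≤-reflexive (sym (xlev i))))
        bound : i₀ + i₀ ≤ reachBound
        bound = let le = ℕP.≤-trans (ℕP.n≤1+n i₀) (ℕP.≰⇒> nle) in ℕP.+-mono-≤ le (ℕP.m≤n⇒m≤1+n le)

      c : Fin 3 → ℕ → V
      c i p = anc p (x i)

      within : ∀ i {p} → p ≤ 4 + h → p ≤ lev (x i)
      within i le = ℕP.≤-trans le (subst (4 + h ≤_) (sym (xlev i)) deep)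

      cC : ∀ i {p} → p ≤ 4 + h → C (c i p)
      cC i le = proj₁ (anc-spec _ (xC i) (within i le))

      clev : ∀ i {p} → p ≤ 4 + h → lev (c i p) + p ≡ i₀
      clev i le = trans (proj₂ (anc-spec _ (xC i) (within i le))) (xlev i)

      cedge : ∀ i {p} → suc p ≤ 4 + h → E (c i p) (c i (suc p))
      cedge i le = proj₁ (proj₂ (anc-next _ (xC i) (within i le)))

      cfar : ∀ {i j} → i ≢ j → ∀ {p q} → p ≤ 4 + h → q ≤ 4 + h → Far (c i p) (c j q)
      cfar {i} {j} ne {p} {q} lp lq = (λ e → apart ne (reach-≤ (ℕP.+-mono-≤ lp (ℕP.m≤n⇒m≤1+n lq)) (reach-++ rp (subst (λ v → Reach Anywhere q v (x j)) (sym e) rq)))) ,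
        λ e → apart ne (reach-≤ (ℕP.+-mono-≤ lp (s≤s lq)) (reach-++ rp (hop tt e rq)))
        where
        rp = anc-reach p (xC i) (within i lp)
        rq = reach-sym (anc-reach q (xC j) (within j lq))

      -- An ancestor at depth 1 may have several neighbours in `U`, but the one at depth 2 has a
      -- single neighbour in `U⁺`; this is the attachment that `tripod` asks for. `L` is arranged
      -- likewise at the other end.
      U⁺ L : V → Set
      U⁺ v = U v ⊎ ∃[ j ] v ≡ c j 1
      L v = (C v × lev v + (4 + h) ≤ i₀) ⊎ ∃[ j ] v ≡ c j (3 + h)

      k k′ l l′ : Fin 3 → V
      k i = c i 1
      k′ i = c i 2
      l i = c i (3 + h)
      l′ i = c i (2 + h)

      mid : Fin 3 → V → Set
      mid j v = ∃[ p ] (3 ≤ p × p ≤ 1 + h × v ≡ c j p)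

      ≤1 : 1 ≤ 4 + h
      ≤1 = s≤s z≤n
      ≤2 : 2 ≤ 4 + h
      ≤2 = s≤s (s≤s z≤n)
      ≤3+ : 3 + h ≤ 4 + h
      ≤3+ = ℕP.n≤1+n _
      ≤2+ : 2 + h ≤ 4 + h
      ≤2+ = ℕP.m≤n+m (2 + h) 2
      ≤mid : ∀ {p} → p ≤ 1 + h → p ≤ 4 + h
      ≤mid le = ℕP.≤-trans le (ℕP.m≤n+m (1 + h) 3)

      U⁺-lev : ∀ {v} → U⁺ v → C v × i₀ ≤ lev v + 1
      U⁺-lev (inj₁ u) = proj₁ (U⊂ u) , ℕP.≤-trans (proj₂ (U⊂ u)) (ℕP.m≤m+n _ 1)
      U⁺-lev (inj₂ (j , refl)) = cC j ≤1 , ℕP.≤-reflexive (sym (clev j ≤1))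

      upper-lev : ∀ {v} → With U⁺ k′ v → C v × i₀ ≤ lev v + 2
      upper-lev (inj₁ u) = proj₁ (U⁺-lev u) , ℕP.≤-trans (proj₂ (U⁺-lev u)) (ℕP.+-monoʳ-≤ _ (s≤s z≤n))
      upper-lev (inj₂ (i , refl)) = cC i ≤2 , ℕP.≤-reflexive (sym (clev i ≤2))

      L-lev : ∀ {v} → L v → C v × lev v + (3 + h) ≤ i₀
      L-lev (inj₁ (c , le)) = c , ℕP.≤-trans (ℕP.+-monoʳ-≤ _ (ℕP.n≤1+n _)) le
      L-lev (inj₂ (j , refl)) = cC j ≤3+ , ℕP.≤-reflexive (clev j ≤3+)

      lower-lev : ∀ {v} → With L l′ v → C v × lev v + (2 + h) ≤ i₀
      lower-lev (inj₁ u) = proj₁ (L-lev u) , ℕP.≤-trans (ℕP.+-monoʳ-≤ _ (ℕP.n≤1+n _)) (proj₂ (L-lev u))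
      lower-lev (inj₂ (i , refl)) = cC i ≤2+ , ℕP.≤-reflexive (clev i ≤2+)

      gap : ∀ {u v} → With U⁺ k′ u → With L l′ v → lev v + h ≤ lev u
      gap {u} {v} hu lv = cancel (lev v) 2 h (lev u) (ℕP.≤-trans (proj₂ (lower-lev lv)) (proj₂ (upper-lev hu)))

      walk-column : ∀ i {Q : V → Set} q p → p + q ≤ 4 + h → (∀ r → p ≤ r → r ≤ p + q → Q (c i r)) → Walk G Q (c i p) (c i (p + q))
      walk-column i {Q} zero p le f = subst (λ r → Walk G Q (c i p) (c i r)) (sym (ℕP.+-identityʳ p)) (here (f p ℕP.≤-refl (ℕP.m≤m+n p 0)))
      walk-column i {Q} (suc q) p le f = subst (λ r → Walk G Q (c i p) (c i r)) (sym (ℕP.+-suc p q))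
        (step (f p ℕP.≤-refl (ℕP.m≤m+n p _)) (cedge i (ℕP.≤-trans (ℕP.m≤m+n (suc p) q) le′))
          (walk-column i q (suc p) le′ λ r lo hi → f r (ℕP.≤-trans (ℕP.n≤1+n p) lo) (subst (r ≤_) (sym (ℕP.+-suc p q)) hi)))
        where
        le′ : suc p + q ≤ 4 + h
        le′ = subst (_≤ 4 + h) (ℕP.+-suc p q) le

      frame : Frame C ℓ U⁺ k′ L l′ mid
      frame = record
        { column = λ i → walk-column i h 2 ≤2+ (colour i)
        ; upper-lower = λ u v → far-by-level (proj₁ (upper-lev u)) (proj₁ (lower-lev v))
            -- The summand 2 of `h`: whatever `ℓ` is, the two parts are at least two levels apart
            -- and hence far.
            (ℕP.≤-trans (ℕP.+-monoʳ-≤ _ (s≤s (s≤s z≤n))) (gap u v))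
        ; U-mid = λ { {u = u} uU (p , lo , hi , refl) → far-by-level (proj₁ (U⁺-lev uU)) (cC _ (≤mid hi))
            (cancel _ 1 2 (lev u) (ℕP.≤-trans (ℕP.+-monoʳ-≤ _ lo) (ℕP.≤-trans (ℕP.≤-reflexive (clev _ (≤mid hi))) (proj₂ (U⁺-lev uU))))) }
        ; L-mid = λ { {i = i} {u = u} uL (p , lo , hi , refl) → far-sym (far-by-level (cC _ (≤mid hi)) (proj₁ (L-lev uL))
            (cancel (lev u) (1 + h) 2 _ (ℕP.≤-trans (subst (λ q → lev u + q ≤ i₀) (arith h) (proj₂ (L-lev uL)))
              (ℕP.≤-trans (ℕP.≤-reflexive (sym (clev i (≤mid hi)))) (ℕP.+-monoʳ-≤ _ hi))))) }
        ; k′-mid = λ { ne (p , lo , hi , refl) → cfar ne ≤2 (≤mid hi) }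
        ; l′-mid = λ { ne (p , lo , hi , refl) → cfar ne ≤2+ (≤mid hi) }
        ; mid-mid = λ { ne (p , lo , hi , refl) (p′ , lo′ , hi′ , refl) → cfar ne (≤mid hi) (≤mid hi′) }
        ; upper-in = proj₁ ∘ upper-lev ; lower-in = proj₁ ∘ lower-lev
        ; mid-in = λ { (p , lo , hi , refl) → cC _ (≤mid hi) }
        ; down-long = λ {x} {y} {l} u v ip cs en → long (length l) (lev y) (lev x) (gap u v) (proj₁ (path-level ip cs en))
        ; up-long = λ {x} {y} {l} v u ip cs en → long (length l) (lev x) (lev y) (gap u v) (proj₂ (path-level ip cs en)) }
        where
        arith : ∀ h → 3 + h ≡ (1 + h) + 2
        arith = solve-∀
        long : ∀ len a b → a + h ≤ b → b ≤ len + a → ℓ ≤ len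
        long len a b le le′ = ℕP.≤-trans (ℕP.m≤n+m ℓ 2) (ℕP.+-cancelʳ-≤ a h len (subst (_≤ len + a) (ℕP.+-comm a h) (ℕP.≤-trans le le′)))
        colour : ∀ i r → 2 ≤ r → r ≤ 2 + h → c i r ≡ k′ i ⊎ mid i (c i r) ⊎ c i r ≡ l′ i
        colour i r lo hi with ℕP.m≤n⇒m<n∨m≡n lo | ℕP.m≤n⇒m<n∨m≡n hi
        ... | inj₂ refl | _ = inj₁ refl
        ... | inj₁ _ | inj₂ refl = inj₂ (inj₂ refl)
        ... | inj₁ lo′ | inj₁ (s≤s hi′) = inj₂ (inj₁ (r , lo′ , hi′ , refl))

      upper-tripod : Tripod U⁺ k′
      upper-tripod = tripod k k′ out (λ i → E-sym (cedge i ≤2)) only (λ ne → cfar ne ≤2 ≤2)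
        (via 0F 1F walk₀₁) (via 2F 0F walk₂₀)
        where
        out : ∀ i → ¬ U⁺ (k′ i)
        out i u = ℕP.<⇒≱ (ℕP.+-monoʳ-< (lev (k′ i)) (s≤s (s≤s z≤n))) (subst (_≤ lev (k′ i) + 1) (sym (clev i ≤2)) (proj₂ (U⁺-lev u)))
        only : ∀ i {u} → U⁺ u → E (k′ i) u → u ≡ k i
        only i (inj₁ u) e = ⊥-elim (proj₂ (far-by-level (proj₁ (U⊂ u)) (cC i ≤2) (ℕP.≤-trans (ℕP.≤-reflexive (clev i ≤2)) (proj₂ (U⊂ u)))) (E-sym e))
        only i (inj₂ (j , refl)) e with i ≟ᶠ j
        ... | yes refl = refl
        ... | no ne = ⊥-elim (proj₂ (cfar ne ≤2 ≤1) e)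
        via : ∀ i j → Walk G U (x i) (x j) → Walk G U⁺ (k i) (k j)
        via i j wk = step (inj₂ (i , refl)) (E-sym (cedge i ≤1)) (walk-snoc (walk-map inj₁ wk) (cedge j ≤1) (inj₂ (j , refl)))

      lower-tripod : Tripod L l′
      lower-tripod = tripod l l′ out (λ i → cedge i ≤3+) only (λ ne → cfar ne ≤2+ ≤2+)
        (walk-++ (descend 0F) (walk-reverse (descend 1F))) (walk-++ (descend 2F) (walk-reverse (descend 0F)))
        where
        out : ∀ i → ¬ L (l′ i)
        out i u = ℕP.<⇒≱ (ℕP.+-monoʳ-< (lev (l′ i)) (ℕP.n<1+n _)) (subst (lev (l′ i) + (3 + h) ≤_) (sym (clev i ≤2+)) (proj₂ (L-lev u)))
        only : ∀ i {u} → L u → E (l′ i) u → u ≡ l i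
        only i {u} (inj₁ (cu , le)) e = ⊥-elim (proj₂ (far-by-level (cC i ≤2+) cu
          (cancel (lev u) (2 + h) 2 _ (subst₂ (λ p q → lev u + p ≤ q) (arith h) (sym (clev i ≤2+)) le))) e)
          where
          arith : ∀ h → 4 + h ≡ (2 + h) + 2
          arith = solve-∀
        only i (inj₂ (j , refl)) e with i ≟ᶠ j
        ... | yes refl = refl
        ... | no ne = ⊥-elim (proj₂ (cfar ne ≤2+ ≤3+) e)
        descend : ∀ i → Walk G L (l i) root
        descend i = step (inj₂ (i , refl)) (cedge i ℕP.≤-refl)
          (walk-map (λ { (cv , le) → inj₁ (cv , ℕP.≤-trans (ℕP.+-monoˡ-≤ (4 + h) le) (ℕP.≤-reflexive (clev i ℕP.≤-refl))) })
            (toRoot _ (cC i ℕP.≤-refl) refl))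

      pyramid : Pyramid C ℓ
      pyramid = strut frame upper-tripod lower-tripod

-- The least d with P d, and N if P fails below N.
first : ∀ {P : ℕ → Set} → Decidable P → ℕ → ℕ
first P? zero = zero
first P? (suc N) with P? zero
... | yes _ = zero
... | no _ = suc (first (P? ∘ suc) N)

first-sat : ∀ {P : ℕ → Set} (P? : Decidable P) N {d} → P d → d ≤ N → P (first P? N)
first-sat P? zero p z≤n = p
first-sat P? (suc N) {d} p le with P? zero
... | yes p₀ = p₀
first-sat P? (suc N) {zero} p le | no ¬p = ⊥-elim (¬p p)
first-sat P? (suc N) {suc d} p (s≤s le) | no ¬p = first-sat (P? ∘ suc) N p le

first-≤ : ∀ {P : ℕ → Set} (P? : Decidable P) N {d} → P d → first P? N ≤ d
first-≤ P? zero p = z≤n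
first-≤ P? (suc N) {d} p with P? zero
... | yes _ = z≤n
first-≤ P? (suc N) {zero} p | no ¬p = ⊥-elim (¬p p)
first-≤ P? (suc N) {suc d} p | no _ = s≤s (first-≤ (P? ∘ suc) N p)

-- The tree of layer components

module LayerTree {n : ℕ} (G : Graph n) (signing : OddSignable G) {δ : ℕ} (deg : MaxDegree≤ G δ) (ℓ : ℕ) where

  open Paths G
  open PyramidSeparation G signing
  open Decompositions G
  open Metric G
  open Bounded G deg
  open Layering G signing deg ℓ

  -- Greedy choice of a vertex, of one outside its ball, and of one outside both balls; where the
  -- choice fails, the balls so far cover `S`.
  cluster : ∀ {S : V → Set} → Decidable S →
    (∃[ l ] (length l ≤ clusterBound × (∀ {v} → S v → v ∈ l) × (∀ {v} → v ∈ l → S v))) ⊎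
    Σ (Fin 3 → V) λ x → (∀ i → S (x i)) × (∀ {i j} → i ≢ j → ¬ Reach Anywhere reachBound (x i) (x j))
  cluster {S} S? with any? S?
  ... | no none = inj₁ ([] , z≤n , (λ s → ⊥-elim (none (_ , s))) , λ ())
  ... | yes (x , sx) with any? (λ y → S? y ×-dec ¬? (Any.any? (y ≟ᶠ_) (ball reachBound x)))
  ...   | no none = inj₁ (filter S? (ball reachBound x) ,
            ℕP.≤-trans (length-filter S? (ball reachBound x)) (ℕP.≤-trans (ball-length reachBound x) (ℕP.m≤m+n _ _)) ,
            (λ {v} s → ∈-filter⁺ S? (decidable-stable (Any.any? (v ≟ᶠ_) _) λ n → none (v , s , n)) s) ,
            λ i → proj₂ (∈-filter⁻ S? {xs = ball reachBound x} i))
  ...   | yes (y , sy , y∉) with any? (λ z → S? z ×-dec ¬? (Any.any? (z ≟ᶠ_) (ball reachBound x ++ ball reachBound y)))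
  ...     | no none = inj₁ (filter S? (ball reachBound x ++ ball reachBound y) ,
              ℕP.≤-trans (length-filter S? (ball reachBound x ++ ball reachBound y))
                (subst (_≤ clusterBound) (sym (length-++ (ball reachBound x))) (ℕP.+-mono-≤ (ball-length reachBound x) (ball-length reachBound y))) ,
              (λ {v} s → ∈-filter⁺ S? (decidable-stable (Any.any? (v ≟ᶠ_) _) λ n → none (v , s , n)) s) ,
              λ i → proj₂ (∈-filter⁻ S? {xs = ball reachBound x ++ ball reachBound y} i))
  ...     | yes (z , sz , z∉) = inj₂ (three x y z , each sx sy sz ,
              pairwise {λ i j → ¬ Reach Anywhere reachBound (three x y z i) (three x y z j)} (λ f r → f (reach-sym r))
                (λ r → y∉ (∈-ball r)) (λ r → z∉ (∈-++⁺ˡ (∈-ball r))) (λ r → z∉ (∈-++⁺ʳ (ball reachBound x) (∈-ball r))))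

  near-walk : ∀ {Y : V → Set} {s u v} → Y v → Near u v → Walk G Y s u → Walk G Y s v
  near-walk _ (inj₁ refl) wk = wk
  near-walk y (inj₂ e) wk = walk-snoc wk e y

  -- A bag consists of a cluster and one of its successors in the next layer.
  bagBound : ℕ
  bagBound = clusterBound + clusterBound

  module Build {C : V → Set} (levels : Levels C) where

    open Levels levels
    open WithLevels levels

    Below : List V → (V → Set) → Set
    Below P W = Σ (TD (λ v → v ∈ P ⊎ W v) _≡_ bagBound) λ D → ∃[ t ] ∀ {v} → v ∈ P → TD.In D t v

    -- P is a cluster of layer i, and W a union of components of the layers beyond i.
    build : ∀ (W : V → Set) (W? : Decidable W) → Acc _<_ (size W?) → ∀ i (P : List V) → length P ≤ clusterBound →
      (∀ {v} → v ∈ P → C v × lev v ≡ i) → (∀ {v} → W v → C v × suc i ≤ lev v) →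
      (∀ {x y} → W x → C y → E x y → suc i ≤ lev y → W y) → Below P W ⊎ Pyramid C ℓ
    build W W? (acc rec) i P lenP P-in W-in W-closed with any? W?
    ... | no none = inj₁ (single P (ℕP.≤-trans lenP (ℕP.m≤m+n _ _)) inj₁ (λ { (inj₁ v∈) → _ , v∈ , refl ; (inj₂ w) → ⊥-elim (none (_ , w)) }) ,
            0F , λ v∈ → _ , v∈ , refl)
    -- A component `U` of `W` is split off. Its vertices `S` in the first layer are the next
    -- cluster, the rest `W₁` of `U` hangs below that, and the other components `W₂` stay below `P`.
    ... | yes (w , ww) = withCluster (cluster S?)
      where
      U S : V → Set
      U v = Walk G W w v
      S v = U v × lev v ≡ suc i
      S? : Decidable S
      S? v = walk? W? w v ×-dec (lev v ℕP.≟ suc i)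
      U-in : ∀ {v} → U v → C v × suc i ≤ lev v
      U-in wk = W-in (walk-target wk)
      U-walk : ∀ {x y} → U x → U y → Walk G U x y
      U-walk ux uy = walk-++ (walk-reverse (stay ux)) (stay uy)
        where
        stay : ∀ {x} → U x → Walk G U w x
        stay wk = go (here (walk-source wk)) wk
          where
          go : ∀ {y x} → U y → Walk G W y x → Walk G U y x
          go uy (here _) = here uy
          go uy (step _ e r) = step uy e (go (walk-snoc uy e (walk-source r)) r)
      ascend : ∀ d {x} → W x → lev x ≡ d + suc i → ∃[ y ] (Walk G W x y × lev y ≡ suc i)
      ascend zero wx e = _ , here wx , e
      ascend (suc d) wx e with down (proj₁ (W-in wx)) e
      ... | y , cy , xy , ey with ascend d (W-closed wx cy xy (subst (suc i ≤_) (sym ey) (ℕP.m≤n+m (suc i) d))) ey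
      ...   | z , wk , ez = z , step wx xy wk , ez
      -- From `w` one can walk towards the root inside `W` until layer `suc i`. So `S` is nonempty,
      -- which makes `W₁` smaller than `W`.
      top : ∃[ y ] S y
      top with ascend (lev w ∸ suc i) ww (sym (ℕP.m∸n+n≡m (proj₂ (W-in ww))))
      ... | y , wk , e = y , wk , e
      W₁ W₂ : V → Set
      W₁ v = U v × lev v ≢ suc i
      W₂ v = W v × ¬ U v
      W₁? : Decidable W₁
      W₁? v = walk? W? w v ×-dec ¬? (lev v ℕP.≟ suc i)
      W₂? : Decidable W₂
      W₂? v = W? v ×-dec ¬? (walk? W? w v)
      far-layer : ∀ {u v} → u ∈ P → U v → lev v ≢ suc i → ¬ Near u v
      far-layer u∈ uv ne (inj₁ refl) = ℕP.<⇒≢ (proj₂ (U-in uv)) (sym (proj₂ (P-in u∈)))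
      far-layer u∈ uv ne (inj₂ e) = ℕP.<⇒≱ (ℕP.≤∧≢⇒< (proj₂ (U-in uv)) (ne ∘ sym))
        (subst (λ m → _ ≤ suc m) (proj₂ (P-in u∈)) (lipschitz (proj₁ (U-in uv)) (proj₁ (P-in u∈)) (E-sym e)))
      withCluster : _ → Below P W ⊎ Pyramid C ℓ
      withCluster (inj₂ (x , xS , apart)) = inj₂ (FarCluster.pyramid U-in x (λ j → proj₁ (xS j)) (λ j → proj₂ (xS j))
        (U-walk (proj₁ (xS _)) (proj₁ (xS _))) (U-walk (proj₁ (xS _)) (proj₁ (xS _))) apart)
      withCluster (inj₁ (Q , lenQ , S⇒Q , Q⇒S))
        with build W₁ W₁? (rec (size-< W₁? W? (walk-target ∘ proj₁) _ (walk-target (proj₁ (proj₂ top))) (λ w₁ → proj₂ w₁ (proj₂ (proj₂ top)))))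
               (suc i) Q lenQ (λ q → proj₁ (U-in (proj₁ (Q⇒S q))) , proj₂ (Q⇒S q))
               (λ w₁ → proj₁ (U-in (proj₁ w₁)) , ℕP.≤∧≢⇒< (proj₂ (U-in (proj₁ w₁))) (proj₂ w₁ ∘ sym))
               (λ { (ux , _) cy e le → walk-snoc ux e (W-closed (walk-target ux) cy e (ℕP.≤-trans (ℕP.n≤1+n _) le)) , λ eq → ℕP.<⇒≢ le (sym eq) })
           | build W₂ W₂? (rec (size-< W₂? W? proj₁ w ww (λ w₂ → proj₂ w₂ (here ww)))) i P lenP P-in (W-in ∘ proj₁)
               (λ { (wx , ¬ux) cy e le → W-closed wx cy e le , λ uy → ¬ux (walk-snoc uy (E-sym e) wx) })
      ... | inj₂ pyr | _ = inj₂ pyr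
      ... | inj₁ _ | inj₂ pyr = inj₂ pyr
      ... | inj₁ (A , s , hs) | inj₁ (B , t , ht) = inj₁ (whole (glue D₁ A 0F s upper⊂ inj-U edge₁ common₁ sat sat))
        where
        sat : ∀ {Y : V → Set} {Z : Set} {r v} → Y r → r ≡ v → Z → Y v
        sat {Y} y e _ = subst Y e y
        D₁ : TD (λ v → v ∈ P ++ Q) _≡_ bagBound
        D₁ = single (P ++ Q) (subst (_≤ bagBound) (sym (length-++ P)) (ℕP.+-mono-≤ lenP lenQ)) id (λ v∈ → _ , v∈ , refl)
        upper⊂ : ∀ {v} → v ∈ P ++ Q → v ∈ P ⊎ U v
        upper⊂ v∈ with ∈-++⁻ P v∈
        ... | inj₁ p = inj₁ p
        ... | inj₂ q = inj₂ (proj₁ (Q⇒S q))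
        inj-U : ∀ {v} → v ∈ Q ⊎ W₁ v → v ∈ P ⊎ U v
        inj-U (inj₁ q) = inj₂ (proj₁ (Q⇒S q))
        inj-U (inj₂ w₁) = inj₂ (proj₁ w₁)
        below : ∀ {v} → U v → v ∈ Q ⊎ W₁ v
        below {v} u with lev v ℕP.≟ suc i
        ... | yes e = inj₁ (S⇒Q (u , e))
        ... | no ne = inj₂ (u , ne)
        edge₁ : ∀ {u v} → u ∈ P ⊎ U u → v ∈ P ⊎ U v → Near u v →
          (u ∈ P ++ Q × v ∈ P ++ Q) ⊎ ((u ∈ Q ⊎ W₁ u) × (v ∈ Q ⊎ W₁ v))
        edge₁ (inj₁ p) (inj₁ p′) e = inj₁ (∈-++⁺ˡ p , ∈-++⁺ˡ p′)
        edge₁ (inj₂ u) (inj₂ v) e = inj₂ (below u , below v)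
        edge₁ (inj₁ p) (inj₂ u) e with below u
        ... | inj₁ q = inj₁ (∈-++⁺ˡ p , ∈-++⁺ʳ P q)
        ... | inj₂ (u′ , ne) = ⊥-elim (far-layer p u′ ne e)
        edge₁ (inj₂ u) (inj₁ p) e with below u
        ... | inj₁ q = inj₁ (∈-++⁺ʳ P q , ∈-++⁺ˡ p)
        ... | inj₂ (u′ , ne) = ⊥-elim (far-layer p u′ ne (near-sym e))
        common₁ : ∀ {v} → v ∈ P ++ Q → v ∈ Q ⊎ W₁ v → TD.In D₁ 0F v × TD.In A s v
        common₁ v∈ (inj₁ q) = (_ , v∈ , refl) , hs q
        common₁ v∈ (inj₂ (u , ne)) with ∈-++⁻ P v∈
        ... | inj₁ p = ⊥-elim (far-layer p u ne (inj₁ refl))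
        ... | inj₂ q = ⊥-elim (ne (proj₂ (Q⇒S q)))
        whole : Σ (TD (λ v → v ∈ P ⊎ U v) _≡_ bagBound) (λ D → ∀ u → ∃[ u′ ] ∀ {v} → TD.In D₁ u v → TD.In D u′ v) → Below P W
        whole (D₂ , lift₁) = retarget (glue D₂ B s₂ t (λ { (inj₁ p) → inj₁ p ; (inj₂ u) → inj₂ (walk-target u) })
            (λ { (inj₁ p) → inj₁ p ; (inj₂ w₂) → inj₂ (proj₁ w₂) }) edge₂ common₂ sat sat)
          where
          s₂ = proj₁ (lift₁ 0F)
          hs₂ : ∀ {v} → v ∈ P → TD.In D₂ s₂ v
          hs₂ p = proj₂ (lift₁ 0F) (_ , ∈-++⁺ˡ p , refl)
          edge₂ : ∀ {u v} → u ∈ P ⊎ W u → v ∈ P ⊎ W v → Near u v →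
            ((u ∈ P ⊎ U u) × (v ∈ P ⊎ U v)) ⊎ ((u ∈ P ⊎ W₂ u) × (v ∈ P ⊎ W₂ v))
          edge₂ (inj₁ p) (inj₁ p′) e = inj₁ (inj₁ p , inj₁ p′)
          edge₂ {_} {v} (inj₁ p) (inj₂ wv) e with walk? W? w v
          ... | yes u = inj₁ (inj₁ p , inj₂ u)
          ... | no ¬u = inj₂ (inj₁ p , inj₂ (wv , ¬u))
          edge₂ {u} (inj₂ wu) b e with walk? W? w u
          edge₂ (inj₂ wu) (inj₁ p) e | yes uu = inj₁ (inj₂ uu , inj₁ p)
          edge₂ (inj₂ wu) (inj₁ p) e | no ¬u = inj₂ (inj₂ (wu , ¬u) , inj₁ p)
          edge₂ (inj₂ wu) (inj₂ wv) e | yes uu = inj₁ (inj₂ uu , inj₂ (near-walk wv e uu))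
          edge₂ (inj₂ wu) (inj₂ wv) e | no ¬u = inj₂ (inj₂ (wu , ¬u) , inj₂ (wv , λ uv → ¬u (near-walk wu (near-sym e) uv)))
          common₂ : ∀ {v} → v ∈ P ⊎ U v → v ∈ P ⊎ W₂ v → TD.In D₂ s₂ v × TD.In B t v
          common₂ (inj₁ p) _ = hs₂ p , ht p
          common₂ _ (inj₁ p) = hs₂ p , ht p
          common₂ (inj₂ u) (inj₂ (_ , ¬u)) = ⊥-elim (¬u u)
          retarget : _ → Below P W
          retarget (D₃ , lift₂) = D₃ , proj₁ (lift₂ s₂) , λ p → proj₂ (lift₂ s₂) (hs₂ p)

    layerTree : TD C _≡_ bagBound ⊎ Pyramid C ℓ
    layerTree with build (λ v → C v × 1 ≤ lev v) (λ v → C? v ×-dec (1 ℕP.≤? lev v)) (<-wellFounded _) 0 (root ∷ [])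
        (ℕP.≤-trans (ballBound-positive reachBound) (ℕP.m≤m+n _ _)) (λ { (here refl) → rootIn , root-lev }) id (λ _ c _ le → c , le)
      where
      ballBound-positive : ∀ d → 1 ≤ ballBound δ d
      ballBound-positive zero = s≤s z≤n
      ballBound-positive (suc d) = s≤s z≤n
    ... | inj₂ pyr = inj₂ pyr
    ... | inj₁ (D , _) = inj₁ (transport (λ { (inj₁ (here refl)) → rootIn ; (inj₂ (c , _)) → c }) back D)
      where
      back : ∀ {v} → C v → v ∈ root ∷ [] ⊎ (C v × 1 ≤ lev v)
      back {v} c with lev v in eq
      ... | zero = inj₁ (here (lev-root c eq))
      ... | suc d = inj₂ (c , s≤s z≤n)

  -- The search for the distance may stop at `n`, since `walk⇒reach` reaches every vertex of the
  -- component within `n` steps.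
  distanceLevels : ∀ {β : V → Set} → Decidable β → ∀ {s} → β s → Levels (Walk G β s)
  distanceLevels {β} β? {s} sβ = record
    { C? = walk? β? s ; root = s ; rootIn = here sβ ; lev = lev ; root-lev = ℕP.n≤0⇒n≡0 (lev-≤ (stop sβ))
    ; lev-root = λ {x} wk e → at-zero (subst (λ d → Reach β d s x) e (lev-reach wk))
    ; down = down
    ; lipschitz = λ cx cy e → lev-≤ (reach-snoc (lev-reach cy) (E-sym e) (walk-target cx)) }
    where
    lev : V → ℕ
    lev x = first (λ d → reach? β? d s x) n
    lev-≤ : ∀ {d x} → Reach β d s x → lev x ≤ d
    lev-≤ {d} {x} = first-≤ (λ d → reach? β? d s x) n
    lev-reach : ∀ {x} → Walk G β s x → Reach β (lev x) s x
    lev-reach {x} wk = first-sat (λ d → reach? β? d s x) n (walk⇒reach wk) ℕP.≤-refl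
    at-zero : ∀ {x} → Reach β 0 s x → x ≡ s
    at-zero (stop _) = refl
    down : ∀ {x d} → Walk G β s x → lev x ≡ suc d → ∃[ y ] (Walk G β s y × E x y × lev y ≡ d)
    down {x} {d} wk e with reach-sym (subst (λ d → Reach β d s x) e (lev-reach wk))
    ... | stop y = ⊥-elim (absurd (ℕP.≤-trans (ℕP.≤-reflexive (sym e)) (lev-≤ (stop y))))
      where
      absurd : ∀ {d} → suc d ≤ 0 → ⊥
      absurd ()
    ... | hop {w = y} xβ xy r = y , reach⇒walk (reach-sym r) , xy , ℕP.≤-antisym (lev-≤ (reach-sym r))
      (ℕP.≤-pred (subst (_≤ suc (lev y)) e (lev-≤ (reach-snoc (lev-reach (reach⇒walk (reach-sym r))) (E-sym xy) xβ))))

  decompose : ∀ (β : V → Set) (β? : Decidable β) → TD β _≡_ bagBound ⊎ Pyramid β ℓ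
  decompose β β? = go β β? (<-wellFounded _)
    where
    node : ∀ {Y : V → Set} {k} (D : TD Y _≡_ k) → Fin (TD.m D)
    node D = fromℕ< (proj₁ (TD.isTree D))
    go : ∀ (β : V → Set) (β? : Decidable β) → Acc _<_ (size β?) → TD β _≡_ bagBound ⊎ Pyramid β ℓ
    go β β? (acc rec) with any? β?
    ... | no none = inj₁ (single [] z≤n (λ ()) λ b → ⊥-elim (none (_ , b)))
    ... | yes (s , sβ) with Build.layerTree (distanceLevels β? sβ)
           | go (λ v → β v × ¬ Walk G β s v) (λ v → β? v ×-dec ¬? (walk? β? s v))
                (rec (size-< (λ v → β? v ×-dec ¬? (walk? β? s v)) β? proj₁ s sβ (λ c → proj₂ c (here sβ))))
    ...   | inj₂ pyr | _ = inj₂ (pyramid-map walk-target pyr)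
    ...   | inj₁ _ | inj₂ pyr = inj₂ (pyramid-map proj₁ pyr)
    -- The component of `s` and the rest share no vertex, so any two nodes may be joined.
    ...   | inj₁ A | inj₁ B = inj₁ (proj₁ (glue A B (node A) (node B) walk-target proj₁ edge (λ c d → ⊥-elim (proj₂ d c))
              (λ y e _ → subst (Walk G β s) e y) (λ y e _ → subst (λ v → β v × ¬ Walk G β s v) e y)))
      where
      edge : ∀ {u v} → β u → β v → Near u v → (Walk G β s u × Walk G β s v) ⊎ ((β u × ¬ Walk G β s u) × (β v × ¬ Walk G β s v))
      edge {u} {v} uβ vβ e with walk? β? s u
      ... | yes wk = inj₁ (wk , near-walk vβ e wk)
      ... | no ¬wk = inj₂ ((uβ , ¬wk) , vβ , λ wk → ¬wk (near-walk uβ (near-sym e) wk))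

-- Greedy colouring

fresh : ∀ {M} (l : List (Fin M)) → length l < M → ∃[ c ] ¬ c ∈ l
fresh {M} l lt with any? (λ c → ¬? (Any.any? (c ≟ᶠ_) l))
... | yes (c , c∉) = c , c∉
... | no none = ⊥-elim (ℕP.<⇒≱ lt (injective⇒≤ {f = λ c → Any.index (all c)} λ {c} {d} e →
    trans (lookup-index (all c)) (trans (cong (lookup l) e) (sym (lookup-index (all d))))))
  where
  all : ∀ c → c ∈ l
  all c = decidable-stable (Any.any? (c ≟ᶠ_) l) λ n → none (c , n)

module Colouring {n : ℕ} (G : Graph n) {δ : ℕ} (deg : MaxDegree≤ G δ) (d : ℕ) where

  open Metric G
  open Bounded G deg

  M : ℕ
  M = suc (ballBound δ d)

  colouring : Σ (Fin n → Fin M) λ col → ∀ {u v} → Reach Anywhere d u v → col u ≡ col v → u ≡ v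
  colouring with greedy (allFin n)
    where
    greedy : ∀ l → Σ (Fin n → Fin M) λ col → ∀ {u v} → u ∈ l → v ∈ l → Reach Anywhere d u v → col u ≡ col v → u ≡ v
    greedy [] = (λ _ → 0F) , λ ()
    greedy (x ∷ l) with greedy l
    -- There are more colours than vertices in a ball, so one of them is free for `x`.
    ... | col , ok with fresh (map col (ball d x)) (s≤s (subst (_≤ ballBound δ d) (sym (length-map col (ball d x))) (ball-length d x)))
    ...   | c , c∉ = col′ , ok′
      where
      col′ : Fin n → Fin M
      col′ u with u ≟ᶠ x
      ... | yes _ = c
      ... | no _ = col u
      tail : ∀ {u} → u ∈ x ∷ l → u ≢ x → u ∈ l
      tail (here e) ne = ⊥-elim (ne e)
      tail (there i) ne = i
      ok′ : ∀ {u v} → u ∈ x ∷ l → v ∈ x ∷ l → Reach Anywhere d u v → col′ u ≡ col′ v → u ≡ v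
      ok′ {u} {v} i j r e with u ≟ᶠ x | v ≟ᶠ x
      ... | yes refl | yes refl = refl
      ... | yes refl | no _ = ⊥-elim (c∉ (subst (_∈ map col (ball d x)) (sym e) (∈-map⁺ col (∈-ball r))))
      ... | no _ | yes refl = ⊥-elim (c∉ (subst (_∈ map col (ball d x)) e (∈-map⁺ col (∈-ball (reach-sym r)))))
      ... | no u≢ | no v≢ = ok (tail i u≢) (tail j v≢) r e
  ... | col , ok = col , ok (∈-allFin _) (∈-allFin _)

-- Bags as subsets, and the final bound

listSubset : ∀ {n} → List (Fin n) → Subset n
listSubset [] = ∅
listSubset (x ∷ l) = ⁅ x ⁆ ∪ listSubset l

∈-listSubset : ∀ {n} {l : List (Fin n)} {x} → x ∈ l → x ∈ˢ listSubset l
∈-listSubset {l = x ∷ l} (here refl) = x∈p∪q⁺ (inj₁ (x∈⁅x⁆ x))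
∈-listSubset {l = x ∷ l} (there i) = x∈p∪q⁺ (inj₂ (∈-listSubset i))

∈-listSubset⁻ : ∀ {n} (l : List (Fin n)) {x} → x ∈ˢ listSubset l → x ∈ l
∈-listSubset⁻ [] i = ⊥-elim (∉⊥ i)
∈-listSubset⁻ (y ∷ l) i with x∈p∪q⁻ ⁅ y ⁆ (listSubset l) i
... | inj₁ j = here (x∈⁅y⁆⇒x≡y y j)
... | inj₂ j = there (∈-listSubset⁻ l j)

∣p∪q∣≤∣p∣+∣q∣ : ∀ {n} (p q : Subset n) → ∣ p ∪ q ∣ ≤ ∣ p ∣ + ∣ q ∣
∣p∪q∣≤∣p∣+∣q∣ [] [] = z≤n
∣p∪q∣≤∣p∣+∣q∣ (false ∷ p) (false ∷ q) = ∣p∪q∣≤∣p∣+∣q∣ p q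
∣p∪q∣≤∣p∣+∣q∣ (false ∷ p) (true ∷ q) = subst (suc ∣ p ∪ q ∣ ≤_) (sym (ℕP.+-suc ∣ p ∣ ∣ q ∣)) (s≤s (∣p∪q∣≤∣p∣+∣q∣ p q))
∣p∪q∣≤∣p∣+∣q∣ (true ∷ p) (false ∷ q) = s≤s (∣p∪q∣≤∣p∣+∣q∣ p q)
∣p∪q∣≤∣p∣+∣q∣ (true ∷ p) (true ∷ q) = s≤s (ℕP.≤-trans (∣p∪q∣≤∣p∣+∣q∣ p q) (ℕP.+-monoʳ-≤ ∣ p ∣ (ℕP.n≤1+n ∣ q ∣)))

listSubset-size : ∀ {n} (l : List (Fin n)) → ∣ listSubset l ∣ ≤ length l
listSubset-size {n} [] = ℕP.≤-reflexive (∣⊥∣≡0 n)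
listSubset-size (x ∷ l) = ℕP.≤-trans (∣p∪q∣≤∣p∣+∣q∣ ⁅ x ⁆ (listSubset l))
  (ℕP.+-mono-≤ (ℕP.≤-reflexive (∣⁅x⁆∣≡1 x)) (listSubset-size l))

colourPairs : (δ : ℕ) → List (Fin (suc (ballBound δ 12)) × Fin (suc (ballBound δ 12)))
colourPairs δ = cartesianProduct (allFin _) (allFin _)

treewidthBound : ℕ → ℕ
treewidthBound δ = widthAfter δ (colourPairs δ) (clusterSize δ (pathLength δ) + clusterSize δ (pathLength δ))

theorem1p2 : ∀ (δ : ℕ) → ∃[ k ] ∀ (n : ℕ) (G : Graph n) → C4Free G → OddSignable G → MaxDegree≤ G δ → TreewidthAtMost G k
theorem1p2 δ = treewidthBound δ , λ n G _ signing deg →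
  let open Decompositions G
      col , proper = Colouring.colouring G deg 12
      open Splitting G signing deg col proper
      D = eliminate-all (colourPairs δ)
            (λ β β? → [ inj₁ , (λ P → inj₂ (P , ∈-cartesianProduct⁺ (∈-allFin _) (∈-allFin _))) ]′
              (LayerTree.decompose G signing deg (pathLength δ) β β?))
            (λ _ → ⊤) (λ _ → yes tt)
      open TD D
      member : ∀ {t v} → In t v → v ∈ˢ listSubset (reps t)
      member = λ { (_ , i , refl) → ∈-listSubset i }
      inBag : ∀ {t v} → v ∈ˢ listSubset (reps t) → In t v
      inBag = λ {t} i → _ , ∈-listSubset⁻ (reps t) i , refl
  in record
    { m = m ; T = tree ; χ = λ t → listSubset (reps t) ; isTree = isTree
    ; cover = λ v → let t , i , _ = cover {v} {v} tt tt (inj₁ refl) in t , member i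
    ; edges = λ u v e → let t , i , j = cover {u} {v} tt tt (inj₂ e) in t , member i , member j
    ; subtree = λ v s t i j → walk-map member (conn {v} {s} {t} tt (inBag i) (inBag j)) }
  , λ t → ℕP.≤-trans (listSubset-size (reps t)) (ℕP.≤-trans (width t) (ℕP.n≤1+n _))
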